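{- There is an absolute constant $C$ such that for every positive integer $w$, $$\operatorname{val}(\mathcal P_w) \le w^{6.5 \lg w + C}.$$
   Context: An on-line poset $P^{\prec}=(V,\le_P,\prec)$ is a finite poset $P=(V,\le_P)$ together with a linear order $\prec$ of $V$ (the presentation order). An on-line chain partitioning algorithm $\mathcal A$ is a deterministic algorithm that assigns the vertices $v_1\prec\dots\prec v_n$ to disjoint chains $C_1,\dots,C_t$ so that, for each $i$, the chain to which $v_i$ is assigned is determined solely by the induced subposet $P[\{v_1,\dots,v_i\}]$ (with the order of presentation); assignments are irrevocable. Let $\chi_{\mathcal A}(P^\prec)$ be the number of nonempty chains $\mathcal A$ uses on $P^\prec$, $\chi_{\mathcal A}(P)=\max_\prec \chi_{\mathcal A}(P^\prec)$ over all presentation orders, and for a class $\mathcal P$ of posets, $\operatorname{val}_{\mathcal A}(\mathcal P)=\max_{P\in\mathcal P}\chi_{\mathcal A}(P)$ and $\operatorname{val}(\mathcal P)=\min_{\mathcal A}\operatorname{val}_{\mathcal A}(\mathcal P)$ over all on-line chain partitioning algorithms. $\mathcal P_w$ denotes the class of finite posets of width $w$. $\lg$ denotes the logarithm to base $2$. -}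

module Defs where

open import Data.Nat using (ℕ; suc; _≤_; _*_; _+_; _^_)
open import Data.Nat.Logarithm using (⌊log₂_⌋)
open import Data.Fin using (Fin; toℕ; inject≤)
open import Data.Fin.Properties using (toℕ<n)
open import Data.Bool using (Bool; T)
open import Data.Product using (Σ; ∃; _×_)
open import Data.Sum using (_⊎_)
open import Relation.Nullary using (¬_)
open import Relation.Binary.PropositionalEquality using (_≡_; _≢_)

-- An on-line poset with n vertices.  WLOG the vertex set is Fin n and the
-- presentation order ≺ is the index order 0 ≺ 1 ≺ … ≺ n-1 (every on-line
-- poset is isomorphic to such a one).  The partial order is a Boolean relation.
record OnlinePoset (n : ℕ) : Set where
  field
    le      : Fin n → Fin n → Bool
    reflexive : ∀ x → T (le x x)
    antisym : ∀ x y → T (le x y) → T (le y x) → x ≡ y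
    transitive : ∀ x y z → T (le x y) → T (le y z) → T (le x z)

open OnlinePoset public

Comparable : ∀ {n} → OnlinePoset n → Fin n → Fin n → Set
Comparable P x y = T (le P x y) ⊎ T (le P y x)

-- g lists k pairwise incomparable (hence distinct) vertices
IsAntichain : ∀ {n k} → OnlinePoset n → (Fin k → Fin n) → Set
IsAntichain {k = k} P g = ∀ (i j : Fin k) → i ≢ j → ¬ Comparable P (g i) (g j)

HasWidth : ∀ {n} → OnlinePoset n → ℕ → Set
HasWidth {n} P w =
  (Σ (Fin w → Fin n) λ g → IsAntichain P g)
  × (∀ (g : Fin (suc w) → Fin n) → ¬ IsAntichain P g)

-- A deterministic on-line chain partitioning algorithm: when the (k+1)-st
-- vertex arrives, it sees only the induced subposet on the first k+1
-- presented vertices (labelled 0..k in presentation order, the new vertex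
-- being k) and outputs the label (ℕ) of the chain receiving the new vertex.
OnlineAlgorithm : Set
OnlineAlgorithm = (k : ℕ) → (Fin (suc k) → Fin (suc k) → Bool) → ℕ

prefix : ∀ {n} → OnlinePoset n → (i : Fin n) →
         Fin (suc (toℕ i)) → Fin (suc (toℕ i)) → Bool
prefix P i a b = le P (inject≤ a (toℕ<n i)) (inject≤ b (toℕ<n i))

assign : ∀ {n} → OnlineAlgorithm → OnlinePoset n → Fin n → ℕ
assign A P i = A (toℕ i) (prefix P i)

IsChainPartition : ∀ {n} → OnlineAlgorithm → OnlinePoset n → Set
IsChainPartition A P = ∀ i j → assign A P i ≡ assign A P j → Comparable P i j

-- A uses at most N (nonempty) chains on P: the set of used labels injects into Fin N
UsesAtMost : ∀ {n} → OnlineAlgorithm → OnlinePoset n → ℕ → Set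
UsesAtMost A P N = Σ (ℕ → Fin N) λ f →
  ∀ i j → f (assign A P i) ≡ f (assign A P j) → assign A P i ≡ assign A P j

ValAtMost : ℕ → ℕ → Set
ValAtMost w N = Σ OnlineAlgorithm λ A →
  ∀ (n : ℕ) (P : OnlinePoset n) → HasWidth P w →
    IsChainPartition A P × UsesAtMost A P N

{-# OPTIONS --safe #-}
module Submission where

-- The vertex x is given the stage s, the largest s such that x completes an antichain of s vertices of smaller stage;
-- the vertices of stage at most s then always have width at most s, so each stage s can be handled on its own, in a
-- poset of width s. There the algorithm inserts a maximum antichain (a level) through x between two consecutive earlier
-- levels; this is possible because, by Dilworth's theorem, maximum antichains can be clamped chain by chain. Comparabilities
-- of consecutive levels are kept only if they lie in a perfect matching, and x is coloured by First-Fit with respect to the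
-- transitive closure ≺ of what is kept.
--
-- Two facts bound the number of colours. First, ≺ has no long ladder x₁ ≺ x₂ ≺ …, y₁ ≺ y₂ ≺ …, xᵢ ≺ yᵢ, xⱼ ∥ yᵢ for i < j:
-- the up-set of y₁ separates the xⱼ from the yᵢ, a kept edge leaving its complement lies in a perfect matching, and so the
-- number of points outside the up-set drops from level to level; at most 2s rungs cross one interval of the tree of levels
-- directly, whence at most 2s² + 1 rungs. Second, the colour classes form a wall: each vertex of colour j has, for each i < j,
-- an incomparable vertex of colour i. In an order without ladders of m + 1 rungs that is covered by fewer than 2ˡ⁺¹ chains,
-- the restriction of a wall to a convex set keeps a 1/r² fraction of its colours, r = O(2ˡ m). If a vertex t has many colours
-- above it before a position hi, then few colours are seen after hi not above t, since otherwise two disjoint sets of chains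
-- would each have to carry a large wall and one of them has fewer than 2ˡ chains. So the witnesses incomparable to t crowd
-- around t, on whose chain few colours occur there; repeating this uses up all chains one after the other, and
-- F (l + 1) = O(16ˡ m² F l) for the largest number F l of colours of a wall on fewer than 2ˡ chains.

open import Defs
open import Data.Bool using (Bool; false; T)
open import Data.Bool.Properties using (T?)
open import Data.Empty using (⊥; ⊥-elim)
open import Data.Fin using (Fin; toℕ; fromℕ<) renaming (zero to fzero; suc to fsuc)
import Data.Fin.Properties as Fin
open import Data.List using (List; []; _∷_; length; filter; map; _++_; reverse; take; drop; allFin)
open import Data.List.Membership.Propositional using (_∈_; find; lose)
open import Data.List.Membership.Propositional.Properties using (∈-filter⁺; ∈-filter⁻; ∈-map⁺; ∈-map⁻; ∈-++⁺ˡ; ∈-++⁺ʳ; ∈-allFin; ∈-downFrom⁻)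
open import Data.List.Properties using (length-filter; filter-all; length-map; length-take; length-drop; length-reverse; filter-notAll; filter-some; unfold-reverse; length-tabulate; length-downFrom)
open import Data.List.Relation.Unary.All using (All; []; _∷_)
import Data.List.Relation.Unary.All as All
import Data.List.Relation.Unary.All.Properties as All
open import Data.List.Relation.Unary.AllPairs using (AllPairs; []; _∷_)
import Data.List.Relation.Unary.Any.Properties as Any
import Data.List.Relation.Unary.AllPairs as AllPairs
import Data.List.Relation.Unary.AllPairs.Properties as AllPairs
open import Data.List.Relation.Unary.Any using (Any; here; there; any?)
open import Data.Nat using (ℕ; NonZero; >-nonZero; ⌊_/2⌋; ⌈_/2⌉; zero; suc; _+_; _*_; _∸_; _^_; _≤_; _<_; _>_; z≤n; s≤s; _≤?_; _<?_; _≟_; _⊔_)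
open import Data.Nat.Logarithm using (⌊log₂_⌋; ⌊log₂⌋-mono-≤; ⌊log₂⌊n/2⌋⌋≡⌊log₂n⌋∸1; ⌊log₂[2^n]⌋≡n)
open import Data.Nat.Properties hiding (_≟_; _≤?_; _<?_)
open import Data.Nat.DivMod using (_%_; [m+kn]%n≡m%n; m<n⇒m%n≡m)
open import Data.Nat.Tactic.RingSolver using (solve-∀)
open import Data.Product using (Σ; Σ-syntax; ∃; ∃-syntax; _×_; _,_; proj₁; proj₂; swap)
open import Data.Sum using (_⊎_; inj₁; inj₂; [_,_]′)
open import Data.Unit using (⊤; tt)
open import Function using (_∘_; id; flip)
open import Relation.Binary.PropositionalEquality using (_≡_; _≢_; _≗_; refl; sym; trans; cong; cong₂; subst; subst₂)
open import Relation.Nullary using (¬_; Dec; yes; no; ¬?; ⌊_⌋; _×-dec_; _⊎-dec_)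
open import Relation.Nullary.Decidable using (map′; toWitness; fromWitness)

variable
  A B : Set

-- Lists and finite search

count : {P : A → Set} → (∀ x → Dec (P x)) → List A → ℕ
count P? xs = length (filter P? xs)

length≡0 : (xs : List A) → (∀ {x} → x ∈ xs → ⊥) → length xs ≤ 0
length≡0 []      _ = z≤n
length≡0 (x ∷ _) h = ⊥-elim (h (here refl))

at-most-one : {R : A → A → Set} (xs : List A) → AllPairs R xs →
              (∀ {x y} → x ∈ xs → y ∈ xs → ¬ R x y) → length xs ≤ 1
at-most-one []          _             _ = z≤n
at-most-one (_ ∷ [])    _             _ = s≤s z≤n
at-most-one (_ ∷ _ ∷ _) ((r ∷ _) ∷ _) h = ⊥-elim (h (here refl) (there (here refl)) r)

count-union : {P Q R : A → Set} (P? : ∀ x → Dec (P x)) (Q? : ∀ x → Dec (Q x)) (R? : ∀ x → Dec (R x)) (xs : List A) →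
              (∀ {x} → x ∈ xs → P x → Q x ⊎ R x) → count P? xs ≤ count Q? xs + count R? xs
count-union P? Q? R? []       _ = z≤n
count-union P? Q? R? (x ∷ xs) h with P? x | Q? x | R? x | count-union P? Q? R? xs (h ∘ there)
... | yes _ | yes _ | yes _ | ih = s≤s (≤-trans ih (+-monoʳ-≤ _ (n≤1+n _)))
... | yes _ | yes _ | no  _ | ih = s≤s ih
... | yes _ | no  _ | yes _ | ih = ≤-trans (s≤s ih) (≤-reflexive (sym (+-suc (count Q? xs) (count R? xs))))
... | yes p | no ¬q | no ¬r | _  = ⊥-elim ([ ¬q , ¬r ]′ (h (here refl) p))
... | no  _ | yes _ | yes _ | ih = m≤n⇒m≤1+n (≤-trans ih (+-monoʳ-≤ _ (n≤1+n _)))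
... | no  _ | yes _ | no  _ | ih = m≤n⇒m≤1+n ih
... | no  _ | no  _ | yes _ | ih = ≤-trans (m≤n⇒m≤1+n ih) (≤-reflexive (sym (+-suc (count Q? xs) (count R? xs))))
... | no  _ | no  _ | no  _ | ih = ih

count-cover : {Q R : A → Set} (Q? : ∀ x → Dec (Q x)) (R? : ∀ x → Dec (R x)) (xs : List A) →
              (∀ {x} → x ∈ xs → Q x ⊎ R x) → length xs ≤ count Q? xs + count R? xs
count-cover Q? R? xs h = subst (_≤ count Q? xs + count R? xs) (cong length (filter-all all? {xs = xs} (All.tabulate λ _ → tt)))
  (count-union all? Q? R? xs λ x∈ _ → h x∈)
  where
  all? : ∀ _ → Dec ⊤
  all? _ = yes tt

count-disjoint : {P Q : A → Set} (P? : ∀ x → Dec (P x)) (Q? : ∀ x → Dec (Q x)) (xs : List A) →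
                 (∀ {x} → x ∈ xs → P x → ¬ Q x) → count P? xs + count Q? xs ≤ length xs
count-disjoint P? Q? []       _ = z≤n
count-disjoint P? Q? (x ∷ xs) h with P? x | Q? x | count-disjoint P? Q? xs (h ∘ there)
... | yes p | yes q | _  = ⊥-elim (h (here refl) p q)
... | yes _ | no  _ | ih = s≤s ih
... | no  _ | yes _ | ih = ≤-trans (≤-reflexive (+-suc (count P? xs) (count Q? xs))) (s≤s ih)
... | no  _ | no  _ | ih = m≤n⇒m≤1+n ih

count-filter : {P Q : A → Set} (P? : ∀ x → Dec (P x)) (Q? : ∀ x → Dec (Q x)) (xs : List A) →
               count P? (filter Q? xs) ≤ count P? xs
count-filter P? Q? []       = z≤n
count-filter P? Q? (x ∷ xs) with Q? x
... | yes _ with P? x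
...   | yes _ = s≤s (count-filter P? Q? xs)
...   | no  _ = count-filter P? Q? xs
count-filter P? Q? (x ∷ xs) | no _ with P? x
...   | yes _ = m≤n⇒m≤1+n (count-filter P? Q? xs)
...   | no  _ = count-filter P? Q? xs

count-mono : {P Q : A → Set} (P? : ∀ x → Dec (P x)) (Q? : ∀ x → Dec (Q x)) (xs : List A) →
             (∀ {x} → x ∈ xs → P x → Q x) → count P? xs ≤ count Q? xs
count-mono P? Q? []       _ = z≤n
count-mono P? Q? (x ∷ xs) h with P? x | Q? x | count-mono P? Q? xs (h ∘ there)
... | yes _ | yes _ | ih = s≤s ih
... | yes p | no ¬q | _  = ⊥-elim (¬q (h (here refl) p))
... | no  _ | yes _ | ih = m≤n⇒m≤1+n ih
... | no  _ | no  _ | ih = ih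

count-< : {P Q : A → Set} (P? : ∀ x → Dec (P x)) (Q? : ∀ x → Dec (Q x)) (xs : List A) →
          count P? xs < count Q? xs → ∃[ x ] x ∈ xs × Q x × ¬ P x
count-< P? Q? xs lt with any? (λ x → Q? x ×-dec ¬? (P? x)) xs
... | yes a = find a
... | no ¬a = ⊥-elim (<⇒≱ lt (count-mono Q? P? xs λ {x} x∈ q → sat x x∈ q))
  where
  sat : ∀ x → x ∈ xs → _ → _
  sat x x∈ q with P? x
  ... | yes p = p
  ... | no ¬p = ⊥-elim (¬a (lose x∈ (q , ¬p)))

averaging : {H : A → B → Set} (H? : ∀ x d → Dec (H x d)) (W : List B) (m : ℕ) (xs : List A) →
            (∀ {x} → x ∈ xs → ∃[ d ] d ∈ W × H x d) →
            (∀ {d} → d ∈ W → count (λ x → H? x d) xs ≤ m) →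
            length xs ≤ length W * m
averaging H? []      m xs cov _ = length≡0 xs λ x∈ → case-⊥ (cov x∈)
  where
  case-⊥ : ∀ {P : _ → Set} → ∃[ d ] d ∈ [] × P d → ⊥
  case-⊥ (_ , () , _)
averaging {H = H} H? (d ∷ W) m xs cov bd =
  ≤-trans (count-cover (λ x → H? x d) N? xs split) (+-mono-≤ (bd (here refl)) rest)
  where
  N? = λ x → ¬? (H? x d)
  split : ∀ {x} → x ∈ xs → H x d ⊎ ¬ H x d
  split {x} _ with H? x d
  ... | yes h = inj₁ h
  ... | no ¬h = inj₂ ¬h
  rest : count N? xs ≤ length W * m
  rest = averaging H? W m (filter N? xs)
    (λ x∈ → let x∈xs , ¬h = ∈-filter⁻ N? {xs = xs} x∈ in other ¬h (cov x∈xs))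
    (λ {e} e∈ → ≤-trans (count-filter (λ x → H? x e) N? xs) (bd (there e∈)))
    where
    other : ∀ {x} → ¬ H x d → ∃[ e ] e ∈ d ∷ W × H x e → ∃[ e ] e ∈ W × H x e
    other ¬h (_ , here refl , h) = ⊥-elim (¬h h)
    other ¬h (e , there e∈ , h) = e , e∈ , h

pairs-length : {R : A → A → Set} {H : A → B → Set} (H? : ∀ x d → Dec (H x d)) (W : List B) (xs : List A) →
               AllPairs R xs → (∀ {x} → x ∈ xs → ∃[ d ] d ∈ W × H x d) →
               (∀ {x y d} → x ∈ xs → y ∈ xs → H x d → H y d → ¬ R x y) → length xs ≤ length W
pairs-length H? W xs ap cov h = subst (length xs ≤_) (*-identityʳ _)
  (averaging H? W 1 xs cov λ {d} _ →
    at-most-one (filter (λ x → H? x d) xs) (AllPairs.filter⁺ (λ x → H? x d) ap)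
      λ x∈ y∈ → let x∈′ , hx = ∈-filter⁻ (λ x → H? x d) {xs = xs} x∈
                    y∈′ , hy = ∈-filter⁻ (λ x → H? x d) {xs = xs} y∈ in h x∈′ y∈′ hx hy)

unique-length : (_≟A_ : (x y : A) → Dec (x ≡ y)) (xs ys : List A) → AllPairs _≢_ xs →
                (∀ {x} → x ∈ xs → x ∈ ys) → length xs ≤ length ys
unique-length _≟A_ xs ys u sub = pairs-length _≟A_ ys xs u (λ {x} x∈ → x , sub x∈ , refl)
  λ { _ _ refl refl x≢x → x≢x refl }

-- Downward search from `b`: where `f` overshoots `K`, its value one step earlier still reaches `K`,
-- because `f` rises by at most one per step.
discrete-ivt : (f : ℕ → ℕ) (K b : ℕ) → f 0 ≤ K → (∀ n → f (suc n) ≤ suc (f n)) → K ≤ f b → ∃[ h ] h ≤ b × f h ≡ K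
discrete-ivt f K b f0 step Kb with K <? f b
... | no K≮ = b , ≤-refl , ≤-antisym (≮⇒≥ K≮) Kb
discrete-ivt f K zero    f0 step Kb | yes K< = ⊥-elim (<⇒≱ K< f0)
discrete-ivt f K (suc b) f0 step Kb | yes K< with discrete-ivt f K b f0 step (≤-pred (≤-trans K< (step b)))
... | h , h≤ , eq = h , m≤n⇒m≤1+n h≤ , eq

least : {P : ℕ → Set} (P? : ∀ n → Dec (P n)) (n : ℕ) → P n → ∃[ m ] P m × (∀ {i} → i < m → ¬ P i)
least P? n p with P? 0
... | yes p0 = 0 , p0 , λ ()
least P? zero    p | no ¬p0 = ⊥-elim (¬p0 p)
least {P} P? (suc n) p | no ¬p0 with least (P? ∘ suc) n p
... | m , pm , below = suc m , pm , λ { {zero} _ → ¬p0 ; {suc i} (s≤s lt) → below lt }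

allPairs-reverse : {R : A → A → Set} (xs : List A) → AllPairs R xs → AllPairs (flip R) (reverse xs)
allPairs-reverse []       []       = []
allPairs-reverse {R = R} (x ∷ xs) (r ∷ rs) = subst (AllPairs (flip R)) (sym (unfold-reverse x xs))
  (AllPairs.++⁺ (allPairs-reverse xs rs) ([] ∷ []) (All.tabulate λ y∈ → All.lookup r (Any.reverse⁻ y∈) ∷ []))

allPairs-zip : {R S : A → A → Set} (xs : List A) → AllPairs R xs →
               (∀ {x y} → x ∈ xs → y ∈ xs → R x y → S x y) → AllPairs S xs
allPairs-zip []       []       _ = []
allPairs-zip (x ∷ xs) (r ∷ rs) f =
  All.tabulate (λ y∈ → f (here refl) (there y∈) (All.lookup r y∈)) ∷ allPairs-zip xs rs (λ x∈ y∈ → f (there x∈) (there y∈))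

take-⊆ : ∀ n {x : A} {xs : List A} → x ∈ take n xs → x ∈ xs
take-⊆ (suc n) {xs = _ ∷ _} (here e)  = here e
take-⊆ (suc n) {xs = _ ∷ _} (there m) = there (take-⊆ n m)

drop-⊆ : ∀ n {x : A} {xs : List A} → x ∈ drop n xs → x ∈ xs
drop-⊆ zero    m = m
drop-⊆ (suc n) {xs = _ ∷ _} m = there (drop-⊆ n m)

take-drop-R : {R : A → A → Set} (n : ℕ) {xs : List A} → AllPairs R xs →
              ∀ {x y} → x ∈ take n xs → y ∈ drop n xs → R x y
take-drop-R (suc n) {_ ∷ _} (r ∷ _)  (here refl) y∈ = All.lookup r (drop-⊆ n y∈)
take-drop-R (suc n) {_ ∷ _} (_ ∷ rs) (there x∈)  y∈ = take-drop-R n rs x∈ y∈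

strict-bound : (f : A → ℕ) (xs : List A) → ∃[ n ] (∀ {x} → x ∈ xs → f x < n)
strict-bound f []       = 0 , λ ()
strict-bound f (x ∷ xs) with strict-bound f xs
... | n , below = suc (f x) ⊔ n , λ { (here refl) → m≤m⊔n (suc (f x)) n ; (there y∈) → ≤-trans (below y∈) (m≤n⊔m (suc (f x)) n) }


-- Walls

-- The elements without an `E`-predecessor form an independent layer, and prepending a predecessor
-- shows that chains among the others are shorter by one. So `r` layers exhaust `xs`, and a largest
-- layer is returned. Sequences may repeat elements, hence the bound on chains also excludes loops
-- of `E`.
mirsky : {E R : A → A → Set} (E? : ∀ x y → Dec (E x y)) (E-trans : ∀ {x y z} → E x y → E y z → E x z)
         (r : ℕ) (xs : List A) → AllPairs R xs →
         (∀ ps → AllPairs E ps → (∀ {p} → p ∈ ps → p ∈ xs) → length ps ≤ r) →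
         ∃[ ys ] (∀ {y} → y ∈ ys → y ∈ xs) × AllPairs R ys × (length xs ≤ r * length ys)
           × (∀ {x y} → x ∈ ys → y ∈ ys → ¬ E x y)
mirsky E? E-trans zero    [] _ _ = [] , (λ ()) , [] , z≤n , (λ ())
mirsky E? E-trans zero    (x ∷ xs) _ h = ⊥-elim (n≮0 (h (x ∷ []) ([] ∷ []) λ { (here e) → here e }))
mirsky {E = E} {R} E? E-trans (suc r) xs Rxs h with mirsky E? E-trans r rest (AllPairs.filter⁺ pred? Rxs) h′
  where
  pred? : ∀ x → Dec (Any (λ y → E y x) xs)
  pred? x = any? (λ y → E? y x) xs
  rest = filter pred? xs
  h′ : ∀ ps → AllPairs E ps → (∀ {p} → p ∈ ps → p ∈ rest) → length ps ≤ r
  h′ []       _        _   = z≤n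
  h′ (p ∷ ps) (e ∷ es) sub =
    let y , y∈ , yp = find (proj₂ (∈-filter⁻ pred? {xs = xs} (sub (here refl))))
    in ≤-pred (h (y ∷ p ∷ ps) ((yp ∷ All.map (E-trans yp) e) ∷ e ∷ es)
        λ { (here refl) → y∈ ; (there p∈) → proj₁ (∈-filter⁻ pred? {xs = xs} (sub p∈)) })
... | ys , ys⊆ , Rys , len , indep = pick (≤-total (length ys) (length src))
  where
  pred? : ∀ x → Dec (Any (λ y → E y x) xs)
  pred? x = any? (λ y → E? y x) xs
  src = filter (λ x → ¬? (pred? x)) xs
  src⊆ : ∀ {x} → x ∈ src → x ∈ xs × ¬ Any (λ y → E y x) xs
  src⊆ = ∈-filter⁻ (λ x → ¬? (pred? x)) {xs = xs}
  total : length xs ≤ length src + r * length ys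
  total = ≤-trans (count-cover (λ x → ¬? (pred? x)) pred? xs (λ {x} _ → dec (pred? x)))
                  (+-monoʳ-≤ (length src) len)
    where
    dec : ∀ {X : Set} → Dec X → ¬ X ⊎ X
    dec (yes p) = inj₂ p
    dec (no ¬p) = inj₁ ¬p
  pick : length ys ≤ length src ⊎ length src ≤ length ys →
         ∃[ zs ] (∀ {y} → y ∈ zs → y ∈ xs) × AllPairs R zs × (length xs ≤ suc r * length zs)
           × (∀ {x y} → x ∈ zs → y ∈ zs → ¬ E x y)
  pick (inj₁ ys≤) = src , proj₁ ∘ src⊆ , AllPairs.filter⁺ (λ x → ¬? (pred? x)) Rxs
    , ≤-trans total (+-monoʳ-≤ (length src) (*-monoʳ-≤ r ys≤))
    , λ x∈ y∈ e → proj₂ (src⊆ y∈) (lose (proj₁ (src⊆ x∈)) e)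
  pick (inj₂ src≤) = ys , (λ y∈ → proj₁ (∈-filter⁻ pred? {xs = xs} (ys⊆ y∈))) , Rys
    , ≤-trans total (+-monoˡ-≤ _ src≤) , indep

Rung : {V : Set} (_⊏_ : V → V → Set) → V × V → V × V → Set
Rung _⊏_ (x , y) (x′ , y′) = x ⊏ x′ × y ⊏ y′ × ¬ x′ ⊏ y × ¬ y ⊏ x′

LadderFree : {V : Set} (_⊏_ : V → V → Set) → ℕ → Set
LadderFree {V} _⊏_ m = (zs : List (V × V)) → All (λ z → proj₁ z ⊏ proj₂ z) zs → AllPairs (Rung _⊏_) zs → length zs ≤ m

-- Duality exchanges the two sides of a ladder and reverses the order of its rungs; therefore the
-- list is both swapped and reversed.
ladderFree-flip : {V : Set} {_⊏_ : V → V → Set} {m : ℕ} → LadderFree _⊏_ m → LadderFree (flip _⊏_) m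
ladderFree-flip {V} {_⊏_} {m} free zs all ap = subst (_≤ m) (trans (length-reverse ws) (length-map swap zs))
  (free (reverse ws) (All.tabulate λ {z} z∈ → good (Any.reverse⁻ z∈)) (allPairs-reverse ws (AllPairs.map⁺ (AllPairs.map f ap))))
  where
  ws = map swap zs
  good : ∀ {z} → z ∈ ws → proj₁ z ⊏ proj₂ z
  good z∈ with ∈-map⁻ swap z∈
  ... | _ , z′∈ , refl = All.lookup all z′∈
  f : ∀ {z z′} → Rung (flip _⊏_) z z′ → Rung _⊏_ (swap z′) (swap z)
  f (a , b , c , d) = b , a , c , d

record FiniteOrder : Set₁ where
  field
    V       : Set
    vs      : List V
    ∈-vs    : ∀ v → v ∈ vs
    _⊏_     : V → V → Set
    _⊏?_    : ∀ u v → Dec (u ⊏ v)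
    ⊏-trans : ∀ {u v w} → u ⊏ v → v ⊏ w → u ⊏ w
    ⊏-irr   : ∀ {u} → ¬ u ⊏ u

  -- The fibres of `f` are chains. Colourings and chain covers are both handled in this form.
  Alike : {C : Set} → (V → C) → Set
  Alike f = ∀ {u v} → f u ≡ f v → u ≡ v ⊎ (u ⊏ v ⊎ v ⊏ u)

  ⊏-asym : ∀ {u v} → u ⊏ v → ¬ v ⊏ u
  ⊏-asym p q = ⊏-irr (⊏-trans p q)

dual : FiniteOrder → FiniteOrder
dual O = record { FiniteOrder O hiding (_⊏_; _⊏?_; ⊏-trans) ; _⊏_ = flip _⊏_ ; _⊏?_ = flip _⊏?_ ; ⊏-trans = flip ⊏-trans }
  where open FiniteOrder O

module Colouring (O : FiniteOrder) (g : FiniteOrder.V O → ℕ) (g-alike : FiniteOrder.Alike O g) where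
  open FiniteOrder O

  _∥_ : V → V → Set
  u ∥ v = ¬ u ⊏ v × ¬ v ⊏ u

  -- The First-Fit property relative to a vertex set and a list of colours. Dropping colours keeps a
  -- wall at once (`wall-⊆`); dropping vertices may destroy witnesses and is the difficult
  -- operation.
  record Wall (S : V → Set) (J : List ℕ) : Set where
    constructor wall
    field
      descending : AllPairs _>_ J
      witness    : ∀ {v i} → S v → g v ∈ J → i ∈ J → i < g v → ∃[ u ] S u × g u ≡ i × u ∥ v
  open Wall public

  Hit : (V → Set) → ℕ → Set
  Hit S i = ∃[ u ] S u × g u ≡ i

  hit? : {S : V → Set} → (∀ v → Dec (S v)) → ∀ i → Dec (Hit S i)
  hit? S? i = map′ (λ a → let u , _ , h = find a in u , h) (λ (u , h) → lose (∈-vs u) h)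
    (any? (λ u → S? u ×-dec (g u ≟ i)) vs)

  Minimum : (V → Set) → V → Set
  Minimum P c = P c × (∀ {u} → P u → u ≡ c ⊎ c ⊏ u)

  minimum : {P : V → Set} → (∀ v → Dec (P v)) → (∀ {u v} → P u → P v → u ≡ v ⊎ (u ⊏ v ⊎ v ⊏ u)) →
            ∀ {v} → P v → ∃[ c ] Minimum P c
  minimum {P} P? comp {v} Pv = let c , Pc , low = go vs in c , Pc , λ {u} → low (∈-vs u)
    where
    go : ∀ us → ∃[ c ] P c × (∀ {u} → u ∈ us → P u → u ≡ c ⊎ c ⊏ u)
    go [] = v , Pv , λ ()
    go (u ∷ us) with go us | P? u
    ... | c , Pc , low | no ¬Pu = c , Pc , λ { (here refl) Pu → ⊥-elim (¬Pu Pu) ; (there u∈) → low u∈ }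
    ... | c , Pc , low | yes Pu with comp Pu Pc
    ...   | inj₁ u≡c = c , Pc , λ { (here refl) _ → inj₁ u≡c ; (there u∈) → low u∈ }
    ...   | inj₂ (inj₂ c⊏u) = c , Pc , λ { (here refl) _ → inj₂ c⊏u ; (there u∈) → low u∈ }
    ...   | inj₂ (inj₁ u⊏c) = u , Pu , λ { (here refl) _ → inj₁ refl ; (there w∈) Pw → inj₂ (above (low w∈ Pw)) }
      where
      above : ∀ {w} → w ≡ c ⊎ c ⊏ w → u ⊏ w
      above (inj₁ refl) = u⊏c
      above (inj₂ c⊏w)  = ⊏-trans u⊏c c⊏w

-- Restricting a wall to an up-set

module HalfWall (O : FiniteOrder) (g : FiniteOrder.V O → ℕ) (g-alike : FiniteOrder.Alike O g)
                {C : Set} (_≟C_ : (c d : C) → Dec (c ≡ d)) (δ : FiniteOrder.V O → C) (δ-alike : FiniteOrder.Alike O δ)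
                (m : ℕ) (free : LadderFree (FiniteOrder._⊏_ O) m) where
  open FiniteOrder O
  open Colouring O g g-alike

  -- Discard colours until the minimum of a larger colour is never below that of a smaller one;
  -- then the minimum replaces any witness that lies outside the up-set U.
  half : {S U : V → Set} → (∀ v → Dec (S v)) → (∀ v → Dec (U v)) →
         (∀ {u v} → U u → u ⊏ v → U v) → (W : List C) → (∀ {v} → S v → δ v ∈ W) →
         {J : List ℕ} → Wall S J → (∀ {i} → i ∈ J → Hit (λ v → S v × U v) i) →
         ∃[ J′ ] (∀ {i} → i ∈ J′ → i ∈ J) × length J ≤ suc (length W * m) * length J′ × Wall (λ v → S v × U v) J′
  half {S} {U} S? U? up W SW {J} wl hits =
    let cs , eq , mins = choose J hits
        ys , ys⊆ , Rys , len , indep = mirsky {R = λ c d → g c > g d} (λ c d → (g c <? g d) ×-dec (d ⊏? c))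
          (λ (a , b) (c , d) → <-trans a c , ⊏-trans d b) (suc (length W * m)) cs
          (AllPairs.map⁻ (subst (AllPairs _>_) (sym eq) (descending wl)))
          (path-bound λ c∈ → mins c∈ , subst (_ ∈_) eq (∈-map⁺ g c∈))
    in map g ys
     , (λ i∈ → let c , c∈ , e = ∈-map⁻ g i∈ in subst (_ ∈_) eq (subst (_∈ map g cs) (sym e) (∈-map⁺ g (ys⊆ c∈))))
     , subst₂ (λ a b → a ≤ suc (length W * m) * b) (trans (sym (length-map g cs)) (cong length eq)) (sym (length-map g ys)) len
     , wall (AllPairs.map⁺ Rys) (wit cs eq mins ys ys⊆ indep)
    where
    S′ : V → Set
    S′ v = S v × U v

    Min : V → Set
    Min c = Minimum (λ v → S′ v × g v ≡ g c) c

    choose : ∀ I → (∀ {i} → i ∈ I → Hit S′ i) → ∃[ cs ] map g cs ≡ I × (∀ {c} → c ∈ cs → Min c)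
    choose []      _ = [] , refl , λ ()
    choose (i ∷ I) h with choose I (h ∘ there) | h (here refl)
    ... | cs , eq , mins | u , Su , refl
      with minimum {P = λ v → S′ v × g v ≡ g u} (λ v → (S? v ×-dec U? v) ×-dec (g v ≟ g u))
                   (λ (_ , a) (_ , b) → g-alike (trans a (sym b))) (Su , refl)
    ... | c , (Sc , gc) , low = c ∷ cs , cong₂ _∷_ gc eq
        , λ { (here refl) → (Sc , refl) , (λ (Sv , gv) → low (Sv , trans gv gc)) ; (there c∈) → mins c∈ }

    E : V → V → Set
    E c d = g c < g d × d ⊏ c

    Good : V × V → Set
    Good (z , c) = S z × ¬ U z × z ⊏ c × U c

    Before : V × V → V × V → Set
    Before (z , c) (z′ , c′) = c′ ⊏ c × ¬ z ⊏ c′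

    -- For consecutive `c`, `d` on an `E`-path, the wall gives `z` of the colour of `c` incomparable
    -- to `d`. Both lie in one colour class and `d ⊏ c`, so `z ⊏ c`; since `c` is least of its
    -- colour in `U`, the vertex `z` is outside `U`.
    path : ∀ c ps → AllPairs E (c ∷ ps) → (∀ {p} → p ∈ c ∷ ps → Min p × g p ∈ J) →
           ∃[ zs ] length ps ≡ length zs × All Good zs × AllPairs Before zs × All (λ z → proj₂ z ∈ c ∷ ps) zs
    path c []       _ _ = [] , refl , [] , [] , []
    path c (d ∷ ps) ((cd ∷ cps) ∷ dps@(dE ∷ _)) mins with path d ps dps (mins ∘ there) | witness wl
        (proj₁ (proj₁ (proj₁ (proj₁ (mins (there (here refl)))))))
        (proj₂ (mins (there (here refl)))) (proj₂ (mins (here refl))) (proj₁ cd)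
    ... | zs , len , good , bef , from | z , Sz , gz , z⋢d , d⋢z =
      (z , c) ∷ zs , cong suc len , (Sz , ¬Uz , z⊏c , Uc) ∷ good
      , All.map (λ {p} → later {p}) from ∷ bef , here refl ∷ All.map there from
      where
      Uc = proj₂ (proj₁ (proj₁ (proj₁ (mins (here refl)))))
      c-low = proj₂ (proj₁ (mins (here refl)))
      z⊏c : z ⊏ c
      z⊏c with g-alike gz
      ... | inj₁ refl = ⊥-elim (d⋢z (proj₂ cd))
      ... | inj₂ (inj₁ lt) = lt
      ... | inj₂ (inj₂ gt) = ⊥-elim (d⋢z (⊏-trans (proj₂ cd) gt))
      ¬Uz : ¬ U z
      ¬Uz Uz with c-low ((Sz , Uz) , gz)
      ... | inj₁ refl = ⊏-irr z⊏c
      ... | inj₂ lt   = ⊏-asym lt z⊏c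
      later : ∀ {p : V × V} → proj₂ p ∈ d ∷ ps → Before (z , c) p
      later {_ , e} (here refl) = proj₂ cd , z⋢d
      later {_ , e} (there e∈)  = proj₂ (All.lookup cps e∈) , λ z⊏e → z⋢d (⊏-trans z⊏e (proj₂ (All.lookup dE e∈)))

    -- Pairs whose lower points share a chain of the cover form a ladder when read backwards:
    -- `c′ ⊏ z` would pull `z` into the up-set `U`. So each chain of `W` carries at most `m` pairs.
    pairs-bound : ∀ zs → All Good zs → AllPairs Before zs → length zs ≤ length W * m
    pairs-bound zs good bef = averaging {H = λ z d → δ (proj₁ z) ≡ d} (λ z d → δ (proj₁ z) ≟C d) W m zs
      (λ {z} z∈ → δ (proj₁ z) , SW (proj₁ (All.lookup good z∈)) , refl)
      λ {d} _ → chain d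
      where
      chain : ∀ d → length (filter (λ z → δ (proj₁ z) ≟C d) zs) ≤ m
      chain d = subst (_≤ m) (length-reverse ws) (free (reverse ws)
          (All.tabulate λ z∈ → proj₁ (proj₂ (proj₂ (good′ (Any.reverse⁻ z∈)))))
          (allPairs-reverse {R = flip (Rung _⊏_)} ws
             (allPairs-zip ws (AllPairs.filter⁺ (λ z → δ (proj₁ z) ≟C d) bef) rung)))
        where
        ws = filter (λ z → δ (proj₁ z) ≟C d) zs
        split : ∀ {z} → z ∈ ws → z ∈ zs × δ (proj₁ z) ≡ d
        split = ∈-filter⁻ (λ z → δ (proj₁ z) ≟C d) {xs = zs}
        good′ : ∀ {z} → z ∈ ws → Good z
        good′ z∈ = All.lookup good (proj₁ (split z∈))
        rung : ∀ {p q} → p ∈ ws → q ∈ ws → Before p q → Rung _⊏_ q p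
        rung {z , c} {z′ , c′} p∈ q∈ (c′⊏c , z⋢c′) with good′ p∈ | good′ q∈
        ... | _ , ¬Uz , z⊏c , Uc | _ , ¬Uz′ , z′⊏c′ , Uc′ =
          z′⊏z (δ-alike (trans (proj₂ (split p∈)) (sym (proj₂ (split q∈))))) , c′⊏c , z⋢c′ , λ c′⊏z → ¬Uz (up Uc′ c′⊏z)
          where
          z′⊏z : z ≡ z′ ⊎ (z ⊏ z′ ⊎ z′ ⊏ z) → z′ ⊏ z
          z′⊏z (inj₁ refl)      = ⊥-elim (z⋢c′ z′⊏c′)
          z′⊏z (inj₂ (inj₁ lt)) = ⊥-elim (z⋢c′ (⊏-trans lt z′⊏c′))
          z′⊏z (inj₂ (inj₂ gt)) = gt

    path-bound : ∀ {cs} → (∀ {c} → c ∈ cs → Min c × g c ∈ J) → ∀ ps → AllPairs E ps → (∀ {p} → p ∈ ps → p ∈ cs) →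
                 length ps ≤ suc (length W * m)
    path-bound mins []       _  _   = z≤n
    path-bound mins (p ∷ ps) ap sub with path p ps ap (mins ∘ sub)
    ... | zs , len , good , bef , _ = s≤s (subst (_≤ length W * m) (sym len) (pairs-bound zs good bef))

    wit : ∀ cs → map g cs ≡ J → (∀ {c} → c ∈ cs → Min c) → ∀ ys → (∀ {y} → y ∈ ys → y ∈ cs) →
          (∀ {x y} → x ∈ ys → y ∈ ys → ¬ E x y) →
          ∀ {v i} → S′ v → g v ∈ map g ys → i ∈ map g ys → i < g v → ∃[ u ] S′ u × g u ≡ i × u ∥ v
    wit cs eq mins ys ys⊆ indep {v} (Sv , Uv) gv∈ i∈ lt with ∈-map⁻ g gv∈ | ∈-map⁻ g i∈
    ... | d , d∈ , gv≡ | c , c∈ , refl with witness wl Sv (in-J d∈ gv≡) (in-J c∈ refl) lt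
      where
      in-J : ∀ {y i} → y ∈ ys → i ≡ g y → i ∈ J
      in-J y∈ e = subst (_ ∈_) eq (subst (_∈ map g cs) (sym e) (∈-map⁺ g (ys⊆ y∈)))
    ... | u , Su , gu , u⋢v , v⋢u with U? u
    ... | yes Uu = u , (Su , Uu) , gu , u⋢v , v⋢u
    -- The witness `u` lies below `c`, the least vertex of its colour in the up-set, so `c ⊏ v`
    -- would give `u ⊏ v`. And `v ⊏ c` would put the least vertex `d` of the larger colour below
    -- `c`, which `indep` forbids.
    ... | no ¬Uu = c , proj₁ (proj₁ (mins (ys⊆ c∈))) , refl , c⋢v , v⋢c
      where
      u⊏c : u ⊏ c
      u⊏c with g-alike gu
      ... | inj₁ refl = ⊥-elim (¬Uu (proj₂ (proj₁ (proj₁ (mins (ys⊆ c∈))))))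
      ... | inj₂ (inj₁ l) = l
      ... | inj₂ (inj₂ r) = ⊥-elim (¬Uu (up (proj₂ (proj₁ (proj₁ (mins (ys⊆ c∈))))) r))
      c⋢v : ¬ c ⊏ v
      c⋢v c⊏v = u⋢v (⊏-trans u⊏c c⊏v)
      v⋢c : ¬ v ⊏ c
      v⋢c v⊏c with proj₂ (mins (ys⊆ d∈)) ((Sv , Uv) , gv≡)
      ... | inj₁ refl = indep c∈ d∈ (lt , v⊏c)
      ... | inj₂ d⊏v  = indep c∈ d∈ (subst (g c <_) gv≡ lt , ⊏-trans d⊏v v⊏c)


-- F l bounds the number of colours of a wall on fewer than 2 ^ l chains. A convex set that sees K l colours meets at
-- least 2 ^ l chains, and every round of the search in Step consumes Q l colours.
module Growth (m : ℕ) where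
  R K Q F : ℕ → ℕ
  R l = 2 ^ suc l * suc m
  K l = suc (R l * (R l * F l))
  Q l = (K l + K l) + (2 ^ suc l * (K l + K l) + 2 ^ suc l * (K l + K l))
  F zero    = 1
  F (suc l) = 2 ^ suc l * Q l

-- Bounding the number of colours of a wall

module WallBound (O : FiniteOrder) (g : FiniteOrder.V O → ℕ) (g-alike : FiniteOrder.Alike O g)
                 {C : Set} (_≟C_ : (c d : C) → Dec (c ≡ d)) (δ : FiniteOrder.V O → C) (δ-alike : FiniteOrder.Alike O δ)
                 (m : ℕ) (free : LadderFree (FiniteOrder._⊏_ O) m)
                 (pos : FiniteOrder.V O → ℕ) (pos-mono : ∀ {u v} → FiniteOrder._⊏_ O u v → pos u < pos v)
                 (pos-inj : ∀ {u v} → pos u ≡ pos v → u ≡ v) where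
  open FiniteOrder O
  open Colouring O g g-alike
  private
    module Up = HalfWall O g g-alike _≟C_ δ δ-alike m free
    swap-alike : {D : Set} {f : V → D} → Alike f → ∀ {u v} → f u ≡ f v → u ≡ v ⊎ (v ⊏ u ⊎ u ⊏ v)
    swap-alike al e with al e
    ... | inj₁ eq       = inj₁ eq
    ... | inj₂ (inj₁ l) = inj₂ (inj₂ l)
    ... | inj₂ (inj₂ r) = inj₂ (inj₁ r)
    module Down = HalfWall (dual O) g (swap-alike g-alike) _≟C_ δ (swap-alike δ-alike) m (ladderFree-flip free)
    module DualColouring = Colouring (dual O) g (swap-alike g-alike)

  wall-dual : ∀ {S J} → Wall S J → DualColouring.Wall S J
  wall-dual wl = DualColouring.wall (descending wl) λ Sv gv∈ i∈ lt → let u , Su , e , a , b = witness wl Sv gv∈ i∈ lt in u , Su , e , b , a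

  wall-undual : ∀ {S J} → DualColouring.Wall S J → Wall S J
  wall-undual wl = wall (DualColouring.descending wl) λ Sv gv∈ i∈ lt →
    let u , Su , e , a , b = DualColouring.witness wl Sv gv∈ i∈ lt in u , Su , e , b , a

  wall-⊆ : ∀ {S J J′} → AllPairs _>_ J′ → (∀ {i} → i ∈ J′ → i ∈ J) → Wall S J → Wall S J′
  wall-⊆ desc sub wl = wall desc λ Sv gv∈ i∈ → witness wl Sv (sub gv∈) (sub i∈)

  -- A convex set is an up-set cut with a down-set: `half` is applied once to the order and once to
  -- its dual, each time at the cost of a factor `r`. Colours missing from the intersection are
  -- discarded first, so both applications find every remaining colour.
  convex : {S U Z : V → Set} → (S? : ∀ v → Dec (S v)) (U? : ∀ v → Dec (U v)) (Z? : ∀ v → Dec (Z v)) →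
           (∀ {u v} → U u → u ⊏ v → U v) → (∀ {u v} → Z v → u ⊏ v → Z u) →
           (W : List C) → (∀ {v} → S v → δ v ∈ W) →
           {J : List ℕ} → Wall S J →
           ∃[ J′ ] count (hit? (λ v → (S? v ×-dec U? v) ×-dec Z? v)) J ≤ suc (length W * m) * (suc (length W * m) * length J′)
             × Wall (λ v → (S v × U v) × Z v) J′ × (∀ {i} → i ∈ J′ → Hit (λ v → (S v × U v) × Z v) i)
  convex {S} {U} {Z} S? U? Z? up down W SW {J} wl = first (Up.half S? U? up W SW wl₁ hits₁)
    where
    r = suc (length W * m)
    SU S′ : V → Set
    SU v = S v × U v
    S′ v = SU v × Z v
    SU? : ∀ v → Dec (SU v)
    SU? v = S? v ×-dec U? v
    S′? : ∀ v → Dec (S′ v)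
    S′? v = SU? v ×-dec Z? v
    J₁ = filter (hit? S′?) J
    in-J₁ : ∀ {i} → i ∈ J₁ → i ∈ J × Hit S′ i
    in-J₁ = ∈-filter⁻ (hit? S′?) {xs = J}
    hits₁ : ∀ {i} → i ∈ J₁ → Hit SU i
    hits₁ i∈ with in-J₁ i∈
    ... | _ , u , (SUu , _) , e = u , SUu , e
    wl₁ : Wall S J₁
    wl₁ = wall-⊆ (AllPairs.filter⁺ (hit? S′?) (descending wl)) (proj₁ ∘ in-J₁) wl
    second : ∀ {J₂} → (∀ {i} → i ∈ J₂ → i ∈ J₁) → length J₁ ≤ r * length J₂ →
             ∃[ J′ ] (∀ {i} → i ∈ J′ → i ∈ J₂) × length J₂ ≤ r * length J′ × DualColouring.Wall S′ J′ →
             ∃[ J′ ] length J₁ ≤ r * (r * length J′) × Wall S′ J′ × (∀ {i} → i ∈ J′ → Hit S′ i)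
    second sub₂ len₂ (J₃ , sub₃ , len₃ , wl₃) =
      J₃ , ≤-trans len₂ (*-monoʳ-≤ r len₃) , wall-undual wl₃ , λ i∈ → proj₂ (in-J₁ (sub₂ (sub₃ i∈)))
    first : ∃[ J′ ] (∀ {i} → i ∈ J′ → i ∈ J₁) × length J₁ ≤ r * length J′ × Wall SU J′ →
            ∃[ J′ ] length J₁ ≤ r * (r * length J′) × Wall S′ J′ × (∀ {i} → i ∈ J′ → Hit S′ i)
    first (J₂ , sub₂ , len₂ , wl₂) = second sub₂ len₂
      (Down.half SU? Z? down W (SW ∘ proj₁) (wall-dual wl₂) (λ i∈ → proj₂ (in-J₁ (sub₂ i∈))))

  open Growth m

  Bounded : ℕ → Set₁
  Bounded l = {S : V → Set} (S? : ∀ v → Dec (S v)) (W : List C) → length W < 2 ^ l → (∀ {v} → S v → δ v ∈ W) →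
              {J : List ℕ} → Wall S J → (∀ {i} → i ∈ J → Hit S i) → length J ≤ F l

  -- As `pos` is injective, position `q` holds at most one vertex and so contributes at most one
  -- colour.
  count-pos : {P P′ : V → Set} (P? : ∀ v → Dec (P v)) (P′? : ∀ v → Dec (P′ v)) (q : ℕ) →
              (∀ {u} → P′ u → P u ⊎ pos u ≡ q) → {I : List ℕ} → AllPairs _>_ I →
              count (hit? P′?) I ≤ suc (count (hit? P?) I)
  count-pos P? P′? q h {I} desc =
    ≤-trans (count-union (hit? P′?) (hit? at?) (hit? P?) I
              λ { _ (u , P′u , e) → [ (λ Pu → inj₂ (u , Pu , e)) , (λ eq → inj₁ (u , eq , e)) ]′ (h P′u) })
            (+-monoˡ-≤ _ (at-most-one (filter (hit? at?) I) (AllPairs.filter⁺ (hit? at?) desc)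
              λ x∈ y∈ → same (proj₂ (∈-filter⁻ (hit? at?) {xs = I} x∈)) (proj₂ (∈-filter⁻ (hit? at?) {xs = I} y∈))))
    where
    at? : ∀ u → Dec (pos u ≡ q)
    at? u = pos u ≟ q
    same : ∀ {i j} → Hit (λ u → pos u ≡ q) i → Hit (λ u → pos u ≡ q) j → ¬ i > j
    same (u , pu , refl) (v , pv , refl) gt = >⇒≢ gt (cong g (pos-inj (trans pu (sym pv))))

  desc-unique : ∀ {I} → AllPairs _>_ I → AllPairs _≢_ I
  desc-unique = AllPairs.map >⇒≢

  count-⊆ : {P : ℕ → Set} (P? : ∀ i → Dec (P i)) {I J : List ℕ} → AllPairs _>_ I → (∀ {i} → i ∈ I → i ∈ J) →
            count P? I ≤ count P? J
  count-⊆ P? {I} desc sub = unique-length _≟_ _ _ (desc-unique (AllPairs.filter⁺ P? desc))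
    λ i∈ → let i∈I , p = ∈-filter⁻ P? {xs = I} i∈ in ∈-filter⁺ P? (sub i∈I) p

  hit-mono : {P P′ : V → Set} → (∀ {u} → P u → P′ u) → ∀ {i} → Hit P i → Hit P′ i
  hit-mono f (u , Pu , e) = u , f Pu , e

  module Step (l : ℕ) (ih : Bounded l) {S : V → Set} (S? : ∀ v → Dec (S v)) (W : List C) (W< : length W < 2 ^ suc l)
              (SW : ∀ {v} → S v → δ v ∈ W) {J : List ℕ} (wl : Wall S J) (hits : ∀ {i} → i ∈ J → Hit S i) where

    used? : {P : V → Set} → (∀ v → Dec (P v)) → ∀ d → Dec (Any (λ v → P v × δ v ≡ d) vs)
    used? P? d = any? (λ v → P? v ×-dec (δ v ≟C d)) vs

    -- Otherwise the wall extracted by `convex` lives on fewer than `2 ^ l` chains; by induction it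
    -- has at most `F l` colours, and the two factors `R l` leave one colour less than `K l`.
    many-chains : {U Z : V → Set} (U? : ∀ v → Dec (U v)) (Z? : ∀ v → Dec (Z v)) →
                  (∀ {u v} → U u → u ⊏ v → U v) → (∀ {u v} → Z v → u ⊏ v → Z u) →
                  K l ≤ count (hit? (λ v → (S? v ×-dec U? v) ×-dec Z? v)) J →
                  2 ^ l ≤ count (used? (λ v → (S? v ×-dec U? v) ×-dec Z? v)) W
    many-chains {U} {Z} U? Z? up down rich = go (2 ^ l ≤? count (used? S′?) W)
      where
      S′? = λ v → (S? v ×-dec U? v) ×-dec Z? v
      r≤ : suc (length W * m) ≤ R l
      r≤ = subst (suc (length W * m) ≤_) (sym (*-suc (2 ^ suc l) m))
             (+-mono-≤ (m^n>0 2 (suc l)) (*-monoˡ-≤ m (<⇒≤ W<)))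
      go : Dec (2 ^ l ≤ count (used? S′?) W) → 2 ^ l ≤ count (used? S′?) W
      go (yes ok) = ok
      go (no few) = ⊥-elim (<⇒≱ rich (absurd (convex S? U? Z? up down W SW wl)))
        where
        absurd : ∃[ J′ ] count (hit? S′?) J ≤ suc (length W * m) * (suc (length W * m) * length J′)
                   × Wall (λ v → (S v × U v) × Z v) J′ × (∀ {i} → i ∈ J′ → Hit (λ v → (S v × U v) × Z v) i) →
                 count (hit? S′?) J ≤ R l * (R l * F l)
        absurd (J′ , len , wl′ , hits′) = ≤-trans len (*-mono-≤ r≤ (*-mono-≤ r≤
          (ih S′? (filter (used? S′?) W) (≰⇒> few)
             (λ {v} p → ∈-filter⁺ (used? S′?) (SW (proj₁ (proj₁ p))) (lose (∈-vs v) (p , refl))) wl′ hits′)))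

    -- Two sets without a common chain: one of them meets fewer than 2 ^ l chains of W.
    rich-poor : {U Z U′ Z′ : V → Set} (U? : ∀ v → Dec (U v)) (Z? : ∀ v → Dec (Z v)) (U′? : ∀ v → Dec (U′ v)) (Z′? : ∀ v → Dec (Z′ v)) →
                (∀ {u v} → U u → u ⊏ v → U v) → (∀ {u v} → Z v → u ⊏ v → Z u) →
                (∀ {u v} → U′ u → u ⊏ v → U′ v) → (∀ {u v} → Z′ v → u ⊏ v → Z′ u) →
                (∀ {u v} → U u → Z u → U′ v → Z′ v → δ u ≢ δ v) →
                K l ≤ count (hit? (λ v → (S? v ×-dec U? v) ×-dec Z? v)) J →
                count (hit? (λ v → (S? v ×-dec U′? v) ×-dec Z′? v)) J < K l
    rich-poor U? Z? U′? Z′? up down up′ down′ apart rich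
      with K l ≤? count (hit? (λ v → (S? v ×-dec U′? v) ×-dec Z′? v)) J
    ... | no  poor  = ≰⇒> poor
    ... | yes rich′ = ⊥-elim (<⇒≱ W< (≤-trans
          (+-mono-≤ (many-chains U? Z? up down rich) (≤-trans (≤-reflexive (+-identityʳ _)) (many-chains U′? Z′? up′ down′ rich′)))
          (count-disjoint (used? (λ v → (S? v ×-dec U? v) ×-dec Z? v)) (used? (λ v → (S? v ×-dec U′? v) ×-dec Z′? v)) W λ _ a b →
            let u , _ , ((_ , Uu) , Zu) , eu = find a
                v , _ , ((_ , Uv) , Zv) , ev = find b
            in apart Uu Zu Uv Zv (trans eu (sym ev)))))

    Above Below : V → V → Set
    Above t u = t ≡ u ⊎ t ⊏ u
    Below t u = u ≡ t ⊎ u ⊏ t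

    _≟V_ : ∀ u v → Dec (u ≡ v)
    u ≟V v = map′ pos-inj (cong pos) (pos u ≟ pos v)

    above? : ∀ t u → Dec (Above t u)
    above? t u = (t ≟V u) ⊎-dec (t ⊏? u)

    below? : ∀ t u → Dec (Below t u)
    below? t u = (u ≟V t) ⊎-dec (u ⊏? t)

    above-up : ∀ {t u v} → Above t u → u ⊏ v → Above t v
    above-up (inj₁ refl) lt = inj₂ lt
    above-up (inj₂ tu)   lt = inj₂ (⊏-trans tu lt)

    below-down : ∀ {t u v} → Below t v → u ⊏ v → Below t u
    below-down (inj₁ refl) lt = inj₂ lt
    below-down (inj₂ vt)   lt = inj₂ (⊏-trans lt vt)

    -- No chain meets both sets: if `u` is above `t` before position `hi` and `v` comes from `hi` on
    -- in the same chain, then `v` is above `u`, because `pos` is a linear extension, and hence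
    -- above `t`.
    rich-above : ∀ t hi → K l ≤ count (hit? (λ v → (S? v ×-dec above? t v) ×-dec (pos v <? hi))) J →
                 count (hit? (λ v → (S? v ×-dec (hi ≤? pos v)) ×-dec ¬? (above? t v))) J < K l
    rich-above t hi = rich-poor (above? t) (λ v → pos v <? hi) (λ v → hi ≤? pos v) (λ v → ¬? (above? t v))
      above-up (λ v< lt → <-trans (pos-mono lt) v<) (λ ≤u lt → ≤-trans ≤u (<⇒≤ (pos-mono lt))) (λ ¬tv lt tu → ¬tv (above-up tu lt))
      λ tu u< ≤v ¬tv e → ¬tv (apart tu (<-≤-trans u< ≤v) (δ-alike e))
      where
      apart : ∀ {u v} → Above t u → pos u < pos v → u ≡ v ⊎ (u ⊏ v ⊎ v ⊏ u) → Above t v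
      apart tu lt (inj₁ refl)      = tu
      apart tu lt (inj₂ (inj₁ uv)) = above-up tu uv
      apart tu lt (inj₂ (inj₂ vu)) = ⊥-elim (<-asym lt (pos-mono vu))

    rich-below : ∀ t lo → K l ≤ count (hit? (λ v → (S? v ×-dec (lo ≤? pos v)) ×-dec below? t v)) J →
                 count (hit? (λ v → (S? v ×-dec ¬? (below? t v)) ×-dec (pos v <? lo))) J < K l
    rich-below t lo = rich-poor (λ v → lo ≤? pos v) (below? t) (λ v → ¬? (below? t v)) (λ v → pos v <? lo)
      (λ ≤u lt → ≤-trans ≤u (<⇒≤ (pos-mono lt))) below-down (λ ¬tv lt tu → ¬tv (below-down tu lt)) (λ v< lt → <-trans (pos-mono lt) v<)
      λ ≤u tu ¬tv v< e → ¬tv (apart tu (<-≤-trans v< ≤u) (δ-alike e))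
      where
      apart : ∀ {u v} → Below t u → pos v < pos u → u ≡ v ⊎ (u ⊏ v ⊎ v ⊏ u) → Below t v
      apart tu lt (inj₁ refl)      = tu
      apart tu lt (inj₂ (inj₁ uv)) = ⊥-elim (<-asym lt (pos-mono uv))
      apart tu lt (inj₂ (inj₂ vu)) = below-down tu vu

    Win : ℕ → ℕ → V → Set
    Win a b u = S u × a ≤ pos u × pos u < b

    win? : ∀ a b u → Dec (Win a b u)
    win? a b u = S? u ×-dec (a ≤? pos u) ×-dec (pos u <? b)

    OnChain : C → ℕ → ℕ → V → Set
    OnChain d a b u = Win a b u × δ u ≡ d

    on? : ∀ d a b u → Dec (OnChain d a b u)
    on? d a b u = win? a b u ×-dec (δ u ≟C d)

    colours : C → ℕ → ℕ → List ℕ → ℕ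
    colours d a b = count (hit? (on? d a b))

    on-mono : ∀ {d a b a′ b′} → a′ ≤ a → b ≤ b′ → ∀ {u} → OnChain d a b u → OnChain d a′ b′ u
    on-mono a≤ b≤ ((Su , l , r) , e) = (Su , ≤-trans a≤ l , ≤-trans r b≤) , e

    colours-mono : ∀ {d a b a′ b′} → a′ ≤ a → b ≤ b′ → ∀ I → colours d a b I ≤ colours d a′ b′ I
    colours-mono a≤ b≤ I = count-mono (hit? (on? _ _ _)) (hit? (on? _ _ _)) I λ _ → hit-mono (on-mono a≤ b≤)

    colours-empty : ∀ d a I → colours d a a I ≤ 0
    colours-empty d a I = length≡0 _ λ i∈ →
      let _ , ((_ , l , r) , _) , _ = proj₂ (∈-filter⁻ (hit? (on? d a a)) {xs = I} i∈) in <⇒≱ r l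

    colours-suc : ∀ d a b {I} → AllPairs _>_ I → colours d a (suc b) I ≤ suc (colours d a b I)
    colours-suc d a b = count-pos (on? d a b) (on? d a (suc b)) b
      λ {u} ((Su , l , r) , e) → [ (λ lt → inj₁ ((Su , l , lt) , e)) , inj₂ ]′ (m≤n⇒m<n∨m≡n (≤-pred r))

    colours-pred : ∀ d a b {I} → AllPairs _>_ I → colours d (a ∸ 1) b I ≤ suc (colours d a b I)
    colours-pred d zero    b desc = n≤1+n _
    colours-pred d (suc a) b desc = count-pos (on? d (suc a) b) (on? d a b) a
      (λ {u} ((Su , l , r) , e) → [ (λ lt → inj₁ ((Su , lt , r) , e)) , inj₂ ∘ sym ]′ (m≤n⇒m<n∨m≡n l)) desc

    2K : ℕ
    2K = K l + K l

    -- Chain `d` shows exactly `K l` colours in the window ending at `t` and in the window starting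
    -- at `t`. This is enough to apply `rich-below` and `rich-above`, and at the same time at most
    -- `2K`, so that `d` is exhausted in either window.
    record Split (I : List ℕ) (d : C) (a b : ℕ) : Set where
      field
        t     : V
        t∈S   : S t
        t∈I   : g t ∈ I
        t∈d   : δ t ≡ d
        lo hi : ℕ
        a≤lo  : a ≤ lo
        lo≤t  : lo ≤ suc (pos t)
        hi≤b  : hi ≤ b
        a≤t   : a ≤ pos t
        t<b   : pos t < b
        low   : colours d lo (suc (pos t)) J ≡ K l
        high  : colours d (pos t) hi J ≡ K l

    split : ∀ {I} → AllPairs _>_ I → (∀ {i} → i ∈ I → i ∈ J) → ∀ d a b → 2K < colours d a b I → Split I d a b
    -- The cut is made where the colours of `d`, counted from `a`, first exceed `K l`. At most `K l`
    -- of the more than `2K` colours occur before it, so at least `K l` occur from it on.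
    split {I} desc sub d a b big with least (λ h → K l <? colours d a h I) b (≤-<-trans (m≤m+n _ _) big)
    ... | zero  , Kh , _ = ⊥-elim (<⇒≱ Kh (≤-trans (length≡0 _ λ i∈ →
            let _ , ((_ , _ , lt) , _) , _ = proj₂ (∈-filter⁻ (hit? (on? d a 0)) {xs = I} i∈) in n≮0 lt) z≤n))
    ... | suc p , Kh , below
      -- The last position before the cut brings a new colour of `I`; the vertex responsible sits
      -- exactly there and serves as `t`.
      with count-< (hit? (on? d a p)) (hit? (on? d a (suc p))) I (≤-<-trans (≮⇒≥ (below ≤-refl)) Kh)
    ... | _ , t∈I , (t , ((St , a≤t , t≤p) , δt) , refl) , new
      with m≤n⇒m<n∨m≡n (≤-pred t≤p)
    ... | inj₁ t<p  = ⊥-elim (new (t , ((St , a≤t , t<p) , δt) , refl))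
    ... | inj₂ refl = record
        { t = t ; t∈S = St ; t∈I = t∈I ; t∈d = δt
        ; lo = suc p ∸ proj₁ down ; hi = proj₁ up
        ; a≤lo = ≤-trans (≤-reflexive (sym (m∸[m∸n]≡n (m≤n⇒m≤1+n a≤t)))) (∸-monoʳ-≤ (suc p) (proj₁ (proj₂ down)))
        ; lo≤t = m∸n≤m (suc p) (proj₁ down)
        ; hi≤b = proj₁ (proj₂ up)
        ; a≤t = a≤t ; t<b = p<b
        ; low = proj₂ (proj₂ down) ; high = proj₂ (proj₂ up) }
      where
      p<b : p < b
      p<b with p <? b
      ... | yes lt = lt
      ... | no ¬lt = ⊥-elim (<⇒≱ (<-≤-trans big (≤-trans (colours-mono ≤-refl (≮⇒≥ ¬lt) I) (≮⇒≥ (below ≤-refl)))) (m≤m+n _ _))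
      right : K l ≤ colours d p b I
      right = +-cancelˡ-≤ (K l) _ _ (≤-trans (<⇒≤ big) (≤-trans
        (count-union (hit? (on? d a b)) (hit? (on? d a p)) (hit? (on? d p b)) I λ _ → cut)
        (+-monoˡ-≤ _ (≮⇒≥ (below ≤-refl)))))
        where
        cut : ∀ {i} → Hit (OnChain d a b) i → Hit (OnChain d a p) i ⊎ Hit (OnChain d p b) i
        cut (u , ((Su , l , r) , e) , gu) with pos u <? p
        ... | yes lt = inj₁ (u , ((Su , l , lt) , e) , gu)
        ... | no ¬lt = inj₂ (u , ((Su , ≮⇒≥ ¬lt , r) , e) , gu)
      up : ∃[ h ] h ≤ b × colours d p h J ≡ K l
      up = discrete-ivt (λ h → colours d p h J) (K l) b
        (≤-trans (length≡0 _ λ i∈ → let _ , ((_ , _ , lt) , _) , _ = proj₂ (∈-filter⁻ (hit? (on? d p 0)) {xs = J} i∈) in n≮0 lt) z≤n)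
        (λ n → colours-suc d p n (descending wl))
        (≤-trans right (count-⊆ (hit? (on? d p b)) desc sub))
      down : ∃[ h ] h ≤ suc p ∸ a × colours d (suc p ∸ h) (suc p) J ≡ K l
      down = discrete-ivt (λ h → colours d (suc p ∸ h) (suc p) J) (K l) (suc p ∸ a)
        (≤-trans (colours-empty d (suc p) J) z≤n)
        (λ n → subst (λ x → colours d x (suc p) J ≤ suc (colours d (suc p ∸ n) (suc p) J)) (pred[m∸n]≡m∸[1+n] (suc p) n)
                 (subst (λ x → colours d x (suc p) J ≤ suc (colours d (suc p ∸ n) (suc p) J)) (sym (pred≡∸1 (suc p ∸ n))) (colours-pred d (suc p ∸ n) (suc p) (descending wl))))
        (subst (λ x → K l ≤ colours d x (suc p) J) (sym (m∸[m∸n]≡n (m≤n⇒m≤1+n a≤t)))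
          (≤-trans (<⇒≤ Kh) (count-⊆ (hit? (on? d a (suc p))) desc sub)))
        where
        pred≡∸1 : ∀ n → Data.Nat.pred n ≡ n ∸ 1
        pred≡∸1 zero    = refl
        pred≡∸1 (suc n) = refl

    -- One of the two windows [lo , t] and [t , hi) still sees many of the next Q l colours,
    -- and in both of them the chain of t shows only K l colours.
    module Advance {I : List ℕ} {d : C} {a b : ℕ} (I⊆J : ∀ {i} → i ∈ I → i ∈ J) (sp : Split I d a b)
                   (N : List ℕ) (lenN : length N ≡ Q l) (N-desc : AllPairs _>_ N) (N⊆J : ∀ {i} → i ∈ N → i ∈ J)
                   (N<I : ∀ {i j} → i ∈ N → j ∈ I → i < j) where
      open Split sp
      p = pos t
      P₁? = hit? (λ v → (S? v ×-dec (hi ≤? pos v)) ×-dec ¬? (above? t v))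
      P₂? = hit? (λ v → (S? v ×-dec ¬? (below? t v)) ×-dec (pos v <? lo))
      P₃? = hit? (win? lo (suc p))
      P₄? = hit? (win? p hi)

      few-above : count P₁? N ≤ K l
      few-above = ≤-trans (count-⊆ P₁? N-desc N⊆J) (<⇒≤ (rich-above t hi (≤-trans (≤-reflexive (sym high))
        (count-mono (hit? (on? d p hi)) (hit? (λ v → (S? v ×-dec above? t v) ×-dec (pos v <? hi))) J
          λ _ → hit-mono λ ((Su , l , r) , e) → (Su , ab l (δ-alike (trans t∈d (sym e)))) , r))))
        where
        ab : ∀ {u} → p ≤ pos u → t ≡ u ⊎ (t ⊏ u ⊎ u ⊏ t) → Above t u
        ab le (inj₁ e)        = inj₁ e
        ab le (inj₂ (inj₁ r)) = inj₂ r
        ab le (inj₂ (inj₂ r)) = ⊥-elim (<⇒≱ (pos-mono r) le)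

      few-below : count P₂? N ≤ K l
      few-below = ≤-trans (count-⊆ P₂? N-desc N⊆J) (<⇒≤ (rich-below t lo (≤-trans (≤-reflexive (sym low))
        (count-mono (hit? (on? d lo (suc p))) (hit? (λ v → (S? v ×-dec (lo ≤? pos v)) ×-dec below? t v)) J
          λ _ → hit-mono λ ((Su , l , r) , e) → (Su , l) , be (≤-pred r) (δ-alike (trans e (sym t∈d)))))))
        where
        be : ∀ {u} → pos u ≤ p → u ≡ t ⊎ (u ⊏ t ⊎ t ⊏ u) → Below t u
        be le (inj₁ e)        = inj₁ e
        be le (inj₂ (inj₁ r)) = inj₂ r
        be le (inj₂ (inj₂ r)) = ⊥-elim (<⇒≱ (pos-mono r) le)

      place : ∀ {u} → S u → g u < g t → u ∥ t → Dec (hi ≤ pos u) → Dec (pos u < lo) → Dec (pos u ≤ p) →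
              (((S u × hi ≤ pos u) × ¬ Above t u) ⊎ ((S u × ¬ Below t u) × pos u < lo)) ⊎ (Win lo (suc p) u ⊎ Win p hi u)
      place Su lt (_ , t⋢u) (yes hi≤) _ _ =
        inj₁ (inj₁ ((Su , hi≤) , λ { (inj₁ refl) → <-irrefl refl lt ; (inj₂ r) → t⋢u r }))
      place Su lt (u⋢t , _) (no _) (yes <lo) _ =
        inj₁ (inj₂ ((Su , λ { (inj₁ refl) → <-irrefl refl lt ; (inj₂ r) → u⋢t r }) , <lo))
      place Su lt _ (no _)   (no ¬lo) (yes ≤p) = inj₂ (inj₁ (Su , ≮⇒≥ ¬lo , s≤s ≤p))
      place Su lt _ (no ¬hi) (no _)   (no ¬p)  = inj₂ (inj₂ (Su , <⇒≤ (≰⇒> ¬p) , ≰⇒> ¬hi))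

      -- The colours of `N` are smaller than that of `t`, so the wall gives each of them a vertex
      -- incomparable to `t`. Being incomparable, it is neither above nor below `t`; outside the two
      -- windows it falls into one of the two poor sets.
      classify : ∀ {i} → i ∈ N →
                 (Hit (λ v → (S v × hi ≤ pos v) × ¬ Above t v) i ⊎ Hit (λ v → (S v × ¬ Below t v) × pos v < lo) i)
                 ⊎ (Hit (Win lo (suc p)) i ⊎ Hit (Win p hi) i)
      classify {i} i∈ = found (witness wl t∈S (I⊆J t∈I) (N⊆J i∈) (N<I i∈ t∈I))
        where
        found : ∃[ u ] S u × g u ≡ i × u ∥ t → _
        found (u , Su , refl , u∥t) with place Su (N<I i∈ t∈I) u∥t (hi ≤? pos u) (pos u <? lo) (pos u ≤? p)
        ... | inj₁ (inj₁ h) = inj₁ (inj₁ (u , h , refl))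
        ... | inj₁ (inj₂ h) = inj₁ (inj₂ (u , h , refl))
        ... | inj₂ (inj₁ h) = inj₂ (inj₁ (u , h , refl))
        ... | inj₂ (inj₂ h) = inj₂ (inj₂ (u , h , refl))

      total : Q l ≤ (K l + K l) + (count P₃? N + count P₄? N)
      total = subst (_≤ (K l + K l) + (count P₃? N + count P₄? N)) lenN (≤-trans
        (count-cover (λ i → P₁? i ⊎-dec P₂? i) (λ i → P₃? i ⊎-dec P₄? i) N classify)
        (+-mono-≤ (≤-trans (count-union (λ i → P₁? i ⊎-dec P₂? i) P₁? P₂? N λ _ → id) (+-mono-≤ few-above few-below))
                  (count-union (λ i → P₃? i ⊎-dec P₄? i) P₃? P₄? N λ _ → id)))

      advance : ∃[ a′ ] ∃[ b′ ] a ≤ a′ × b′ ≤ b × colours d a′ b′ J ≡ K l × length W * 2K < count (hit? (win? a′ b′)) N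
      advance = side (length W * 2K <? count P₃? N) (length W * 2K <? count P₄? N)
        where
        lt : length W * 2K < 2 ^ suc l * 2K
        lt = *-monoˡ-< 2K W<
        side : Dec (length W * 2K < count P₃? N) → Dec (length W * 2K < count P₄? N) → _
        side (yes m₃) _        = lo , suc p , a≤lo , t<b , low , m₃
        side (no _)   (yes m₄) = p , hi , a≤t , hi≤b , high , m₄
        -- The three summands of `Q l` are made for this: `2K` colours for the poor sets, and
        -- `2 ^ suc l * 2K`, strictly more than `length W * 2K`, for each window.
        side (no ¬m₃) (no ¬m₄) = ⊥-elim (<⇒≱ (+-monoʳ-< (K l + K l) (+-mono-< lt lt))
          (≤-trans total (+-monoʳ-≤ (K l + K l) (+-mono-≤ (≮⇒≥ ¬m₃) (≮⇒≥ ¬m₄)))))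

    -- `Y` contains every chain that still shows more than `2K` colours in the window. As `I` has
    -- more than `length W * 2K` colours there, some chain `d` is of this kind. A round spends `Q l`
    -- colours of `rest` and passes to a window in which `d` shows only `K l`, so `d` leaves `Y`.
    -- After `n` rounds `Y` is empty, yet `d` would have to belong to it.
    loop : ∀ n (Y : List C) → length Y ≤ n → ∀ a b →
           (∀ {d} → d ∈ W → 2K < colours d a b J → d ∈ Y) →
           ∀ {I} → AllPairs _>_ I → (∀ {i} → i ∈ I → i ∈ J) → (∀ {i} → i ∈ I → Hit (Win a b) i) →
           length W * 2K < length I →
           ∀ rest → AllPairs _>_ rest → (∀ {i} → i ∈ rest → i ∈ J) → (∀ {i j} → i ∈ rest → j ∈ I → i < j) →
           n * Q l ≤ length rest → ⊥
    loop n Y Y≤ a b busy {I} desc sub seen many rest rdesc rsub rlow rlen = start (any? (λ d → 2K <? colours d a b I) W)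
      where
      next : ∀ n → length Y ≤ suc n → suc n * Q l ≤ length rest → ∀ {d} → d ∈ Y →
             ∃[ a′ ] ∃[ b′ ] a ≤ a′ × b′ ≤ b × colours d a′ b′ J ≡ K l
               × length W * 2K < count (hit? (win? a′ b′)) (take (Q l) rest) → ⊥
      next n Y≤ rlen {d} d∈Y (a′ , b′ , a≤ , b≤ , quiet , many′) =
        loop n (filter (λ e → ¬? (e ≟C d)) Y)
          (≤-pred (≤-trans (filter-notAll (λ e → ¬? (e ≟C d)) Y (lose d∈Y λ ne → ne refl)) Y≤)) a′ b′ busy′
          (AllPairs.filter⁺ (hit? (win? a′ b′)) (AllPairs.take⁺ (Q l) rdesc))
          (λ i∈ → rsub (take-⊆ (Q l) (proj₁ (in-N i∈)))) (λ i∈ → proj₂ (in-N i∈)) many′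
          (drop (Q l) rest) (AllPairs.drop⁺ (Q l) rdesc) (rsub ∘ drop-⊆ (Q l))
          (λ i∈ j∈ → take-drop-R (Q l) rdesc (proj₁ (in-N j∈)) i∈)
          (subst (n * Q l ≤_) (sym (length-drop (Q l) rest)) (m+n≤o⇒m≤o∸n _ (subst (_≤ length rest) (+-comm (Q l) (n * Q l)) rlen)))
        where
        in-N : ∀ {i} → i ∈ filter (hit? (win? a′ b′)) (take (Q l) rest) → i ∈ take (Q l) rest × Hit (Win a′ b′) i
        in-N = ∈-filter⁻ (hit? (win? a′ b′)) {xs = take (Q l) rest}
        busy′ : ∀ {e} → e ∈ W → 2K < colours e a′ b′ J → e ∈ filter (λ e → ¬? (e ≟C d)) Y
        busy′ {e} e∈ lt = ∈-filter⁺ (λ e → ¬? (e ≟C d)) (busy e∈ (<-≤-trans lt (colours-mono a≤ b≤ J)))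
          λ { refl → <⇒≱ lt (≤-trans (≤-reflexive quiet) (m≤m+n _ _)) }
      blocked : ∀ n → length Y ≤ n → n * Q l ≤ length rest → ∀ {d} → d ∈ Y → 2K < colours d a b I → ⊥
      blocked zero    Y≤ _    d∈Y _   = n≮0 (<-≤-trans (filter-some (λ _ → yes tt) (lose {P = λ _ → ⊤} d∈Y tt)) (≤-trans (length-filter _ Y) Y≤))
      blocked (suc n) Y≤ rlen d∈Y big = next n Y≤ rlen d∈Y (Advance.advance sub (split desc sub _ a b big) (take (Q l) rest)
        (trans (length-take (Q l) rest) (m≤n⇒m⊓n≡m (≤-trans (m≤m+n (Q l) (n * Q l)) rlen)))
        (AllPairs.take⁺ (Q l) rdesc) (rsub ∘ take-⊆ (Q l)) (λ i∈ → rlow (take-⊆ (Q l) i∈)))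
      start : Dec (Any (λ d → 2K < colours d a b I) W) → ⊥
      start (no none) = <⇒≱ many (averaging (λ i d → hit? (on? d a b) i) W 2K I
            (λ i∈ → let u , w , e = seen i∈ in δ u , SW (proj₁ w) , u , (w , refl) , e)
            λ d∈ → ≮⇒≥ λ lt → none (lose d∈ lt))
      start (yes some) with find some
      ... | d , d∈W , big = blocked n Y≤ rlen (busy d∈W (<-≤-trans big (count-⊆ (hit? (on? d a b)) desc sub))) big

    -- Since `length W < 2 ^ suc l`, more than `F (suc l)` colours provide one initial block of
    -- `Q l` colours and a further block for every chain of `W`.
    bound : length J ≤ F (suc l)
    bound with length J ≤? F (suc l)
    ... | yes ok = ok
    ... | no big = ⊥-elim (loop (length W) W ≤-refl 0 top (λ d∈ _ → d∈)
        (AllPairs.take⁺ (Q l) (descending wl)) (take-⊆ (Q l))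
        (λ i∈ → let u , Su , e = hits (take-⊆ (Q l) i∈) in u , (Su , z≤n , proj₂ (strict-bound pos vs) (∈-vs u)) , e)
        (subst (length W * 2K <_) (sym lenI) (<-≤-trans (*-monoˡ-< 2K W<) (≤-trans (m≤m+n _ _) (m≤n+m _ (K l + K l)))))
        (drop (Q l) J) (AllPairs.drop⁺ (Q l) (descending wl)) (drop-⊆ (Q l))
        (λ i∈ j∈ → take-drop-R (Q l) (descending wl) j∈ i∈)
        (subst (length W * Q l ≤_) (sym (length-drop (Q l) J)) (m+n≤o⇒m≤o∸n _ (subst (_≤ length J) (+-comm (Q l) _) enough))))
      where
      enough : suc (length W) * Q l ≤ length J
      enough = ≤-trans (*-monoˡ-≤ (Q l) W<) (<⇒≤ (≰⇒> big))
      lenI : length (take (Q l) J) ≡ Q l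
      lenI = trans (length-take (Q l) J) (m≤n⇒m⊓n≡m (≤-trans (m≤m+n (Q l) (length W * Q l)) enough))
      top = proj₁ (strict-bound pos vs)

  bounded : ∀ l → Bounded l
  bounded zero    S? []      _ SW wl hits = ≤-trans (length≡0 _ λ i∈ → empty (hits i∈)) z≤n
    where
    empty : ∀ {i} → Hit _ i → ⊥
    empty (_ , Su , _) with SW Su
    ... | ()
  bounded zero    S? (_ ∷ _) (s≤s ()) SW wl hits
  bounded (suc l) S? W W< SW wl hits = Step.bound l (bounded l) S? W W< SW wl hits


-- Trees of levels

module Levels (k : ℕ) where

  Mat : Set
  Mat = Fin k → Fin k → Bool

  -- A tree describes the levels inserted between two consecutive levels. A node is a level, its matrices
  -- give the edges from the level below and to the level above; only its point at index j is coloured.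
  data Tree : Set where
    leaf : Tree
    node : (l : Tree) (L : Mat) (A : Fin k → ℕ) (j : Fin k) (R : Mat) (r : Tree) → Tree

  data Pt : Tree → Set where
    left  : ∀ {l L A j R r} → Pt l → Pt (node l L A j R r)
    here  : ∀ {l L A j R r} → Fin k → Pt (node l L A j R r)
    right : ∀ {l L A j R r} → Pt r → Pt (node l L A j R r)

  private variable
    t : Tree
    M : Mat

  -- To reach the right subtree, `L` is used as the relation across the whole left subtree, whatever
  -- has been inserted there. For this reason later insertions leave the relation between earlier
  -- points unchanged.
  up : Fin k → Pt t → Set
  up f (left p)          = up f p
  up f (here {L = L} a)  = T (L f a)
  up f (right {L = L} p) = ∃[ a ] T (L f a) × up a p

  dn : Pt t → Fin k → Set
  dn (left {R = R} p) g = ∃[ a ] dn p a × T (R a g)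
  dn (here {R = R} a) g = T (R a g)
  dn (right p)        g = dn p g

  _≺_ : Pt t → Pt t → Set
  left p  ≺ left q  = p ≺ q
  left p  ≺ here a  = dn p a
  left p  ≺ right q = ∃[ a ] dn p a × up a q
  here a  ≺ right q = up a q
  right p ≺ right q = p ≺ q
  here _  ≺ left _  = ⊥
  here _  ≺ here _  = ⊥
  right _ ≺ left _  = ⊥
  right _ ≺ here _  = ⊥

  up? : ∀ f (p : Pt t) → Dec (up f p)
  up? f (left p)          = up? f p
  up? f (here {L = L} a)  = T? (L f a)
  up? f (right {L = L} p) = Fin.any? λ a → T? (L f a) ×-dec up? a p

  dn? : ∀ (p : Pt t) g → Dec (dn p g)
  dn? (left {R = R} p) g = Fin.any? λ a → dn? p a ×-dec T? (R a g)
  dn? (here {R = R} a) g = T? (R a g)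
  dn? (right p)        g = dn? p g

  _≺?_ : (p q : Pt t) → Dec (p ≺ q)
  left p  ≺? left q  = p ≺? q
  left p  ≺? here a  = dn? p a
  left p  ≺? right q = Fin.any? λ a → dn? p a ×-dec up? a q
  here a  ≺? right q = up? a q
  right p ≺? right q = p ≺? q
  here _  ≺? left _  = no λ ()
  here _  ≺? here _  = no λ ()
  right _ ≺? left _  = no λ ()
  right _ ≺? here _  = no λ ()

  Injective : (Fin k → Fin k) → Set
  Injective τ = ∀ {i j} → τ i ≡ τ j → i ≡ j

  record Matching (M : Mat) : Set where
    field
      τ     : Fin k → Fin k
      inj   : Injective τ
      edge  : ∀ j → T (M (τ j) j)
  open Matching

  -- `through` is the reason for discarding comparabilities: an edge entering an up-set extends to a
  -- perfect matching, which makes the edge cost one point in `outside-<`.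
  record Regular (M : Mat) : Set where
    field
      some    : Matching M
      through : ∀ f g → T (M f g) → Σ[ μ ∈ Matching M ] τ μ g ≡ f
  open Regular

  data WF : Mat → Tree → Set where
    leaf : Regular M → WF M leaf
    node : ∀ {l L A j R r} → Regular M → (∀ {f a g} → T (L f a) → T (R a g) → T (M f g)) →
           WF L l → WF R r → WF M (node l L A j R r)

  regular : WF M t → Regular M
  regular (leaf r)       = r
  regular (node r _ _ _) = r

  -- The composability condition at each node collapses a path through the interval to one edge of
  -- `M`. The transitivity of `≺` reduces to this.
  up-dn : WF M t → ∀ f p g → up f p → dn {t} p g → T (M f g)
  up-dn (node _ comp wl wr) f (left p)  g u (a , d , e) = comp (up-dn wl f p a u d) e
  up-dn (node _ comp wl wr) f (here a)  g u d           = comp u d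
  up-dn (node _ comp wl wr) f (right p) g (a , e , u) d = comp e (up-dn wr a p g u d)

  up-≺ : WF M t → ∀ f (p q : Pt t) → up f p → p ≺ q → up f q
  up-≺ (node _ _ wl wr) f (left p)  (left q)  u lt = up-≺ wl f p q u lt
  up-≺ (node _ _ wl wr) f (left p)  (here a)  u lt = up-dn wl f p a u lt
  up-≺ (node _ _ wl wr) f (left p)  (right q) u (a , d , v) = a , up-dn wl f p a u d , v
  up-≺ (node _ _ wl wr) f (here a)  (right q) u lt = a , u , lt
  up-≺ (node _ _ wl wr) f (right p) (right q) (a , e , u) lt = a , e , up-≺ wr a p q u lt

  ≺-dn : WF M t → ∀ (p q : Pt t) g → p ≺ q → dn q g → dn p g
  ≺-dn (node _ _ wl wr) (left p)  (left q)  g lt (a , d , e) = a , ≺-dn wl p q a lt d , e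
  ≺-dn (node _ _ wl wr) (left p)  (here a)  g lt e = a , lt , e
  ≺-dn (node _ _ wl wr) (left p)  (right q) g (a , d , u) e = a , d , up-dn wr a q g u e
  ≺-dn (node _ _ wl wr) (here a)  (right q) g u e = up-dn wr a q g u e
  ≺-dn (node _ _ wl wr) (right p) (right q) g lt d = ≺-dn wr p q g lt d

  ≺-trans : WF M t → (p q s : Pt t) → p ≺ q → q ≺ s → p ≺ s
  ≺-trans (node _ _ wl wr) (left p)  (left q)  (left s)  a b = ≺-trans wl p q s a b
  ≺-trans (node _ _ wl wr) (left p)  (left q)  (here s)  a b = ≺-dn wl p q s a b
  ≺-trans (node _ _ wl wr) (left p)  (left q)  (right s) a (x , d , u) = x , ≺-dn wl p q x a d , u
  ≺-trans (node _ _ wl wr) (left p)  (here q)  (right s) a b = q , a , b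
  ≺-trans (node _ _ wl wr) (left p)  (right q) (right s) (x , d , u) b = x , d , up-≺ wr x q s u b
  ≺-trans (node _ _ wl wr) (here p)  (right q) (right s) a b = up-≺ wr p q s a b
  ≺-trans (node _ _ wl wr) (right p) (right q) (right s) a b = ≺-trans wr p q s a b

  -- Fixing a perfect matching in every leaf cuts the tree into chains; baseG g and base p are the bottom ends of the
  -- chains through g and p.

  baseG : WF M t → Fin k → Fin k
  baseG (leaf r)         g = τ (some r) g
  baseG (node _ _ wl wr) g = baseG wl (baseG wr g)

  base : WF M t → Pt t → Fin k
  base (node _ _ wl wr) (left p)  = base wl p
  base (node _ _ wl wr) (here a)  = baseG wl a
  base (node _ _ wl wr) (right p) = baseG wl (base wr p)

  baseG-inj : (wf : WF M t) → Injective (baseG wf)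
  baseG-inj (leaf r)         e = inj (some r) e
  baseG-inj (node _ _ wl wr) e = baseG-inj wr (baseG-inj wl e)

  baseG-edge : (wf : WF M t) → ∀ g → T (M (baseG wf g) g)
  baseG-edge (leaf r)            g = edge (some r) g
  baseG-edge (node _ comp wl wr) g = comp (baseG-edge wl _) (baseG-edge wr g)

  base-up : (wf : WF M t) → ∀ p → up (base wf p) p
  base-up (node _ _ wl wr) (left p)  = base-up wl p
  base-up (node _ _ wl wr) (here a)  = baseG-edge wl a
  base-up (node _ _ wl wr) (right p) = base wr p , baseG-edge wl _ , base-up wr p

  base-dn : (wf : WF M t) → ∀ p g → base wf p ≡ baseG wf g → dn p g
  base-dn (node _ _ wl wr) (left p)  g e = baseG wr g , base-dn wl p _ e , baseG-edge wr g
  base-dn (node _ _ wl wr) (here a)  g e with baseG-inj wl e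
  ... | refl = baseG-edge wr g
  base-dn (node _ _ wl wr) (right p) g e = base-dn wr p g (baseG-inj wl e)

  -- The base points thus index a cover of `≺` by `k` chains, which serves as `δ` in the bound for
  -- walls.
  base-alike : (wf : WF M t) → ∀ p q → base wf p ≡ base wf q → p ≡ q ⊎ (p ≺ q ⊎ q ≺ p)
  base-alike (node _ _ wl wr) (left p) (left q) e with base-alike wl p q e
  ... | inj₁ refl = inj₁ refl
  ... | inj₂ c    = inj₂ c
  base-alike (node _ _ wl wr) (right p) (right q) e with base-alike wr p q (baseG-inj wl e)
  ... | inj₁ refl = inj₁ refl
  ... | inj₂ c    = inj₂ c
  base-alike (node _ _ wl wr) (here a)  (here b)  e with baseG-inj wl e
  ... | refl = inj₁ refl
  base-alike (node _ _ wl wr) (left p)  (here a)  e = inj₂ (inj₁ (base-dn wl p a e))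
  base-alike (node _ _ wl wr) (left p)  (right q) e = inj₂ (inj₁ (base wr q , base-dn wl p _ e , base-up wr q))
  base-alike (node _ _ wl wr) (here a)  (left q)  e = inj₂ (inj₂ (base-dn wl q a (sym e)))
  base-alike (node _ _ wl wr) (right p) (left q)  e = inj₂ (inj₂ (base wr p , base-dn wl q _ (sym e) , base-up wr p))
  base-alike (node _ _ wl wr) (here a)  (right q) e with baseG-inj wl e
  ... | refl = inj₂ (inj₁ (base-up wr q))
  base-alike (node _ _ wl wr) (right p) (here a)  e with baseG-inj wl e
  ... | refl = inj₂ (inj₂ (base-up wr p))

  -- Ladders

  -- The bounding levels are added as points so that a rung cut at the middle level of a node has
  -- both its ends inside one of the halves.
  data Cl (t : Tree) : Set where
    bot : Fin k → Cl t
    pt  : Pt t → Cl t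
    top : Fin k → Cl t

  Rel : Mat → Cl t → Cl t → Set
  Rel M (bot f) (pt p)  = up f p
  Rel M (bot f) (top g) = T (M f g)
  Rel M (pt p)  (pt q)  = p ≺ q
  Rel M (pt p)  (top g) = dn p g
  Rel M (top _) _       = ⊥
  Rel M _       (bot _) = ⊥

  rel-trans : WF M t → (x y z : Cl t) → Rel M x y → Rel M y z → Rel M x z
  rel-trans wf (bot f) (pt p) (pt q)  a b = up-≺ wf f p q a b
  rel-trans wf (bot f) (pt p) (top g) a b = up-dn wf f p g a b
  rel-trans wf (pt p)  (pt q) (pt s)  a b = ≺-trans wf p q s a b
  rel-trans wf (pt p)  (pt q) (top g) a b = ≺-dn wf p q g a b

  leP : Pt t → Pt t → Set
  leP (left p)  (left q)  = leP p q
  leP (left p)  _         = ⊤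
  leP (here _)  (left _)  = ⊥
  leP (here _)  _         = ⊤
  leP (right p) (right q) = leP p q
  leP (right p) _         = ⊥

  leCl : Cl t → Cl t → Set
  leCl (bot _) _       = ⊤
  leCl (pt _)  (bot _) = ⊥
  leCl (pt p)  (pt q)  = leP p q
  leCl (pt _)  (top _) = ⊤
  leCl (top _) (top _) = ⊤
  leCl (top _) _       = ⊥

  ≺⇒leP : (p q : Pt t) → p ≺ q → leP p q
  ≺⇒leP (left p)  (left q)  lt = ≺⇒leP p q lt
  ≺⇒leP (left p)  (here _)  _  = tt
  ≺⇒leP (left p)  (right _) _  = tt
  ≺⇒leP (here _)  (right _) _  = tt
  ≺⇒leP (right p) (right q) lt = ≺⇒leP p q lt

  module _ {l r : Tree} {L R : Mat} {A : Fin k → ℕ} {j : Fin k} where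
    private N = node l L A j R r

    embL : Cl l → Cl N
    embL (bot f) = bot f
    embL (pt p)  = pt (left p)
    embL (top a) = pt (here a)

    embR : Cl r → Cl N
    embR (bot a) = pt (here a)
    embR (pt p)  = pt (right p)
    embR (top g) = top g

    embL-rel : ∀ x y → Rel L x y → Rel M (embL x) (embL y)
    embL-rel (bot _) (pt _)  h = h
    embL-rel (bot _) (top _) h = h
    embL-rel (pt _) (pt _)  h = h
    embL-rel (pt _) (top _) h = h

    embR-rel : ∀ x y → Rel R x y → Rel M (embR x) (embR y)
    embR-rel (bot _) (pt _)  h = h
    embR-rel (bot _) (top _) h = h
    embR-rel (pt _) (pt _)  h = h
    embR-rel (pt _) (top _) h = h

    embL-le : ∀ x y → leCl (embL x) (embL y) → leCl x y
    embL-le (bot _) _     h = tt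
    embL-le (pt _) (pt _)  h = h
    embL-le (pt _) (top _) h = tt
    embL-le (top _) (top _) h = tt

    embR-le : ∀ x y → leCl (embR x) (embR y) → leCl x y
    embR-le (bot _) _     h = tt
    embR-le (pt _) (pt _)  h = h
    embR-le (pt _) (top _) h = tt
    embR-le (top _) (top _) h = tt

    data Cross (x y : Cl N) : Set where
      spans : ∀ f g → x ≡ bot f → y ≡ top g → Cross x y
      lower : ∀ x′ y′ → x ≡ embL x′ → y ≡ embL y′ → Rel L x′ y′ → Cross x y
      upper : ∀ x′ y′ → x ≡ embR x′ → y ≡ embR y′ → Rel R x′ y′ → Cross x y
      cross : ∀ x′ y′ a → x ≡ embL x′ → y ≡ embR y′ → Rel L x′ (top a) → Rel R (bot a) y′ → Cross x y

    cross? : ∀ x y → Rel M x y → Cross x y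
    cross? (bot f)        (top g)        h = spans f g refl refl
    cross? (bot f)        (pt (left q))  h = lower (bot f) (pt q) refl refl h
    cross? (bot f)        (pt (here a))  h = lower (bot f) (top a) refl refl h
    cross? (bot f)        (pt (right q)) (a , e , h) = cross (bot f) (pt q) a refl refl e h
    cross? (pt (left p))  (pt (left q))  h = lower (pt p) (pt q) refl refl h
    cross? (pt (left p))  (pt (here a))  h = lower (pt p) (top a) refl refl h
    cross? (pt (left p))  (pt (right q)) (a , e , h) = cross (pt p) (pt q) a refl refl e h
    cross? (pt (left p))  (top g)        (a , e , h) = cross (pt p) (top g) a refl refl e h
    cross? (pt (here a))  (pt (right q)) h = upper (bot a) (pt q) refl refl h
    cross? (pt (here a))  (top g)        h = upper (bot a) (top g) refl refl h
    cross? (pt (right p)) (pt (right q)) h = upper (pt p) (pt q) refl refl h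
    cross? (pt (right p)) (top g)        h = upper (pt p) (top g) refl refl h

  -- The bottom points outside u are counted; matchings push u upwards, so this number decreases along levels.
  outside : (Fin k → Bool) → ℕ
  outside u = count (λ f → ¬? (T? (u f))) (allFin k)

  map-unique : {τ : Fin k → Fin k} → Injective τ → ∀ {xs} → AllPairs _≢_ xs → AllPairs _≢_ (map τ xs)
  map-unique inj ap = AllPairs.map⁺ (AllPairs.map (λ ne e → ne (inj e)) ap)

  allFin-unique : AllPairs _≢_ (allFin k)
  allFin-unique = AllPairs.tabulate⁺ {f = λ i → i} λ ne → ne

  outside-≤ : (M : Mat) (u v : Fin k → Bool) → (∀ {f g} → T (M f g) → T (u f) → T (v g)) → Matching M → outside v ≤ outside u
  outside-≤ M u v up μ = subst (_≤ outside u) (length-map (τ μ) xs)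
    (unique-length Fin._≟_ (map (τ μ) xs) _ (map-unique (inj μ) (AllPairs.filter⁺ _ allFin-unique)) λ {f} → sub f)
    where
    xs = filter (λ f → ¬? (T? (v f))) (allFin k)
    sub : ∀ f → f ∈ map (τ μ) xs → f ∈ filter (λ f → ¬? (T? (u f))) (allFin k)
    sub f f∈ with ∈-map⁻ (τ μ) f∈
    ... | g , g∈ , refl = ∈-filter⁺ (λ f → ¬? (T? (u f))) (∈-allFin f)
      λ uf → proj₂ (∈-filter⁻ (λ f → ¬? (T? (v f))) {xs = allFin k} g∈) (up (edge μ g) uf)

  -- The matching sends the points outside `v` injectively to points outside `u`. The point `τ μ g`
  -- is one more point outside `u`, missed by this map because its partner `g` is in `v`.
  outside-< : (M : Mat) (u v : Fin k → Bool) → (∀ {f g} → T (M f g) → T (u f) → T (v g)) →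
              (μ : Matching M) → ∀ g → T (v g) → ¬ T (u (τ μ g)) → outside v < outside u
  outside-< M u v up μ g vg ¬uf = subst (λ n → suc n ≤ outside u) (length-map (τ μ) xs)
    (unique-length Fin._≟_ (τ μ g ∷ map (τ μ) xs) _
      (All.tabulate new ∷ map-unique (inj μ) (AllPairs.filter⁺ _ allFin-unique)) λ {f} → sub f)
    where
    xs = filter (λ f → ¬? (T? (v f))) (allFin k)
    out : ∀ {h} → h ∈ xs → ¬ T (v h)
    out h∈ = proj₂ (∈-filter⁻ (λ f → ¬? (T? (v f))) {xs = allFin k} h∈)
    new : ∀ {f} → f ∈ map (τ μ) xs → τ μ g ≢ f
    new f∈ e with ∈-map⁻ (τ μ) f∈
    ... | h , h∈ , refl with inj μ e
    ... | refl = out h∈ vg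
    sub : ∀ f → f ∈ τ μ g ∷ map (τ μ) xs → f ∈ filter (λ f → ¬? (T? (u f))) (allFin k)
    sub f (here refl) = ∈-filter⁺ (λ f → ¬? (T? (u f))) (∈-allFin f) ¬uf
    sub f (there f∈) with ∈-map⁻ (τ μ) f∈
    ... | g , g∈ , refl = ∈-filter⁺ (λ f → ¬? (T? (u f))) (∈-allFin f) λ uf → out g∈ (up (edge μ g) uf)

  Edge : Mat → (Cl t → Bool) → Cl t × Cl t → Set
  Edge M u (x , y) = ¬ T (u x) × T (u y) × Rel M x y

  -- A weakened form of `Rung` that survives cutting: two rungs cut at the same level receive ends
  -- of that level, which need not be related by `≺`, so only the heights are compared.
  Before : Mat → Cl t × Cl t → Cl t × Cl t → Set
  Before M (x , y) (x′ , y′) = leCl x x′ × leCl y y′ × ¬ Rel M x′ y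

  isBot isTop : Cl t → Fin k → Set
  isBot (bot f) g = f ≡ g
  isBot _       _ = ⊥
  isTop (top f) g = f ≡ g
  isTop _       _ = ⊥

  isBot? : (x : Cl t) → ∀ f → Dec (isBot x f)
  isBot? (bot f) g = f Fin.≟ g
  isBot? (pt _)  g = no λ ()
  isBot? (top _) g = no λ ()

  isTop? : (x : Cl t) → ∀ f → Dec (isTop x f)
  isTop? (top f) g = f Fin.≟ g
  isTop? (pt _)  g = no λ ()
  isTop? (bot _) g = no λ ()

  Flat : Cl t × Cl t → Set
  Flat (x , y) = ∃ (isBot x) × ∃ (isTop y)

  flat? : (z : Cl t × Cl t) → Dec (Flat z)
  flat? (x , y) = Fin.any? (isBot? x) ×-dec Fin.any? (isTop? y)

  le-bot : (x y : Cl t) → leCl x y → ∃ (isBot y) → ∃ (isBot x)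
  le-bot (bot f) _ _ _ = f , refl
  le-bot (pt _)  (bot _) () _
  le-bot (top _) (bot _) () _

  le-top : (x y : Cl t) → leCl x y → ∃ (isTop x) → ∃ (isTop y)
  le-top (top _) (top g) _ _ = g , refl

  le-any-top : (x : Cl t) → ∀ a → leCl x (top a)
  le-any-top (bot _) a = tt
  le-any-top (pt _)  a = tt
  le-any-top (top _) a = tt

  around : {Z : Set} {P : Z → Set} {S : Z → Z → Set} {zs : List Z} → Any P zs → AllPairs S zs → ∀ {z} → z ∈ zs →
           ∃[ z₀ ] P z₀ × (S z z₀ ⊎ z ≡ z₀ ⊎ S z₀ z)
  around (here {x = z₀} p) _        (here refl) = z₀ , p , inj₂ (inj₁ refl)
  around (here {x = z₀} p) (s ∷ _)  (there z∈)  = z₀ , p , inj₂ (inj₂ (All.lookup s z∈))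
  around (there a)         (s ∷ _)  (here refl) = let z₀ , z₀∈ , p = find a in z₀ , p , inj₁ (All.lookup s z₀∈)
  around (there a)         (_ ∷ ss) (there z∈)  = around a ss z∈

  -- Rungs before a flat one start at distinct bottom points, rungs after it end at distinct top points.
  flat-length : {u : Cl t → Bool} (zs : List (Cl t × Cl t)) → All (Edge M u) zs → AllPairs (Before M) zs → Any Flat zs →
                length zs ≤ k + k
  flat-length {t} {M} {u} zs edges before flat =
    ≤-trans (count-cover bot? top? zs λ z∈ → ends (around flat before z∈)) (+-mono-≤ bots tops)
    where
    bot? : (z : Cl t × Cl t) → Dec (∃ (isBot (proj₁ z)))
    bot? z = Fin.any? (isBot? (proj₁ z))
    top? : (z : Cl t × Cl t) → Dec (∃ (isTop (proj₂ z)))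
    top? z = Fin.any? (isTop? (proj₂ z))
    ends : ∀ {z} → ∃[ z₀ ] Flat z₀ × (Before M z z₀ ⊎ z ≡ z₀ ⊎ Before M z₀ z) → ∃ (isBot (proj₁ z)) ⊎ ∃ (isTop (proj₂ z))
    ends {z} (z₀ , (b , _) , inj₁ (l , _ , _))        = inj₁ (le-bot (proj₁ z) (proj₁ z₀) l b)
    ends     (_  , (b , _) , inj₂ (inj₁ refl))        = inj₁ b
    ends {z} (z₀ , (_ , e) , inj₂ (inj₂ (_ , l , _))) = inj₂ (le-top (proj₂ z₀) (proj₂ z) l e)
    same-bot : (x x′ : Cl t) → ∀ {f} → isBot x f → isBot x′ f → x ≡ x′
    same-bot (bot _) (bot _) refl refl = refl
    same-top : (x x′ : Cl t) → ∀ {f} → isTop x f → isTop x′ f → x ≡ x′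
    same-top (top _) (top _) refl refl = refl
    k≡ : length (allFin k) ≡ k
    k≡ = length-tabulate (λ i → i)
    bots : count bot? zs ≤ k
    bots = subst (count bot? zs ≤_) k≡ (pairs-length {R = Before M} {H = λ z → isBot (proj₁ z)} (λ z → isBot? (proj₁ z)) (allFin k) (filter bot? zs)
      (AllPairs.filter⁺ bot? before)
      (λ z∈ → let f , b = proj₂ (∈-filter⁻ bot? {xs = zs} z∈) in f , ∈-allFin f , b)
      λ {z} {z′} z∈ _ b b′ (_ , _ , ¬r) → ¬r (subst (λ x → Rel M x (proj₂ z)) (same-bot (proj₁ z) (proj₁ z′) b b′)
        (proj₂ (proj₂ (All.lookup edges (proj₁ (∈-filter⁻ bot? {xs = zs} z∈)))))))
    tops : count top? zs ≤ k
    tops = subst (count top? zs ≤_) k≡ (pairs-length {R = Before M} {H = λ z → isTop (proj₂ z)} (λ z → isTop? (proj₂ z)) (allFin k) (filter top? zs)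
      (AllPairs.filter⁺ top? before)
      (λ z∈ → let f , b = proj₂ (∈-filter⁻ top? {xs = zs} z∈) in f , ∈-allFin f , b)
      λ {z} {z′} _ z′∈ b b′ (_ , _ , ¬r) → ¬r (subst (Rel M (proj₁ z′)) (same-top (proj₂ z′) (proj₂ z) b′ b)
        (proj₂ (proj₂ (All.lookup edges (proj₁ (∈-filter⁻ top? {xs = zs} z′∈)))))))

  module _ {l r : Tree} {L R : Mat} {A : Fin k → ℕ} {j : Fin k} where
    private N = node l L A j R r

    SplitL : Cl N × Cl N → Cl l × Cl l → Set
    SplitL (x , y) (x′ , y′) =
      x ≡ embL x′ × (y ≡ embL y′ ⊎ Σ[ a ∈ Fin k ] Σ[ y₀ ∈ Cl r ] y′ ≡ top a × y ≡ embR y₀ × Rel R (bot a) y₀)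

    SplitR : Cl N × Cl N → Cl r × Cl r → Set
    SplitR (x , y) (x′ , y′) =
      y ≡ embR y′ × (x ≡ embR x′ ⊎ Σ[ a ∈ Fin k ] Σ[ x₀ ∈ Cl l ] x′ ≡ bot a × x ≡ embL x₀ × Rel L x₀ (top a))

    embR≰embL : ∀ y₀ a → Rel R (bot a) y₀ → ∀ y → ¬ leCl {N} (embR y₀) (embL y)
    embR≰embL (pt _)  _ _ (bot _) ()
    embR≰embL (pt _)  _ _ (pt _)  ()
    embR≰embL (pt _)  _ _ (top _) ()
    embR≰embL (top _) _ _ (bot _) ()
    embR≰embL (top _) _ _ (pt _)  ()
    embR≰embL (top _) _ _ (top _) ()

    embR≤embL : ∀ x x₀ a → Rel L x₀ (top a) → leCl {N} (embR x) (embL x₀) → leCl x (bot a)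
    embR≤embL (bot _) _ _ _ _ = tt
    embR≤embL (pt _)  (bot _) _ _ ()
    embR≤embL (pt _)  (pt _)  _ _ ()
    embR≤embL (top _) (bot _) _ _ ()
    embR≤embL (top _) (pt _)  _ _ ()

    -- A rung crossing the middle level at `a` is shortened to end at `a`. If the later lower point
    -- reached `a`, it would reach the former upper end through `a`; hence shortening creates no
    -- forbidden relation.
    splitL-before : WF M N → ∀ {z₁ z₂ w₁ w₂} → SplitL z₁ w₁ → SplitL z₂ w₂ → Before M z₁ z₂ → Before L w₁ w₂
    splitL-before wf {w₁ = x₁ , y₁} {x₂ , y₂} (refl , s₁) (refl , s₂) (lx , ly , ¬r) =
      embL-le x₁ x₂ lx , le-y s₁ s₂ ly , ¬back s₁ ¬r
      where
      le-y : ∀ {y z} → (y ≡ embL y₁ ⊎ Σ[ a ∈ Fin k ] Σ[ y₀ ∈ Cl r ] y₁ ≡ top a × y ≡ embR y₀ × Rel R (bot a) y₀) →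
             (z ≡ embL y₂ ⊎ Σ[ a ∈ Fin k ] Σ[ y₀ ∈ Cl r ] y₂ ≡ top a × z ≡ embR y₀ × Rel R (bot a) y₀) → leCl y z → leCl y₁ y₂
      le-y (inj₁ refl) (inj₁ refl) h = embL-le y₁ y₂ h
      le-y _ (inj₂ (a , _ , refl , _)) h = le-any-top y₁ a
      le-y (inj₂ (a , y₀ , refl , refl , e)) (inj₁ refl) h = ⊥-elim (embR≰embL y₀ a e y₂ h)
      ¬back : ∀ {y} → (y ≡ embL y₁ ⊎ Σ[ a ∈ Fin k ] Σ[ y₀ ∈ Cl r ] y₁ ≡ top a × y ≡ embR y₀ × Rel R (bot a) y₀) →
            ¬ Rel _ (embL x₂) y → ¬ Rel L x₂ y₁
      ¬back (inj₁ refl) ¬r h = ¬r (embL-rel x₂ y₁ h)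
      ¬back (inj₂ (a , y₀ , refl , refl , e)) ¬r h =
        ¬r (rel-trans wf (embL x₂) (pt (here a)) (embR y₀) (embL-rel x₂ (top a) h) (embR-rel (bot a) y₀ e))

    splitR-before : WF M N → ∀ {z₁ z₂ w₁ w₂} → SplitR z₁ w₁ → SplitR z₂ w₂ → Before M z₁ z₂ → Before R w₁ w₂
    splitR-before wf {w₁ = x₁ , y₁} {x₂ , y₂} (refl , s₁) (refl , s₂) (lx , ly , ¬r) =
      le-x s₁ s₂ lx , embR-le y₁ y₂ ly , ¬back s₂ ¬r
      where
      le-x : ∀ {x z} → (x ≡ embR x₁ ⊎ Σ[ a ∈ Fin k ] Σ[ x₀ ∈ Cl l ] x₁ ≡ bot a × x ≡ embL x₀ × Rel L x₀ (top a)) →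
             (z ≡ embR x₂ ⊎ Σ[ a ∈ Fin k ] Σ[ x₀ ∈ Cl l ] x₂ ≡ bot a × z ≡ embL x₀ × Rel L x₀ (top a)) → leCl x z → leCl x₁ x₂
      le-x (inj₁ refl) (inj₁ refl) h = embR-le x₁ x₂ h
      le-x (inj₂ (a , _ , refl , _)) _ h = tt
      le-x (inj₁ refl) (inj₂ (a , x₀ , refl , refl , e)) h = embR≤embL x₁ x₀ a e h
      ¬back : ∀ {x} → (x ≡ embR x₂ ⊎ Σ[ a ∈ Fin k ] Σ[ x₀ ∈ Cl l ] x₂ ≡ bot a × x ≡ embL x₀ × Rel L x₀ (top a)) →
            ¬ Rel _ x (embR y₁) → ¬ Rel R x₂ y₁
      ¬back (inj₁ refl) ¬r h = ¬r (embR-rel x₂ y₁ h)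
      ¬back (inj₂ (a , x₀ , refl , refl , e)) ¬r h =
        ¬r (rel-trans wf (embL x₀) (pt (here a)) (embR y₁) (embL-rel x₀ (top a) e) (embR-rel (bot a) y₁ h))

    record Halves (M : Mat) (u : Cl N → Bool) (zs : List (Cl N × Cl N)) : Set where
      field
        ls       : List (Cl l × Cl l)
        rs       : List (Cl r × Cl r)
        total    : length zs ≡ length ls + length rs
        ls-edge  : All (Edge L (u ∘ embL)) ls
        rs-edge  : All (Edge R (u ∘ embR)) rs
        ls-split : All (λ w → ∃[ z ] z ∈ zs × SplitL z w) ls
        rs-split : All (λ w → ∃[ z ] z ∈ zs × SplitR z w) rs
        ls-before : AllPairs (Before L) ls
        rs-before : AllPairs (Before R) rs

    halves : WF M N → (u : Cl N → Bool) → ∀ zs → All (Edge M u) zs → AllPairs (Before M) zs → All (¬_ ∘ Flat) zs → Halves M u zs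
    halves wf u [] [] [] [] = record
      { ls = [] ; rs = [] ; total = refl ; ls-edge = [] ; rs-edge = [] ; ls-split = [] ; rs-split = [] ; ls-before = [] ; rs-before = [] }
    halves {M} wf u (z@(x , y) ∷ zs) ((¬ux , uy , h) ∷ edges) (b ∷ before) (¬flat ∷ ¬flats) =
      side (halves wf u zs edges before ¬flats) (cross? x y h)
      where
      module _ (H : Halves M u zs) where
        open Halves H
        addL : ∀ w → Edge L (u ∘ embL) w → SplitL z w → Halves M u (z ∷ zs)
        addL w e s = record
          { ls = w ∷ ls ; rs = rs ; total = cong suc total ; ls-edge = e ∷ ls-edge ; rs-edge = rs-edge
          ; ls-split = (z , here refl , s) ∷ All.map (λ (z′ , z∈ , s′) → z′ , there z∈ , s′) ls-split
          ; rs-split = All.map (λ (z′ , z∈ , s′) → z′ , there z∈ , s′) rs-split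
          ; ls-before = All.map (λ (z′ , z∈ , s′) → splitL-before wf s s′ (All.lookup b z∈)) ls-split ∷ ls-before
          ; rs-before = rs-before }
        addR : ∀ w → Edge R (u ∘ embR) w → SplitR z w → Halves M u (z ∷ zs)
        addR w e s = record
          { ls = ls ; rs = w ∷ rs ; total = trans (cong suc total) (sym (+-suc (length ls) (length rs)))
          ; ls-edge = ls-edge ; rs-edge = e ∷ rs-edge
          ; rs-split = (z , here refl , s) ∷ All.map (λ (z′ , z∈ , s′) → z′ , there z∈ , s′) rs-split
          ; ls-split = All.map (λ (z′ , z∈ , s′) → z′ , there z∈ , s′) ls-split
          ; rs-before = All.map (λ (z′ , z∈ , s′) → splitR-before wf s s′ (All.lookup b z∈)) rs-split ∷ rs-before
          ; ls-before = ls-before }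
      side : Halves M u zs → Cross x y → Halves M u (z ∷ zs)
      side H (spans f g refl refl) = ⊥-elim (¬flat ((f , refl) , (g , refl)))
      side H (lower x′ y′ refl refl e) = addL H (x′ , y′) (¬ux , uy , e) (refl , inj₁ refl)
      side H (upper x′ y′ refl refl e) = addR H (x′ , y′) (¬ux , uy , e) (refl , inj₁ refl)
      -- The middle point decides the half: if it is in `u`, the rung already enters `u` below the
      -- middle level, otherwise above it.
      side H (cross x′ y′ a refl refl e e′) with T? (u (pt (here a)))
      ... | yes ua = addL H (x′ , top a) (¬ux , ua , e) (refl , inj₂ (a , y′ , refl , refl , e′))
      ... | no ¬ua = addR H (bot a , y′) (¬ua , uy , e′) (refl , inj₂ (a , x′ , refl , refl , e))

  -- Induction over the tree with the potential `(k + k) * outside`. Without a flat rung, the rungs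
  -- are distributed over the two halves, and the terms of the middle level cancel. With a flat rung
  -- there are at most `k + k` rungs in all, paid for by the drop of `outside` that regularity
  -- guarantees for this rung.
  ladder-length : WF M t → (u : Cl t → Bool) → (∀ x y → Rel M x y → T (u x) → T (u y)) →
                  ∀ zs → All (Edge M u) zs → AllPairs (Before M) zs →
                  length zs + (k + k) * outside (u ∘ top) ≤ (k + k) * outside (u ∘ bot)
  ladder-length {M} {t} wf u mono zs edges before = go (any? flat? zs)
    where
    μ = some (regular wf)
    level : ∀ {f g} → T (M f g) → T (u (bot f)) → T (u (top g))
    level {f} {g} = mono (bot f) (top g)
    drops : ∀ z → Edge M u z → Flat z → outside (u ∘ top) < outside (u ∘ bot)
    drops (bot f , top g) (¬uf , ug , h) _ with through (regular wf) f g h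
    ... | μ′ , refl = outside-< M (u ∘ bot) (u ∘ top) level μ′ g ug ¬uf
    none : ∀ zs → All (Edge M u) zs → WF M t → All (¬_ ∘ Flat) zs → AllPairs (Before M) zs → (∀ x y → Rel M x y → T (u x) → T (u y)) →
           length zs + (k + k) * outside (u ∘ top) ≤ (k + k) * outside (u ∘ bot)
    none [] _ (leaf r) _ _ _ = *-monoʳ-≤ (k + k) (outside-≤ M (u ∘ bot) (u ∘ top) level μ)
    none ((bot f , top g) ∷ _) _ (leaf _) (¬flat ∷ _) _ _ = ⊥-elim (¬flat ((f , refl) , (g , refl)))
    none ((top _ , _) ∷ _) ((_ , _ , ()) ∷ _) (leaf _) _ _ _
    none ((bot _ , bot _) ∷ _) ((_ , _ , ()) ∷ _) (leaf _) _ _ _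
    none zs edges wf@(node _ _ wl wr) ¬flats before mono = begin
      length zs + c * o₂                          ≡⟨ cong (_+ c * o₂) total ⟩
      length ls + length rs + c * o₂              ≡⟨ +-assoc (length ls) (length rs) (c * o₂) ⟩
      length ls + (length rs + c * o₂)            ≤⟨ +-monoʳ-≤ (length ls) (ladder-length wr (u ∘ embR)
                                                       (λ x y h → mono (embR x) (embR y) (embR-rel x y h)) rs rs-edge rs-before) ⟩
      length ls + c * outside (u ∘ embL ∘ top)    ≤⟨ ladder-length wl (u ∘ embL)
                                                       (λ x y h → mono (embL x) (embL y) (embL-rel x y h)) ls ls-edge ls-before ⟩
      c * outside (u ∘ bot)                       ∎
      where
      open ≤-Reasoning
      open Halves (halves wf u zs edges before ¬flats)
      c = k + k
      o₂ = outside (u ∘ top)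
    go : Dec (Any Flat zs) → length zs + (k + k) * outside (u ∘ top) ≤ (k + k) * outside (u ∘ bot)
    go (yes a) = let z , z∈ , f = find a in begin
      length zs + (k + k) * outside (u ∘ top) ≤⟨ +-monoˡ-≤ _ (flat-length zs edges before a) ⟩
      (k + k) + (k + k) * outside (u ∘ top)   ≡⟨ *-suc (k + k) (outside (u ∘ top)) ⟨
      (k + k) * suc (outside (u ∘ top))       ≤⟨ *-monoʳ-≤ (k + k) (drops z (All.lookup edges z∈) f) ⟩
      (k + k) * outside (u ∘ bot)             ∎
      where open ≤-Reasoning
    go (no ¬a) = none zs edges wf (All.tabulate λ z∈ f → ¬a (lose z∈ f)) before mono

  -- The rungs after the first one leave the strict up-set of its upper point.
  ladderFree : WF M t → LadderFree (_≺_ {t}) (suc ((k + k) * k))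
  ladderFree wf [] _ _ = z≤n
  ladderFree {M} {t} wf ((x₁ , y₁) ∷ zs) (_ ∷ all) (r ∷ rs) = s≤s (begin
      length zs                                 ≡⟨ length-map f zs ⟨
      length (map f zs)                         ≤⟨ m≤m+n _ _ ⟩
      length (map f zs) + (k + k) * outside (u ∘ top) ≤⟨ ladder-length wf u mono (map f zs) edges
                                                      (AllPairs.map⁺ (AllPairs.map (λ {z} {z′} → bef {z} {z′}) rs)) ⟩
      (k + k) * outside (u ∘ bot)               ≤⟨ *-monoʳ-≤ (k + k) (≤-trans (length-filter _ (allFin k)) (≤-reflexive (length-tabulate (λ i → i)))) ⟩
      (k + k) * k                               ∎)
    where
    open ≤-Reasoning
    f : Pt t × Pt t → Cl t × Cl t
    f (x , y) = pt x , pt y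
    rel? : ∀ y → Dec (Rel M (pt y₁) y)
    rel? (bot _) = no λ ()
    rel? (pt q)  = y₁ ≺? q
    rel? (top g) = dn? y₁ g
    u : Cl t → Bool
    u y = ⌊ rel? y ⌋
    mono : ∀ x y → Rel M x y → T (u x) → T (u y)
    mono x y h ux = fromWitness (rel-trans wf (pt y₁) x y (toWitness ux) h)
    edges : All (Edge M u) (map f zs)
    edges = All.map⁺ (All.tabulate λ {z} z∈ →
      let _ , y<y′ , _ , y₁⊀x = All.lookup r z∈ in (λ ux → y₁⊀x (toWitness ux)) , fromWitness y<y′ , All.lookup all z∈)
    bef : ∀ {z z′} → Rung _≺_ z z′ → Before M (f z) (f z′)
    bef {x , y} {x′ , y′} (a , b , c , _) = ≺⇒leP x x′ a , ≺⇒leP y y′ b , c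


-- Coloured points and insertion

module Coloured (k : ℕ) where
  open Levels k

  -- Each level is inserted for one presented vertex, and only the point of that vertex is coloured.
  -- The remaining points of the level merely transmit the relation.
  data V : Tree → Set where
    left  : ∀ {l L A j R r} → V l → V (node l L A j R r)
    here  : ∀ {l L A j R r} → V (node l L A j R r)
    right : ∀ {l L A j R r} → V r → V (node l L A j R r)

  private variable
    t : Tree
    M : Mat

  emb : V t → Pt t
  emb (left v)       = left (emb v)
  emb (here {j = j}) = here j
  emb (right v)      = right (emb v)

  emb-inj : {u v : V t} → emb u ≡ emb v → u ≡ v
  emb-inj {u = u} {v} = go u v
    where
    left-inj : ∀ {l L A j R r} {p q : Pt l} → _≡_ {A = Pt (node l L A j R r)} (left p) (left q) → p ≡ q
    left-inj refl = refl
    right-inj : ∀ {l L A j R r} {p q : Pt r} → _≡_ {A = Pt (node l L A j R r)} (right p) (right q) → p ≡ q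
    right-inj refl = refl
    go : ∀ {t} (u v : V t) → emb u ≡ emb v → u ≡ v
    go (left u)  (left v)  e = cong left (go u v (left-inj e))
    go here      here      _ = refl
    go (right u) (right v) e = cong right (go u v (right-inj e))
    go (left _)  here      ()
    go (left _)  (right _) ()
    go here      (left _)  ()
    go here      (right _) ()
    go (right _) (left _)  ()
    go (right _) here      ()

  vertices : (t : Tree) → List (V t)
  vertices leaf               = []
  vertices (node l L A j R r) = map left (vertices l) ++ here ∷ map right (vertices r)

  ∈-vertices : (v : V t) → v ∈ vertices t
  ∈-vertices (left v)  = ∈-++⁺ˡ (∈-map⁺ left (∈-vertices v))
  ∈-vertices (here {l = l}) = ∈-++⁺ʳ (map left (vertices l)) (here refl)
  ∈-vertices (right {l = l} v) = ∈-++⁺ʳ (map left (vertices l)) (there (∈-map⁺ right (∈-vertices v)))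

  size : Tree → ℕ
  size leaf               = 0
  size (node l L A j R r) = suc (size l + size r)

  -- The in-order numbering of the nodes, a linear extension of `≺` on the coloured points.
  pos : V t → ℕ
  pos (left v)          = pos v
  pos (here {l = l})    = size l
  pos (right {l = l} v) = suc (size l + pos v)

  pos<size : (v : V t) → pos v < size t
  pos<size (left v)          = m≤n⇒m≤1+n (m≤n⇒m≤n+o _ (pos<size v))
  pos<size (here {l = l})    = s≤s (m≤m+n (size l) _)
  pos<size (right {l = l} v) = s≤s (+-monoʳ-< (size l) (pos<size v))

  pos-mono : (u v : V t) → emb u ≺ emb v → pos u < pos v
  pos-mono (left u)  (left v)  h = pos-mono u v h
  pos-mono (left u)  here      h = pos<size u
  pos-mono (left u)  (right v) h = m≤n⇒m≤1+n (m≤n⇒m≤n+o _ (pos<size u))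
  pos-mono (here {l = l}) (right v) h = s≤s (m≤m+n (size l) _)
  pos-mono (right {l = l} u) (right v) h = s≤s (+-monoʳ-< (size l) (pos-mono u v h))

  pos-inj : (u v : V t) → pos u ≡ pos v → u ≡ v
  pos-inj (left u)  (left v)  e = cong left (pos-inj u v e)
  pos-inj here      here      e = refl
  pos-inj (right {l = l} u) (right v) e = cong right (pos-inj u v (+-cancelˡ-≡ (size l) _ _ (suc-injective e)))
  pos-inj (left u)  here      e = ⊥-elim (<⇒≢ (pos<size u) e)
  pos-inj here      (left v)  e = ⊥-elim (<⇒≢ (pos<size v) (sym e))
  pos-inj (left u)  (right {l = l} v) e = ⊥-elim (<⇒≢ (m≤n⇒m≤1+n (m≤n⇒m≤n+o _ (pos<size u))) e)
  pos-inj (right {l = l} u) (left v)  e = ⊥-elim (<⇒≢ (m≤n⇒m≤1+n (m≤n⇒m≤n+o _ (pos<size v))) (sym e))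
  pos-inj (here {l = l}) (right v) e = ⊥-elim (<⇒≢ (s≤s (m≤m+n (size l) _)) e)
  pos-inj (right {l = l} u) here   e = ⊥-elim (<⇒≢ (s≤s (m≤m+n (size l) _)) (sym e))

  _⋎_ : V t → V t → Set
  u ⋎ v = ¬ emb u ≺ emb v × ¬ emb v ≺ emb u

  _⋎?_ : (u v : V t) → Dec (u ⋎ v)
  u ⋎? v = ¬? (emb u ≺? emb v) ×-dec ¬? (emb v ≺? emb u)

  record FirstFit (t : Tree) (col : V t → ℕ) : Set where
    field
      proper : ∀ u v → col u ≡ col v → u ≡ v ⊎ (emb u ≺ emb v ⊎ emb v ≺ emb u)
      first  : ∀ v {i} → i < col v → ∃[ u ] col u ≡ i × u ⋎ v
  open FirstFit

  -- By First-Fit, the colours up to `col v` form a wall on all coloured points, covered by the `k`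
  -- chains of `base`. The parameters `m` and `l` are left free so that a common choice serves all
  -- stages.
  colours-bound : WF M t → {col : V t → ℕ} → FirstFit t col → ∀ m → suc ((k + k) * k) ≤ m → ∀ l → k < 2 ^ l →
                  ∀ v → col v < Growth.F m l
  colours-bound {M} {t} wf {col} ff m m≥ l k< v =
    subst (_≤ Growth.F m l) (length-downFrom (suc (col v)))
      (bounded l (λ _ → yes tt) (allFin k) (subst (_< 2 ^ l) (sym (length-tabulate (λ i → i))) k<) (λ {u} _ → ∈-allFin _)
        (wall (AllPairs.applyDownFrom⁺₁ id (suc (col v)) (λ j<i _ → j<i)) λ {u} _ _ _ lt → let w , e , a = first ff u lt in w , tt , e , a)
        λ i∈ → hit (∈-downFrom⁻ i∈))
    where
    O : FiniteOrder
    O = record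
      { V = V t ; vs = vertices t ; ∈-vs = ∈-vertices
      ; _⊏_ = λ u v → emb u ≺ emb v ; _⊏?_ = λ u v → emb u ≺? emb v
      ; ⊏-trans = λ {u} {v} {w} → ≺-trans wf (emb u) (emb v) (emb w)
      ; ⊏-irr = λ {u} h → <-irrefl refl (pos-mono u u h) }
    free : LadderFree (λ u v → emb u ≺ emb v) m
    free zs all ap = ≤-trans (subst (_≤ suc ((k + k) * k)) (length-map _ zs)
      (ladderFree wf (map (λ (x , y) → emb x , emb y) zs) (All.map⁺ all) (AllPairs.map⁺ ap))) m≥
    base-col : {u w : V t} → base wf (emb u) ≡ base wf (emb w) → u ≡ w ⊎ (emb u ≺ emb w ⊎ emb w ≺ emb u)
    base-col {u} {w} e with base-alike wf (emb u) (emb w) e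
    ... | inj₁ eq = inj₁ (emb-inj eq)
    ... | inj₂ c  = inj₂ c
    open WallBound O col (λ {u} {v} → proper ff u v) Fin._≟_ (λ u → base wf (emb u)) (λ {u} {w} → base-col {u} {w})
      m free pos (λ {u} {v} → pos-mono u v) (λ {u} {v} → pos-inj u v)
    open Colouring O col (λ {u} {v} → proper ff u v)
    hit : ∀ {i} → i < suc (col v) → Hit (λ _ → ⊤) i
    hit lt with m≤n⇒m<n∨m≡n (≤-pred lt)
    ... | inj₂ refl = v , tt , refl
    ... | inj₁ i<   = let u , e , _ = first ff v i< in u , tt , e

  -- Inserting a level and extending the colouring

  data Gap : Tree → Set where
    gap   : Gap leaf
    left  : ∀ {l L A j R r} → Gap l → Gap (node l L A j R r)
    right : ∀ {l L A j R r} → Gap r → Gap (node l L A j R r)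

  insert : Gap t → Mat → (Fin k → ℕ) → Fin k → Mat → Tree
  insert gap                                          L′ A′ j′ R′ = node leaf L′ A′ j′ R′ leaf
  insert (left  {l = l} {L} {A} {j} {R} {r} γ) L′ A′ j′ R′ = node (insert γ L′ A′ j′ R′) L A j R r
  insert (right {l = l} {L} {A} {j} {R} {r} γ) L′ A′ j′ R′ = node l L A j R (insert γ L′ A′ j′ R′)

  module _ {L : Mat} {A : Fin k → ℕ} {j : Fin k} {R : Mat} where
    oldP : (γ : Gap t) → Pt t → Pt (insert γ L A j R)
    oldP (left γ)  (left p)  = left (oldP γ p)
    oldP (left γ)  (here a)  = here a
    oldP (left γ)  (right p) = right p
    oldP (right γ) (left p)  = left p
    oldP (right γ) (here a)  = here a
    oldP (right γ) (right p) = right (oldP γ p)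

    old : (γ : Gap t) → V t → V (insert γ L A j R)
    old (left γ)  (left v)  = left (old γ v)
    old (left γ)  here      = here
    old (left γ)  (right v) = right v
    old (right γ) (left v)  = left v
    old (right γ) here      = here
    old (right γ) (right v) = right (old γ v)

    new : (γ : Gap t) → V (insert γ L A j R)
    new gap       = here
    new (left γ)  = left (new γ)
    new (right γ) = right (new γ)

    data View (γ : Gap t) : V (insert γ L A j R) → Set where
      isOld : ∀ v → View γ (old γ v)
      isNew : View γ (new γ)

    view : (γ : Gap t) → ∀ v → View γ v
    view gap here = isNew
    view (left γ) (left v) with view γ v
    ... | isOld u = isOld (left u)
    ... | isNew   = isNew
    view (left γ) here      = isOld here
    view (left γ) (right v) = isOld (right v)
    view (right γ) (left v) = isOld (left v)
    view (right γ) here     = isOld here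
    view (right γ) (right v) with view γ v
    ... | isOld u = isOld (right u)
    ... | isNew   = isNew

    view-old : (γ : Gap t) → ∀ v → view γ (old γ v) ≡ isOld v
    view-old (left γ)  (left v)  rewrite view-old γ v = refl
    view-old (left γ)  here      = refl
    view-old (left γ)  (right v) = refl
    view-old (right γ) (left v)  = refl
    view-old (right γ) here      = refl
    view-old (right γ) (right v) rewrite view-old γ v = refl

    view-new : (γ : Gap t) → view γ (new γ) ≡ isNew
    view-new gap = refl
    view-new (left γ)  rewrite view-new γ = refl
    view-new (right γ) rewrite view-new γ = refl

    emb-old : (γ : Gap t) → ∀ v → emb (old γ v) ≡ oldP γ (emb v)
    emb-old (left γ)  (left v)  = cong left (emb-old γ v)
    emb-old (left γ)  here      = refl
    emb-old (left γ)  (right v) = refl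
    emb-old (right γ) (left v)  = refl
    emb-old (right γ) here      = refl
    emb-old (right γ) (right v) = cong right (emb-old γ v)

    up-old : (γ : Gap t) → ∀ f p → (up f p → up f (oldP γ p)) × (up f (oldP γ p) → up f p)
    up-old (left γ)  f (left p)  = up-old γ f p
    up-old (left γ)  f (here a)  = id , id
    up-old (left γ)  f (right p) = id , id
    up-old (right γ) f (left p)  = id , id
    up-old (right γ) f (here a)  = id , id
    up-old (right γ) f (right p) = (λ (a , e , u) → a , e , proj₁ (up-old γ a p) u) , (λ (a , e , u) → a , e , proj₂ (up-old γ a p) u)

    dn-old : (γ : Gap t) → ∀ p g → (dn p g → dn (oldP γ p) g) × (dn (oldP γ p) g → dn p g)
    dn-old (left γ)  (left p)  g = (λ (a , d , e) → a , proj₁ (dn-old γ p a) d , e) , (λ (a , d , e) → a , proj₂ (dn-old γ p a) d , e)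
    dn-old (left γ)  (here a)  g = id , id
    dn-old (left γ)  (right p) g = id , id
    dn-old (right γ) (left p)  g = id , id
    dn-old (right γ) (here a)  g = id , id
    dn-old (right γ) (right p) g = dn-old γ p g

    -- Colours are irrevocable, so the First-Fit property of the points coloured so far has to
    -- survive every insertion; this equivalence ensures it.
    ≺-oldP : (γ : Gap t) → ∀ p q → (p ≺ q → oldP γ p ≺ oldP γ q) × (oldP γ p ≺ oldP γ q → p ≺ q)
    ≺-oldP (left γ)  (left p)  (left q)  = ≺-oldP γ p q
    ≺-oldP (left γ)  (left p)  (here a)  = dn-old γ p a
    ≺-oldP (left γ)  (left p)  (right q) = (λ (a , d , u) → a , proj₁ (dn-old γ p a) d , u) , (λ (a , d , u) → a , proj₂ (dn-old γ p a) d , u)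
    ≺-oldP (right γ) (left p)  (right q) = (λ (a , d , u) → a , d , proj₁ (up-old γ a q) u) , (λ (a , d , u) → a , d , proj₂ (up-old γ a q) u)
    ≺-oldP (right γ) (here a)  (right q) = up-old γ a q
    ≺-oldP (right γ) (right p) (right q) = ≺-oldP γ p q
    ≺-oldP (left γ)  (here _)  (left _)  = (λ ()) , λ ()
    ≺-oldP (left γ)  (here _)  (here _)  = (λ ()) , λ ()
    ≺-oldP (left γ)  (here _)  (right _) = id , id
    ≺-oldP (left γ)  (right _) (left _)  = (λ ()) , λ ()
    ≺-oldP (left γ)  (right _) (here _)  = (λ ()) , λ ()
    ≺-oldP (left γ)  (right _) (right _) = id , id
    ≺-oldP (right γ) (left _)  (left _)  = id , id
    ≺-oldP (right γ) (left _)  (here _)  = id , id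
    ≺-oldP (right γ) (here _)  (left _)  = (λ ()) , λ ()
    ≺-oldP (right γ) (here _)  (here _)  = (λ ()) , λ ()
    ≺-oldP (right γ) (right _) (left _)  = (λ ()) , λ ()
    ≺-oldP (right γ) (right _) (here _)  = (λ ()) , λ ()

    ≺-old : (γ : Gap t) → ∀ u v → (emb u ≺ emb v → emb (old γ u) ≺ emb (old γ v)) × (emb (old γ u) ≺ emb (old γ v) → emb u ≺ emb v)
    ≺-old γ u v rewrite emb-old γ u | emb-old γ v = ≺-oldP γ (emb u) (emb v)

  module _ {L : Mat} {A : Fin k → ℕ} {j : Fin k} {R : Mat} (γ : Gap t) (col : V t → ℕ) where
    private
      N = new {L = L} {A} {j} {R} γ

    Blocked : ℕ → Set
    Blocked c = Any (λ u → col u ≡ c × old {L = L} {A} {j} {R} γ u ⋎ N) (vertices t)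

    blocked? : ∀ c → Dec (Blocked c)
    blocked? c = any? (λ u → (col u ≟ c) ×-dec (old γ u ⋎? N)) (vertices t)

    mex : ∃[ c ] ¬ Blocked c × (∀ {i} → i < c → ¬ ¬ Blocked i)
    -- A strict upper bound of all colours in use is not blocked, so the search has a starting
    -- point.
    mex = least (λ c → ¬? (blocked? c)) (proj₁ bd) λ b → let _ , u∈ , e , _ = find b in <-irrefl e (proj₂ bd u∈)
      where bd = strict-bound col (vertices t)

    extend : V (insert γ L A j R) → ℕ
    extend v with view γ v
    ... | isOld u = col u
    ... | isNew   = proj₁ mex

    extend-old : ∀ v → extend (old γ v) ≡ col v
    extend-old v rewrite view-old {L = L} {A} {j} {R} γ v = refl

    extend-new : extend (new γ) ≡ proj₁ mex
    extend-new rewrite view-new {L = L} {A} {j} {R} γ = refl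

    extend-firstFit : FirstFit t col → FirstFit (insert γ L A j R) extend
    extend-firstFit ff = record { proper = λ u v e → prop u v (view γ u) (view γ v) e ; first = λ v → fst v (view γ v) }
      where
      n-o : ∀ u → proj₁ mex ≡ col u → emb (old γ u) ≺ emb N ⊎ emb N ≺ emb (old γ u)
      n-o u e with emb (old {L = L} {A} {j} {R} γ u) ≺? emb N | emb N ≺? emb (old {L = L} {A} {j} {R} γ u)
      ... | yes a | _     = inj₁ a
      ... | no _  | yes b = inj₂ b
      ... | no ¬a | no ¬b = ⊥-elim (proj₁ (proj₂ mex) (lose (∈-vertices u) (sym e , ¬a , ¬b)))
      prop : ∀ u v → View γ u → View γ v → extend u ≡ extend v → u ≡ v ⊎ (emb u ≺ emb v ⊎ emb v ≺ emb u)
      prop _ _ (isOld u) (isOld v) e with proper ff u v (trans (sym (extend-old u)) (trans e (extend-old v)))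
      ... | inj₁ refl     = inj₁ refl
      ... | inj₂ (inj₁ h) = inj₂ (inj₁ (proj₁ (≺-old γ u v) h))
      ... | inj₂ (inj₂ h) = inj₂ (inj₂ (proj₁ (≺-old γ v u) h))
      prop _ _ (isOld u) isNew e = inj₂ (n-o u (trans (sym extend-new) (trans (sym e) (extend-old u))))
      prop _ _ isNew (isOld v) e with n-o v (trans (sym extend-new) (trans e (extend-old v)))
      ... | inj₁ h = inj₂ (inj₂ h)
      ... | inj₂ h = inj₂ (inj₁ h)
      prop _ _ isNew isNew e = inj₁ refl
      fst : ∀ v → View γ v → ∀ {i} → i < extend v → ∃[ u ] extend u ≡ i × u ⋎ v
      fst _ (isOld v) lt with first ff v (subst (_ <_) (extend-old v) lt)
      ... | u , e , a , b = old γ u , trans (extend-old u) e , (λ h → a (proj₂ (≺-old γ u v) h)) , (λ h → b (proj₂ (≺-old γ v u) h))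
      fst _ isNew {i} lt with blocked? i
      ... | yes b = let u , _ , e , h = find b in old γ u , trans (extend-old u) e , h
      ... | no ¬b = ⊥-elim (proj₂ (proj₂ mex) (subst (i <_) extend-new lt) ¬b)


-- Dilworth's theorem

_◂_ : {k : ℕ} → A → (Fin k → A) → Fin (suc k) → A
(a ◂ g) fzero    = a
(a ◂ g) (fsuc i) = g i

-- Functions are enumerated value by value, hence only up to pointwise equality; `P` must respect it
-- because function extensionality is not assumed.
anyFunction? : (D : List A) (k : ℕ) {P : (Fin k → A) → Set} → (∀ {g h} → g ≗ h → P g → P h) → (∀ g → Dec (P g)) →
               Dec (∃[ g ] (∀ i → g i ∈ D) × P g)
anyFunction? D zero resp P? with P? (λ ())
... | yes p = yes ((λ ()) , (λ ()) , p)
... | no ¬p = no λ (g , _ , p) → ¬p (resp (λ ()) p)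
anyFunction? {A} D (suc k) {P} resp P?
  with any? (λ a → anyFunction? D k {λ g → P (a ◂ g)} (λ e → resp (cons-cong a e)) (λ g → P? (a ◂ g))) D
  where
  cons-cong : ∀ a {g h : Fin k → A} → g ≗ h → (a ◂ g) ≗ (a ◂ h)
  cons-cong a e fzero    = refl
  cons-cong a e (fsuc i) = e i
... | yes p = let a , a∈ , g , g∈ , Pg = find p in yes (a ◂ g , (λ { fzero → a∈ ; (fsuc i) → g∈ i }) , Pg)
... | no ¬p = no λ (g , g∈ , Pg) → ¬p (lose (g∈ fzero) (g ∘ fsuc , g∈ ∘ fsuc , resp (λ { fzero → refl ; (fsuc i) → refl }) Pg))

injective⇒surjective : {k : ℕ} (τ : Fin k → Fin k) → (∀ {i j} → τ i ≡ τ j → i ≡ j) → ∀ c → ∃[ i ] τ i ≡ c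
injective⇒surjective {k} τ inj c with Fin.any? (λ i → τ i Fin.≟ c)
... | yes p = p
... | no ¬p = ⊥-elim (<-irrefl refl (subst₂ _<_ (trans (length-map τ (allFin k)) k≡) k≡
    (unique-length Fin._≟_ (c ∷ map τ (allFin k)) (allFin k)
      (All.tabulate new ∷ AllPairs.map⁺ (AllPairs.map (λ ne e → ne (inj e)) (AllPairs.tabulate⁺ {f = λ i → i} id))) λ _ → ∈-allFin _)))
  where
  k≡ : length (allFin k) ≡ k
  k≡ = length-tabulate (λ i → i)
  new : ∀ {d} → d ∈ map τ (allFin k) → c ≢ d
  new d∈ refl = let i , _ , e = ∈-map⁻ τ d∈ in ¬p (i , sym e)

Independent : (A → A → Set) → {k : ℕ} → (Fin k → A) → Set
Independent _⊑_ g = ∀ i j → i ≢ j → ¬ g i ⊑ g j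

independent? : {_⊑_ : A → A → Set} → (∀ a b → Dec (a ⊑ b)) → ∀ {k} (g : Fin k → A) → Dec (Independent _⊑_ g)
independent? ⊑? g = Fin.all? λ i → Fin.all? λ j → dec (i Fin.≟ j) (⊑? (g i) (g j))
  where
  dec : {X Y : Set} → Dec X → Dec Y → Dec (¬ X → ¬ Y)
  dec (yes x) _       = yes λ ¬x → ⊥-elim (¬x x)
  dec (no ¬x) (no ¬y) = yes λ _ → ¬y
  dec (no ¬x) (yes y) = no λ f → f ¬x y

independent-resp : (_⊑_ : A → A → Set) {k : ℕ} {g h : Fin k → A} → g ≗ h → Independent _⊑_ g → Independent _⊑_ h
independent-resp _⊑_ e ac i j ne le = ac i j ne (subst₂ _⊑_ (sym (e i)) (sym (e j)) le)

record DecPoset : Set₁ where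
  field
    Carrier : Set
    _≟ᶜ_    : (a b : Carrier) → Dec (a ≡ b)
    _⊑_     : Carrier → Carrier → Set
    _⊑?_    : ∀ a b → Dec (a ⊑ b)
    ⊑-refl  : ∀ {a} → a ⊑ a
    ⊑-trans : ∀ {a b c} → a ⊑ b → b ⊑ c → a ⊑ c
    ⊑-antisym : ∀ {a b} → a ⊑ b → b ⊑ a → a ≡ b

module Antichains (P : DecPoset) where
  open DecPoset P

  Antichain : {k : ℕ} → (Fin k → Carrier) → Set
  Antichain = Independent _⊑_

  Narrow : ℕ → List Carrier → Set
  Narrow k D = (g : Fin (suc k) → Carrier) → (∀ i → g i ∈ D) → ¬ Antichain g

  record Chains (k : ℕ) (D : List Carrier) : Set where
    field
      chain : Carrier → ℕ
      small : ∀ {a} → a ∈ D → chain a < k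
      comp  : ∀ {a b} → a ∈ D → b ∈ D → chain a ≡ chain b → a ⊑ b ⊎ b ⊑ a
  open Chains

  -- No chain contains two elements of an antichain, so the map from its `k` elements to the `k`
  -- chains is injective and therefore surjective.
  hits-chain : ∀ {k D} (C : Chains k D) (g : Fin k → Carrier) → (∀ i → g i ∈ D) → Antichain g →
               ∀ (c : Fin k) → ∃[ i ] chain C (g i) ≡ toℕ c
  hits-chain C g g∈ ac c =
    let i , e = injective⇒surjective (λ i → fromℕ< (small C (g∈ i))) inj c
    in i , trans (sym (Fin.toℕ-fromℕ< _)) (cong toℕ e)
    where
    inj : ∀ {i j} → fromℕ< (small C (g∈ i)) ≡ fromℕ< (small C (g∈ j)) → i ≡ j
    inj {i} {j} e with i Fin.≟ j
    ... | yes i≡j = i≡j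
    ... | no ne with comp C (g∈ i) (g∈ j) (trans (sym (Fin.toℕ-fromℕ< _)) (trans (cong toℕ e) (Fin.toℕ-fromℕ< _)))
    ...   | inj₁ l = ⊥-elim (ac i j ne l)
    ...   | inj₂ l = ⊥-elim (ac j i (ne ∘ sym) l)

  maximal : ∀ a D → ∃[ m ] m ∈ a ∷ D × (∀ {b} → b ∈ a ∷ D → m ⊑ b → b ≡ m)
  maximal a [] = a , here refl , λ { (here refl) _ → refl }
  maximal a (b ∷ D) with maximal b D
  ... | m , m∈ , max with m ⊑? a
  ...   | no m⋢a = m , there m∈ , λ { (here refl) l → ⊥-elim (m⋢a l) ; (there b∈) l → max b∈ l }
  ...   | yes m⊑a = a , here refl , λ { (here refl) _ → refl
                                    ; (there b∈) a⊑b → ⊑-antisym (subst (_⊑ a) (sym (max b∈ (⊑-trans m⊑a a⊑b))) m⊑a) a⊑b }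

  greatest : {Q : Carrier → Set} → (∀ a → Dec (Q a)) → ∀ D → (∀ {a b} → Q a → Q b → a ⊑ b ⊎ b ⊑ a) →
             ∀ {a} → Q a → ∃[ m ] Q m × (∀ {b} → b ∈ D → Q b → b ⊑ m)
  greatest Q? []      tot {a} Qa = a , Qa , λ ()
  greatest Q? (b ∷ D) tot Qa with greatest Q? D tot Qa | Q? b
  ... | m , Qm , ub | no ¬Qb = m , Qm , λ { (here refl) Qb → ⊥-elim (¬Qb Qb) ; (there c∈) → ub c∈ }
  ... | m , Qm , ub | yes Qb with tot Qb Qm
  ...   | inj₁ b⊑m = m , Qm , λ { (here refl) _ → b⊑m ; (there c∈) → ub c∈ }
  ...   | inj₂ m⊑b = b , Qb , λ { (here refl) _ → ⊑-refl ; (there c∈) Qc → ⊑-trans (ub c∈ Qc) m⊑b }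

  -- Galvin's proof: remove a maximal element a and split the rest into chains. In each chain take the greatest
  -- element lying on a k-antichain; some such x is below a, and a with the part of the chain below x is split off.
  module Galvin {k : ℕ} {a : Carrier} {D D′ : List Carrier} (narrow : Narrow k D) (a∈ : a ∈ D)
                (max : ∀ {b} → b ∈ D → a ⊑ b → b ≡ a) (D′⊆ : ∀ {b} → b ∈ D′ → b ∈ D × b ≢ a)
                (C : Chains k D′) (g₀ : Fin k → Carrier) (g₀∈ : ∀ i → g₀ i ∈ D′) (ac₀ : Antichain g₀) where

    OnAntichain : Carrier → Set
    OnAntichain y = ∃[ g ] (∀ i → g i ∈ D′) × (Antichain {k} g × ∃[ i ] g i ≡ y)

    onAntichain? : ∀ y → Dec (OnAntichain y)
    onAntichain? y = anyFunction? D′ k (λ e (ac , i , eq) → independent-resp _⊑_ e ac , i , trans (sym (e i)) eq)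
      λ g → independent? _⊑?_ g ×-dec Fin.any? λ i → g i ≟ᶜ y

    Candidate : Fin k → Carrier → Set
    Candidate c y = (y ∈ D′ × chain C y ≡ toℕ c) × OnAntichain y

    candidate : ∀ c → ∃[ m ] Candidate c m × (∀ {b} → b ∈ D′ → Candidate c b → b ⊑ m)
    candidate c with hits-chain C g₀ g₀∈ ac₀ c
    ... | i , e = greatest (λ y → (any? (y ≟ᶜ_) D′ ×-dec (chain C y ≟ toℕ c)) ×-dec onAntichain? y) D′
      (λ ((a∈ , ea) , _) ((b∈ , eb) , _) → comp C a∈ b∈ (trans ea (sym eb)))
      ((g₀∈ i , e) , g₀ , g₀∈ , ac₀ , i , refl)

    x : Fin k → Carrier
    x c = proj₁ (candidate c)

    x∈ : ∀ c → x c ∈ D′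
    x∈ c = proj₁ (proj₁ (proj₁ (proj₂ (candidate c))))

    x-chain : ∀ c → chain C (x c) ≡ toℕ c
    x-chain c = proj₂ (proj₁ (proj₁ (proj₂ (candidate c))))

    -- Suppose `x c ⊑ x d`, and take a `k`-antichain through `x d`. Its element on chain `c` is at
    -- most `x c` by the choice of `x c`, hence below `x d`, another element of the same antichain.
    x-antichain : Antichain x
    x-antichain c d c≢d le with proj₂ (proj₁ (proj₂ (candidate d)))
    ... | g , g∈ , ac , i , gi≡ with hits-chain C g g∈ ac c
    ... | j , e = ac j i
      (λ { refl → c≢d (Fin.toℕ-injective (trans (sym e) (trans (cong (chain C) gi≡) (x-chain d)))) })
      (⊑-trans (proj₂ (proj₂ (candidate c)) (g∈ j) ((g∈ j , e) , g , g∈ , ac , j , refl)) (subst (x c ⊑_) (sym gi≡) le))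

    below : ∃[ c ] x c ⊑ a
    below with Fin.any? (λ c → x c ⊑? a)
    ... | yes p = p
    ... | no ¬p = ⊥-elim (narrow (a ◂ x) (λ { fzero → a∈ ; (fsuc c) → proj₁ (D′⊆ (x∈ c)) })
      λ { fzero    fzero    ne _  → ne refl
        ; fzero    (fsuc c) _  le → proj₂ (D′⊆ (x∈ c)) (max (proj₁ (D′⊆ (x∈ c))) le)
        ; (fsuc c) fzero    _  le → ¬p (c , le)
        ; (fsuc c) (fsuc d) ne le → x-antichain c d (ne ∘ cong fsuc) le })

    Split : Fin k → Carrier → Set
    Split c z = z ≡ a ⊎ (z ∈ D′ × chain C z ≡ toℕ c × z ⊑ x c)

    split? : ∀ c z → Dec (Split c z)
    split? c z = (z ≟ᶜ a) ⊎-dec (any? (z ≟ᶜ_) D′ ×-dec (chain C z ≟ toℕ c) ×-dec (z ⊑? x c))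

    split-comp : ∀ c → x c ⊑ a → ∀ {y z} → Split c y → Split c z → y ⊑ z ⊎ z ⊑ y
    split-comp c le (inj₁ refl)          (inj₁ refl)          = inj₁ ⊑-refl
    split-comp c le (inj₁ refl)          (inj₂ (_ , _ , l))   = inj₂ (⊑-trans l le)
    split-comp c le (inj₂ (_ , _ , l))   (inj₁ refl)          = inj₁ (⊑-trans l le)
    split-comp c le (inj₂ (y∈ , ey , _)) (inj₂ (z∈ , ez , _)) = comp C y∈ z∈ (trans ey (sym ez))

    -- A `k`-antichain would meet chain `c` in a candidate, which is at most `x c` and has therefore
    -- been split off.
    narrow′ : ∀ c (g : Fin k → Carrier) → (∀ i → g i ∈ D′ × ¬ Split c (g i)) → ¬ Antichain g
    narrow′ c g g∈ ac with hits-chain C g (proj₁ ∘ g∈) ac c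
    ... | i , e = proj₂ (g∈ i) (inj₂ (proj₁ (g∈ i) , e ,
      proj₂ (proj₂ (candidate c)) (proj₁ (g∈ i)) ((proj₁ (g∈ i) , e) , g , proj₁ ∘ g∈ , ac , i , refl)))

  add-chain : ∀ {k D D″} {Q : Carrier → Set} → (∀ z → Dec (Q z)) → (∀ {y z} → Q y → Q z → y ⊑ z ⊎ z ⊑ y) →
              (∀ {z} → z ∈ D → ¬ Q z → z ∈ D″) → Chains k D″ → Chains (suc k) D
  add-chain {k} {D} {D″} {Q} Q? Q-comp sub C = record
    { chain = λ z → ch z (Q? z) ; small = λ {z} z∈ → sm z∈ (Q? z) ; comp = λ {y} {z} y∈ z∈ → cp y∈ z∈ (Q? y) (Q? z) }
    where
    ch : ∀ z → Dec (Q z) → ℕ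
    ch z (yes _) = k
    ch z (no  _) = chain C z
    sm : ∀ {z} → z ∈ D → (q : Dec (Q z)) → ch z q < suc k
    sm z∈ (yes _) = ≤-refl
    sm z∈ (no ¬q) = m≤n⇒m≤1+n (small C (sub z∈ ¬q))
    cp : ∀ {y z} → y ∈ D → z ∈ D → (p : Dec (Q y)) (q : Dec (Q z)) → ch y p ≡ ch z q → y ⊑ z ⊎ z ⊑ y
    cp y∈ z∈ (yes p) (yes q) _ = Q-comp p q
    cp y∈ z∈ (no ¬p) (no ¬q) e = comp C (sub y∈ ¬p) (sub z∈ ¬q) e
    cp y∈ z∈ (yes _) (no ¬q) e = ⊥-elim (<⇒≢ (small C (sub z∈ ¬q)) (sym e))
    cp y∈ z∈ (no ¬p) (yes _) e = ⊥-elim (<⇒≢ (small C (sub y∈ ¬p)) e)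

  dilworth-≤ : ∀ n D → length D ≤ n → ∀ k → Narrow k D → Chains k D
  dilworth-≤ n       []        _  k nar = record { chain = λ _ → 0 ; small = λ () ; comp = λ () }
  dilworth-≤ (suc n) D@(b ∷ E) D≤ k nar with maximal b E
  ... | a , a∈ , max = go k nar (anyFunction? D′ k (independent-resp _⊑_) (independent? _⊑?_))
    where
    D′ = filter (λ z → ¬? (z ≟ᶜ a)) D
    in-D′ : ∀ {z} → z ∈ D′ → z ∈ D × z ≢ a
    in-D′ = ∈-filter⁻ (λ z → ¬? (z ≟ᶜ a)) {xs = D}
    to-D′ : ∀ {z} → z ∈ D → z ≢ a → z ∈ D′
    to-D′ = ∈-filter⁺ (λ z → ¬? (z ≟ᶜ a))
    D′≤ : length D′ ≤ n
    D′≤ = ≤-pred (≤-trans (filter-notAll (λ z → ¬? (z ≟ᶜ a)) D (lose a∈ λ ne → ne refl)) D≤)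
    go : ∀ k → Narrow k D → Dec (∃[ g ] (∀ i → g i ∈ D′) × Antichain {k} g) → Chains k D
    go zero    nar (no ¬g) = ⊥-elim (¬g ((λ ()) , (λ ()) , λ ()))
    -- Without `D′` containing an antichain of full size, the maximal element `a` can form a chain
    -- by itself.
    go (suc k) nar (no ¬g) = add-chain (_≟ᶜ a) (λ { refl refl → inj₁ ⊑-refl }) to-D′
      (dilworth-≤ n D′ D′≤ k λ g g∈ ac → ¬g (g , g∈ , ac))
    go k nar (yes (g₀ , g₀∈ , ac₀)) = cut k nar g₀ g₀∈ ac₀ (dilworth-≤ n D′ D′≤ k λ g g∈ → nar g (proj₁ ∘ in-D′ ∘ g∈))
      where
      cut : ∀ k → Narrow k D → (g₀ : Fin k → Carrier) → (∀ i → g₀ i ∈ D′) → Antichain g₀ → Chains k D′ → Chains k D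
      cut k nar g₀ g₀∈ ac₀ C = finish k nar g₀ g₀∈ ac₀ C (Galvin.below nar a∈ max in-D′ C g₀ g₀∈ ac₀)
        where
        finish : ∀ k (nar : Narrow k D) (g₀ : Fin k → Carrier) (g₀∈ : ∀ i → g₀ i ∈ D′) (ac₀ : Antichain g₀) (C : Chains k D′) →
                 ∃[ c ] Galvin.x nar a∈ max in-D′ C g₀ g₀∈ ac₀ c ⊑ a → Chains k D
        finish (suc k) nar g₀ g₀∈ ac₀ C (c , le) =
          add-chain (split? c) (split-comp c le)
            (λ z∈ ¬s → ∈-filter⁺ (λ z → ¬? (split? c z)) (to-D′ z∈ (¬s ∘ inj₁)) ¬s)
            (dilworth-≤ n (filter (λ z → ¬? (split? c z)) D′) (≤-trans (length-filter _ D′) D′≤) k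
              λ g g∈ → narrow′ c g λ i → ∈-filter⁻ (λ z → ¬? (split? c z)) {xs = D′} (g∈ i))
          where open Galvin nar a∈ max in-D′ C g₀ g₀∈ ac₀

  dilworth : ∀ D k → Narrow k D → Chains k D
  dilworth D = dilworth-≤ (length D) D ≤-refl


-- The strategy inside one stage

module Stage (k : ℕ) where
  open Levels k
  open Coloured k

  -- `lo` and `hi` fill two virtual levels below and above everything, so that every gap, even the
  -- first one, lies between two levels.
  data X : Set where
    lo hi : X
    el    : ℕ → X

  Level : Set
  Level = Fin k → X

  leX : (ℕ → ℕ → Bool) → X → X → Set
  leX q lo     _      = ⊤
  leX q _      hi     = ⊤
  leX q (el a) (el b) = T (q a b)
  leX q hi     _      = ⊥
  leX q (el _) lo     = ⊥

  leX? : ∀ q u v → Dec (leX q u v)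
  leX? q lo     _      = yes tt
  leX? q (el a) (el b) = T? (q a b)
  leX? q (el _) lo     = no λ ()
  leX? q (el _) hi     = yes tt
  leX? q hi     lo     = no λ ()
  leX? q hi     (el _) = no λ ()
  leX? q hi     hi     = yes tt

  Below : (ℕ → ℕ → Bool) → Level → Level → (Fin k → Fin k) → Set
  Below q F G τ = Injective τ × (∀ j → leX q (F (τ j)) (G j))

  below? : ∀ q F G τ → Dec (Below q F G τ)
  below? q F G τ = map′ (λ h {i} {j} → h i j) (λ h i j → h)
    (Fin.all? λ i → Fin.all? λ j → dec (τ i Fin.≟ τ j) (i Fin.≟ j)) ×-dec Fin.all? λ j → leX? q (F (τ j)) (G j)
    where
    dec : {Y Z : Set} → Dec Y → Dec Z → Dec (Y → Z)
    dec (no ¬y) _       = yes λ y → ⊥-elim (¬y y)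
    dec (yes _) (yes z) = yes λ _ → z
    dec (yes y) (no ¬z) = no λ f → ¬z (f y)

  Matched : (ℕ → ℕ → Bool) → Level → Level → Set
  Matched q F G = ∃[ τ ] Below q F G τ

  MatchedEdge : (ℕ → ℕ → Bool) → Level → Level → Fin k → Fin k → Set
  MatchedEdge q F G f g = ∃[ τ ] Below q F G τ × τ g ≡ f

  below-resp : ∀ {q F G τ υ} → τ ≗ υ → Below q F G τ → Below q F G υ
  below-resp {q} {F} {G} e (inj , b) = (λ eq → inj (trans (e _) (trans eq (sym (e _)))))
    , λ j → subst (λ i → leX q (F i) (G j)) (e j) (b j)

  matched? : ∀ q F G → Dec (Matched q F G)
  matched? q F G = map′ (λ (τ , _ , b) → τ , b) (λ (τ , b) → τ , (λ i → ∈-allFin (τ i)) , b)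
    (anyFunction? (allFin k) k (below-resp {q} {F} {G}) (below? q F G))

  matchedEdge? : ∀ q F G f g → Dec (MatchedEdge q F G f g)
  matchedEdge? q F G f g = map′ (λ (τ , _ , b) → τ , b) (λ (τ , b) → τ , (λ i → ∈-allFin (τ i)) , b)
    (anyFunction? (allFin k) k (λ e (b , eq) → below-resp {q} {F} {G} e b , trans (sym (e g)) eq)
      λ τ → below? q F G τ ×-dec (τ g Fin.≟ f))

  -- Keeping exactly the comparabilities that occur in perfect matchings makes the matrix regular by
  -- construction.
  matrix : (ℕ → ℕ → Bool) → Level → Level → Mat
  matrix q F G f g = ⌊ matchedEdge? q F G f g ⌋

  lowerAt : {t : Tree} → Level → Gap t → Level
  lowerAt F gap               = F
  lowerAt F (left γ)          = lowerAt F γ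
  lowerAt F (right {A = A} γ) = lowerAt (el ∘ A) γ

  upperAt : {t : Tree} → Level → Gap t → Level
  upperAt G gap              = G
  upperAt G (left {A = A} γ) = upperAt (el ∘ A) γ
  upperAt G (right γ)        = upperAt G γ

  Le : (ℕ → ℕ → Bool) → ℕ → ℕ → Set
  Le q a b = T (q a b)

  Fits : (ℕ → ℕ → Bool) → ℕ → Level → Level → (Fin k → ℕ) → Set
  Fits q x F G A = (Independent (Le q) A × ∃[ j ] A j ≡ x) × Matched q F (el ∘ A) × Matched q (el ∘ A) G

  Found : (ℕ → ℕ → Bool) → List ℕ → ℕ → Level → Level → Tree → Set
  Found q D x F G t = Σ[ γ ∈ Gap t ] ∃[ A ] (∀ i → A i ∈ D) × Fits q x (lowerAt F γ) (upperAt G γ) A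

  fits? : ∀ q x F G A → Dec (Fits q x F G A)
  fits? q x F G A = (independent? (λ a b → T? (q a b)) A ×-dec Fin.any? λ j → A j ≟ x)
    ×-dec (matched? q F (el ∘ A) ×-dec matched? q (el ∘ A) G)

  fits-resp : ∀ {q x F G A B} → A ≗ B → Fits q x F G A → Fits q x F G B
  fits-resp {q} {x} {F} {G} e ((ind , j , eq) , (τ , iτ , bτ) , υ , iυ , bυ) =
    (independent-resp (Le q) e ind , j , trans (sym (e j)) eq)
    , (τ , iτ , λ i → subst (λ a → leX q (F (τ i)) (el a)) (e i) (bτ i))
    , (υ , iυ , λ i → subst (λ a → leX q (el a) (G i)) (e (υ i)) (bυ i))

  search : ∀ q D x F G t → Dec (Found q D x F G t)
  search q D x F G leaf = map′ (λ f → gap , f) (λ { (gap , f) → f })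
    (anyFunction? D k (fits-resp {q} {x} {F} {G}) (fits? q x F G))
  search q D x F G (node l L A j R r) = map′
    (λ { (inj₁ (γ , f)) → left γ , f ; (inj₂ (γ , f)) → right γ , f })
    (λ { (left γ , f) → inj₁ (γ , f) ; (right γ , f) → inj₂ (γ , f) })
    (search q D x F (el ∘ A) l ⊎-dec search q D x (el ∘ A) G r)

  State : Set
  State = Σ[ t ∈ Tree ] (V t → ℕ)

  bottom ceiling : Level
  bottom _  = lo
  ceiling _ = hi

  module _ (q : ℕ → ℕ → Bool) {t : Tree} (γ : Gap t) (A : Fin k → ℕ) where
    matL matR : Mat
    matL = matrix q (lowerAt bottom γ) (el ∘ A)
    matR = matrix q (el ∘ A) (upperAt ceiling γ)

  step′ : ∀ q D x (st : State) → Dec (Found q D x bottom ceiling (proj₁ st)) → State × ℕ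
  -- A default value: in a poset of width at most `k`, with `x` on an antichain of `k` vertices, the
  -- search succeeds, as `step-correct` shows.
  step′ q D x st         (no _) = st , 0
  step′ q D x (t , col) (yes (γ , A , _ , (_ , j , _) , _)) =
    (insert γ (matL q γ A) A j (matR q γ A) , extend γ col) , proj₁ (mex {L = matL q γ A} {A} {j} {matR q γ A} γ col)

  step : (ℕ → ℕ → Bool) → List ℕ → ℕ → State → State × ℕ
  step q D x st = step′ q D x st (search q D x bottom ceiling (proj₁ st))

  value : {t : Tree} → Pt t → ℕ
  value (left p)         = value p
  value (here {A = A} a) = A a
  value (right p)        = value p

  value-oldP : ∀ {t L A j R} (γ : Gap t) (p : Pt t) → value (oldP {L = L} {A} {j} {R} γ p) ≡ value p
  value-oldP (left γ)  (left p)  = value-oldP γ p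
  value-oldP (left γ)  (here a)  = refl
  value-oldP (left γ)  (right p) = refl
  value-oldP (right γ) (left p)  = refl
  value-oldP (right γ) (here a)  = refl
  value-oldP (right γ) (right p) = value-oldP γ p

  value-new : ∀ {t L A j R} (γ : Gap t) → value (emb (new {L = L} {A} {j} {R} γ)) ≡ A j
  value-new gap       = refl
  value-new (left γ)  = value-new γ
  value-new (right γ) = value-new γ

  -- The algorithm works with the relation `q` presented so far, whereas the invariants refer to one
  -- fixed order. The two need to coincide only on the vertices already present.
  Agree : (q q′ : ℕ → ℕ → Bool) → List ℕ → Set
  Agree q q′ D = ∀ {a b} → a ∈ D → b ∈ D → q a b ≡ q′ a b

  inX : List ℕ → X → Set
  inX D (el a) = a ∈ D
  inX D _      = ⊤

  module _ {q q′ : ℕ → ℕ → Bool} {D : List ℕ} (agree : Agree q q′ D) where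
    leX-agree : ∀ u v → inX D u → inX D v → leX q u v → leX q′ u v
    leX-agree lo     v      _ _ h = tt
    leX-agree (el a) (el b) a∈ b∈ h = subst T (agree a∈ b∈) h
    leX-agree (el _) hi     _ _ h = tt
    leX-agree hi     hi     _ _ h = tt

    module _ {F G : Level} (F∈ : ∀ i → inX D (F i)) (G∈ : ∀ i → inX D (G i)) where
      below-agree : ∀ {τ} → Below q F G τ → Below q′ F G τ
      below-agree {τ} (inj , b) = inj , λ j → leX-agree (F (τ j)) (G j) (F∈ _) (G∈ j) (b j)

      matched-agree : Matched q F G → Matched q′ F G
      matched-agree (τ , b) = τ , below-agree b

      edge-agree : ∀ {f g} → MatchedEdge q F G f g → MatchedEdge q′ F G f g
      edge-agree (τ , b , e) = τ , below-agree b , e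

    independent-agree : ∀ {A : Fin k → ℕ} → (∀ i → A i ∈ D) → Independent (Le q′) A → Independent (Le q) A
    independent-agree A∈ ind i j ne h = ind i j ne (subst T (agree (A∈ i) (A∈ j)) h)

  -- Correctness of the strategy inside one stage

  module Correct (le : ℕ → ℕ → Bool) (le-refl : ∀ {a} → T (le a a)) (le-trans : ∀ {a b c} → T (le a b) → T (le b c) → T (le a c))
                 (le-antisym : ∀ {a b} → T (le a b) → T (le b a) → a ≡ b) where

    order : DecPoset
    order = record { Carrier = ℕ ; _≟ᶜ_ = _≟_ ; _⊑_ = Le le ; _⊑?_ = λ a b → T? (le a b)
                   ; ⊑-refl = le-refl ; ⊑-trans = le-trans ; ⊑-antisym = le-antisym }
    open Antichains order
    open Chains

    leX-trans : ∀ u v w → leX le u v → leX le v w → leX le u w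
    leX-trans lo     v      w      _ _ = tt
    leX-trans (el a) (el b) (el c) p r = le-trans p r
    leX-trans (el a) (el b) hi     p r = tt
    leX-trans (el a) hi     hi     p r = tt
    leX-trans hi     hi     hi     p r = tt

    record MatOK (M : Mat) (F G : Level) : Set where
      field
        sound    : ∀ {f g} → T (M f g) → MatchedEdge le F G f g
        complete : ∀ {f g} → MatchedEdge le F G f g → T (M f g)
        matched  : Matched le F G
    open MatOK

    data OK (D : List ℕ) : Mat → Level → Level → Tree → Set where
      leaf : ∀ {M F G} → MatOK M F G → OK D M F G leaf
      node : ∀ {M F G l L A j R r} → MatOK M F G → Antichain A → (∀ i → A i ∈ D) →
             OK D L F (el ∘ A) l → OK D R (el ∘ A) G r → OK D M F G (node l L A j R r)

    matOK : ∀ {D M F G t} → OK D M F G t → MatOK M F G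
    matOK (leaf m)         = m
    matOK (node m _ _ _ _) = m

    ok-mono : ∀ {D D′ M F G t} → (∀ {a} → a ∈ D → a ∈ D′) → OK D M F G t → OK D′ M F G t
    ok-mono sub (leaf m)            = leaf m
    ok-mono sub (node m ac A∈ ol or) = node m ac (sub ∘ A∈) (ok-mono sub ol) (ok-mono sub or)

    matOK-regular : ∀ {M F G} → MatOK M F G → Regular M
    matOK-regular m = record
      { some    = let τ , i , b = matched m in record { τ = τ ; inj = i ; edge = λ j → complete m (τ , (i , b) , refl) }
      ; through = λ f g h → let τ , (i , b) , e = sound m h in
          record { τ = τ ; inj = i ; edge = λ j → complete m (τ , (i , b) , refl) } , e }

    -- Perfect matchings compose to perfect matchings; this yields the composability condition of
    -- `WF` for the pruned relations.
    compose : ∀ F G H {f g h} → MatchedEdge le F G f g → MatchedEdge le G H g h → MatchedEdge le F H f h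
    compose F G H (τ , (iτ , bτ) , refl) (υ , (iυ , bυ) , refl) =
      τ ∘ υ , ((iυ ∘ iτ) , λ j → leX-trans (F (τ (υ j))) (G (υ j)) (H j) (bτ (υ j)) (bυ j)) , refl

    ok-wf : ∀ {D M F G t} → OK D M F G t → WF M t
    ok-wf (leaf m)           = leaf (matOK-regular m)
    ok-wf {F = F} {G} (node {A = A} m _ _ ol or) = node (matOK-regular m)
      (λ a b → complete m (compose F (el ∘ A) G (sound (matOK ol) a) (sound (matOK or) b))) (ok-wf ol) (ok-wf or)

    edge-sound : ∀ {M F G f g} → MatOK M F G → T (M f g) → leX le (F f) (G g)
    edge-sound {g = g} m h with sound m h
    ... | τ , (_ , b) , refl = b g

    up-sound : ∀ {D M F G t} → OK D M F G t → ∀ f (p : Pt t) → up f p → leX le (F f) (el (value p))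
    up-sound (node m _ _ ol or) f (left p)  h = up-sound ol f p h
    up-sound (node m _ _ ol or) f (here a)  h = edge-sound (matOK ol) h
    up-sound {F = F} (node {A = A} m _ _ ol or) f (right p) (a , e , h) =
      leX-trans (F f) (el (A a)) (el (value p)) (edge-sound (matOK ol) e) (up-sound or a p h)

    dn-sound : ∀ {D M F G t} → OK D M F G t → ∀ (p : Pt t) g → dn p g → leX le (el (value p)) (G g)
    dn-sound {G = G} (node {A = A} m _ _ ol or) (left p) g (a , h , e) =
      leX-trans (el (value p)) (el (A a)) (G g) (dn-sound ol p a h) (edge-sound (matOK or) e)
    dn-sound (node m _ _ ol or) (here a)  g h = edge-sound (matOK or) h
    dn-sound (node m _ _ ol or) (right p) g h = dn-sound or p g h

    ≺-sound : ∀ {D M F G t} → OK D M F G t → ∀ (p q : Pt t) → p ≺ q → T (le (value p) (value q))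
    ≺-sound (node m _ _ ol or) (left p)  (left q)  h = ≺-sound ol p q h
    ≺-sound (node m _ _ ol or) (left p)  (here a)  h = dn-sound ol p a h
    ≺-sound (node m _ _ ol or) (left p)  (right q) (a , d , u) = le-trans (dn-sound ol p a d) (up-sound or a q u)
    ≺-sound (node m _ _ ol or) (here a)  (right q) h = up-sound or a q h
    ≺-sound (node m _ _ ol or) (right p) (right q) h = ≺-sound or p q h

    lowerAt-in : ∀ {D M F G t} → OK D M F G t → (∀ i → inX D (F i)) → (γ : Gap t) → ∀ i → inX D (lowerAt F γ i)
    lowerAt-in o                   F∈ gap       = F∈
    lowerAt-in (node _ _ _ ol _)   F∈ (left γ)  = lowerAt-in ol F∈ γ
    lowerAt-in (node _ _ A∈ _ or)  F∈ (right γ) = lowerAt-in or A∈ γ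

    upperAt-in : ∀ {D M F G t} → OK D M F G t → (∀ i → inX D (G i)) → (γ : Gap t) → ∀ i → inX D (upperAt G γ i)
    upperAt-in o                   G∈ gap       = G∈
    upperAt-in (node _ _ A∈ ol _)  G∈ (left γ)  = upperAt-in ol A∈ γ
    upperAt-in (node _ _ _ _ or)   G∈ (right γ) = upperAt-in or G∈ γ

    insert-ok : ∀ {D M F G t L A j R} → OK D M F G t → (γ : Gap t) → MatOK L (lowerAt F γ) (el ∘ A) → MatOK R (el ∘ A) (upperAt G γ) →
                Antichain A → (∀ i → A i ∈ D) → OK D M F G (insert γ L A j R)
    insert-ok (leaf m) gap mL mR ac A∈ = node m ac A∈ (leaf mL) (leaf mR)
    insert-ok (node m ac′ A′∈ ol or) (left γ)  mL mR ac A∈ = node m ac′ A′∈ (insert-ok ol γ mL mR ac A∈) or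
    insert-ok (node m ac′ A′∈ ol or) (right γ) mL mR ac A∈ = node m ac′ A′∈ ol (insert-ok or γ mL mR ac A∈)

    -- Every level meets every chain of a Dilworth partition, so an antichain through x can be clamped,
    -- chain by chain, between two consecutive levels without losing x.
    module Clamp {D : List ℕ} (C : Chains k D) where

      OnChain : Fin k → X → Set
      OnChain c (el a) = a ∈ D × chain C a ≡ toℕ c
      OnChain c _      = ⊤

      -- The index `σ c` selects the element of the level on chain `c`, and `ρ` is its inverse.
      -- Virtual levels are included because `lo` and `hi` count as members of every chain.
      record Arranged (F : Level) : Set where
        field
          σ ρ : Fin k → Fin k
          σρ  : ∀ j → σ (ρ j) ≡ j
          ρσ  : ∀ c → ρ (σ c) ≡ c
          on  : ∀ c → OnChain c (F (σ c))
      open Arranged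

      same : ∀ {c a b} → OnChain c (el a) → OnChain c (el b) → T (le a b) ⊎ T (le b a)
      same (a∈ , ea) (b∈ , eb) = comp C a∈ b∈ (trans ea (sym eb))

      antichain-≡ : {A : Fin k → ℕ} → Antichain A → ∀ {i j} → T (le (A i) (A j)) → i ≡ j
      antichain-≡ ac {i} {j} h with i Fin.≟ j
      ... | yes e = e
      ... | no ne = ⊥-elim (ac i j ne h)

      arrange : {A : Fin k → ℕ} → Antichain A → (∀ i → A i ∈ D) → Arranged (el ∘ A)
      arrange {A} ac A∈ = record
        { σ = λ c → proj₁ (hits-chain C A A∈ ac c) ; ρ = ρ′
        ; σρ = λ j → index-inj (trans (proj₂ (hits-chain C A A∈ ac (ρ′ j))) (Fin.toℕ-fromℕ< _))
        ; ρσ = λ c → Fin.toℕ-injective (trans (Fin.toℕ-fromℕ< _) (proj₂ (hits-chain C A A∈ ac c)))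
        ; on = λ c → A∈ _ , proj₂ (hits-chain C A A∈ ac c) }
        where
        ρ′ : Fin k → Fin k
        ρ′ j = fromℕ< (small C (A∈ j))
        index-inj : ∀ {i j} → chain C (A i) ≡ chain C (A j) → i ≡ j
        index-inj {i} {j} e with comp C (A∈ i) (A∈ j) e
        ... | inj₁ h = antichain-≡ ac h
        ... | inj₂ h = sym (antichain-≡ ac h)

      arrange-const : {x : X} → (∀ c → OnChain c x) → Arranged (λ _ → x)
      arrange-const on = record { σ = id ; ρ = id ; σρ = λ _ → refl ; ρσ = λ _ → refl ; on = on }

      -- The matching puts `F (σ aF c)` below some `A j`. If it were above the element of `A` on its
      -- own chain, that element would be below `A j`; as `A` is an antichain the two coincide, and
      -- the desired comparison holds anyway.
      below-chain : ∀ {F A} (aF : Arranged F) (aA : Arranged (el ∘ A)) → Antichain A → Matched le F (el ∘ A) →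
                    ∀ c → leX le (F (σ aF c)) (el (A (σ aA c)))
      below-chain {F} {A} aF aA ac (τ , i , b) c with injective⇒surjective τ i (σ aF c)
      ... | j , e = go (F (σ aF c)) (on aF c) (subst (λ f → leX le (F f) (el (A j))) e (b j))
        where
        go : ∀ u → OnChain c u → leX le u (el (A j)) → leX le u (el (A (σ aA c)))
        go lo     _  _ = tt
        go (el a) oc h with same {c} oc (on aA c)
        ... | inj₁ l = l
        ... | inj₂ l = subst (λ i → T (le a (A i))) (sym (antichain-≡ ac (le-trans l h))) h

      above-chain : ∀ {G A} (aG : Arranged G) (aA : Arranged (el ∘ A)) → Antichain A → Matched le (el ∘ A) G →
                    ∀ c → leX le (el (A (σ aA c))) (G (σ aG c))
      above-chain {G} {A} aG aA ac (τ , i , b) c = go (G (σ aG c)) (on aG c) (b (σ aG c))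
        where
        go : ∀ u → OnChain c u → leX le (el (A (τ (σ aG c)))) u → leX le (el (A (σ aA c))) u
        go hi     _  _ = tt
        go (el a) oc h with same {c} oc (on aA c)
        ... | inj₁ l = subst (λ i → T (le (A i) a)) (antichain-≡ ac (le-trans h l)) h
        ... | inj₂ l = l

      record Current (x : ℕ) (g : Fin k → ℕ) : Set where
        field
          anti   : Antichain g
          chains : ∀ c → OnChain c (el (g c))
          c₀     : Fin k
          at-c₀  : g c₀ ≡ x
      open Current

      module _ {x : ℕ} {g A : Fin k → ℕ} (cur : Current x g) (ac : Antichain A) (aA : Arranged (el ∘ A)) where
        b : Fin k → ℕ
        b c = A (σ aA c)

        b-anti : Antichain b
        b-anti c d ne h = ne (trans (sym (ρσ aA c)) (trans (cong (ρ aA) (antichain-≡ ac h)) (ρσ aA d)))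

        glb : ∀ c → ∃[ m ] (m ≡ g c ⊎ m ≡ b c) × T (le m (g c)) × T (le m (b c))
        glb c with same {c} (chains cur c) (on aA c)
        ... | inj₁ l = g c , inj₁ refl , le-refl , l
        ... | inj₂ l = b c , inj₂ refl , l , le-refl

        lub : ∀ c → ∃[ m ] (m ≡ g c ⊎ m ≡ b c) × T (le (g c) m) × T (le (b c) m)
        lub c with same {c} (chains cur c) (on aA c)
        ... | inj₁ l = b c , inj₂ refl , l , le-refl
        ... | inj₂ l = g c , inj₁ refl , le-refl , l

        pick-on : ∀ c {m} → m ≡ g c ⊎ m ≡ b c → OnChain c (el m)
        pick-on c (inj₁ refl) = chains cur c
        pick-on c (inj₂ refl) = on aA c

        -- Each chain keeps the smaller of its two elements. A relation from one such minimum to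
        -- another descends to a relation inside `g` or inside `b`, both antichains. The hypothesis
        -- makes `x` the minimum on its chain.
        meet : T (le x (b (c₀ cur))) → Current x (λ c → proj₁ (glb c))
        meet h = record
          { anti = λ c d ne l → go c d ne (proj₁ (proj₂ (glb c))) l ; chains = λ c → pick-on c (proj₁ (proj₂ (glb c)))
          ; c₀ = c₀ cur ; at-c₀ = x-min (proj₁ (proj₂ (glb (c₀ cur)))) (proj₁ (proj₂ (proj₂ (glb (c₀ cur))))) }
          where
          go : ∀ c d → c ≢ d → proj₁ (glb c) ≡ g c ⊎ proj₁ (glb c) ≡ b c → ¬ T (le (proj₁ (glb c)) (proj₁ (glb d)))
          go c d ne (inj₁ e) l = anti cur c d ne (le-trans (subst (λ m → T (le m _)) e l) (proj₁ (proj₂ (proj₂ (glb d)))))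
          go c d ne (inj₂ e) l = b-anti c d ne (le-trans (subst (λ m → T (le m _)) e l) (proj₂ (proj₂ (proj₂ (glb d)))))
          x-min : ∀ {m} → m ≡ g (c₀ cur) ⊎ m ≡ b (c₀ cur) → T (le m (g (c₀ cur))) → m ≡ x
          x-min (inj₁ e)    _ = trans e (at-c₀ cur)
          x-min (inj₂ refl) l = le-antisym (subst (λ y → T (le (b (c₀ cur)) y)) (at-c₀ cur) l) h

        join : T (le (b (c₀ cur)) x) → Current x (λ c → proj₁ (lub c))
        join h = record
          { anti = λ c d ne l → go c d ne (proj₁ (proj₂ (lub d))) l ; chains = λ c → pick-on c (proj₁ (proj₂ (lub c)))
          ; c₀ = c₀ cur ; at-c₀ = x-max (proj₁ (proj₂ (lub (c₀ cur)))) (proj₁ (proj₂ (proj₂ (lub (c₀ cur))))) }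
          where
          go : ∀ c d → c ≢ d → proj₁ (lub d) ≡ g d ⊎ proj₁ (lub d) ≡ b d → ¬ T (le (proj₁ (lub c)) (proj₁ (lub d)))
          go c d ne (inj₁ e) l = anti cur c d ne (le-trans (proj₁ (proj₂ (proj₂ (lub c)))) (subst (λ m → T (le _ m)) e l))
          go c d ne (inj₂ e) l = b-anti c d ne (le-trans (proj₂ (proj₂ (proj₂ (lub c)))) (subst (λ m → T (le _ m)) e l))
          x-max : ∀ {m} → m ≡ g (c₀ cur) ⊎ m ≡ b (c₀ cur) → T (le (g (c₀ cur)) m) → m ≡ x
          x-max (inj₁ e)    _ = trans e (at-c₀ cur)
          x-max (inj₂ refl) l = le-antisym h (subst (λ y → T (le y (b (c₀ cur)))) (at-c₀ cur) l)

      clamp : ∀ {M F G t x g} → OK D M F G t → (aF : Arranged F) (aG : Arranged G) → Current x g →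
              (∀ c → leX le (F (σ aF c)) (el (g c))) → (∀ c → leX le (el (g c)) (G (σ aG c))) → Found le D x F G t
      clamp {G = G} {g = g} (leaf m) aF aG cur F≤ ≤G =
        gap , g , (λ i → proj₁ (chains cur i)) , (anti cur , c₀ cur , at-c₀ cur)
        -- In a gap the comparisons along chains are themselves the required matchings. The lower
        -- one is `σ aF`; the upper one is indexed by `G`, hence the inverse `ρ aG`.
        , (σ aF , (λ e → trans (sym (ρσ aF _)) (trans (cong (ρ aF) e) (ρσ aF _))) , F≤)
        , (ρ aG , (λ e → trans (sym (σρ aG _)) (trans (cong (σ aG) e) (σρ aG _)))
          , λ j → subst (λ i → leX le (el (g (ρ aG j))) (G i)) (σρ aG j) (≤G (ρ aG j)))
      clamp {F = F} {G} {x = x} {g} (node {A = A} m ac A∈ ol or) aF aG cur F≤ ≤G =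
        side (same {c₀ cur} (subst (λ y → OnChain (c₀ cur) (el y)) (at-c₀ cur) (chains cur (c₀ cur))) (on aA (c₀ cur)))
        where
        aA = arrange ac A∈
        side : T (le x (A (σ aA (c₀ cur)))) ⊎ T (le (A (σ aA (c₀ cur))) x) → Found le D x F G _
        side (inj₁ h) with clamp ol aF aA (meet cur ac aA h)
            (λ c → from-F c (proj₁ (proj₂ (glb cur ac aA c)))) (λ c → proj₂ (proj₂ (proj₂ (glb cur ac aA c))))
          where
          from-F : ∀ c {m} → m ≡ g c ⊎ m ≡ A (σ aA c) → leX le (F (σ aF c)) (el m)
          from-F c (inj₁ refl) = F≤ c
          from-F c (inj₂ refl) = below-chain aF aA ac (matched (matOK ol)) c
        ... | γ , f = left γ , f
        side (inj₂ h) with clamp or aA aG (join cur ac aA h)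
            (λ c → proj₂ (proj₂ (proj₂ (lub cur ac aA c)))) (λ c → to-G c (proj₁ (proj₂ (lub cur ac aA c))))
          where
          to-G : ∀ c {m} → m ≡ g c ⊎ m ≡ A (σ aA c) → leX le (el m) (G (σ aG c))
          to-G c (inj₁ refl) = ≤G c
          to-G c (inj₂ refl) = above-chain aG aA ac (matched (matOK or)) c
        ... | γ , f = right γ , f

    found : ∀ {D M t x} → Narrow k D → OK D M bottom ceiling t → (A : Fin k → ℕ) → (∀ i → A i ∈ D) → Antichain A → ∀ j → A j ≡ x →
            Found le D x bottom ceiling t
    found {D} {x = x} nar ok A A∈ ac j Aj≡ = clamp ok (arrange-const λ _ → tt) (arrange-const λ _ → tt) cur (λ _ → tt) (λ _ → tt)
      where
      open Clamp (dilworth D k nar)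
      open Arranged (arrange ac A∈)
      cur : Current x (λ c → A (σ c))
      cur = record
        { anti = λ c d ne h → ne (trans (sym (ρσ c)) (trans (cong ρ (antichain-≡ ac h)) (ρσ d)))
        ; chains = on ; c₀ = ρ j ; at-c₀ = trans (cong A (σρ j)) Aj≡ }

    record Inv (D : List ℕ) (st : State) : Set where
      field
        {M} : Mat
        ok  : OK D M bottom ceiling (proj₁ st)
        ff  : FirstFit (proj₁ st) (proj₂ st)
    open Inv

    Has : State → ℕ → ℕ → Set
    Has (t , col) x c = ∃[ v ] value (emb {t} v) ≡ x × col v ≡ c

    inv-comparable : ∀ {D st x y c} → Inv D st → Has st x c → Has st y c → T (le x y) ⊎ T (le y x)
    inv-comparable inv (u , refl , eu) (v , refl , ev) with FirstFit.proper (ff inv) u v (trans eu (sym ev))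
    ... | inj₁ refl     = inj₁ le-refl
    ... | inj₂ (inj₁ h) = inj₁ (≺-sound (ok inv) (emb u) (emb v) h)
    ... | inj₂ (inj₂ h) = inj₂ (≺-sound (ok inv) (emb v) (emb u) h)

    inv-bound : ∀ {D st x c} → Inv D st → Has st x c → ∀ m → suc ((k + k) * k) ≤ m → ∀ l → k < 2 ^ l → c < Growth.F m l
    inv-bound inv (v , _ , refl) m m≥ l k< = colours-bound (ok-wf (ok inv)) (ff inv) m m≥ l k< v

    inv-mono : ∀ {D D′ st} → (∀ {a} → a ∈ D → a ∈ D′) → Inv D st → Inv D′ st
    inv-mono sub inv = record { ok = ok-mono sub (ok inv) ; ff = ff inv }

    inv-init : ∀ {col} → Inv [] (leaf , col)
    inv-init = record
      { M = matrix le bottom ceiling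
      ; ok = leaf (record { sound = toWitness ; complete = fromWitness ; matched = id , id , λ _ → tt })
      ; ff = record { proper = λ () ; first = λ () } }

    module _ {q : ℕ → ℕ → Bool} {D : List ℕ} {x : ℕ} (agree : Agree q le D) where
      agree′ : Agree le q D
      agree′ a∈ b∈ = sym (agree a∈ b∈)

      matrix-ok : ∀ {F G} → (∀ i → inX D (F i)) → (∀ i → inX D (G i)) → Matched q F G → MatOK (matrix q F G) F G
      matrix-ok F∈ G∈ m = record
        { sound = λ h → edge-agree agree F∈ G∈ (toWitness h) ; complete = λ h → fromWitness (edge-agree agree′ F∈ G∈ h)
        ; matched = matched-agree agree F∈ G∈ m }

      step-correct : ∀ {st} → Inv D st → Narrow k D → (A : Fin k → ℕ) → (∀ i → A i ∈ D) → Antichain A → ∀ j → A j ≡ x →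
                     let st′ , c = step q D x st in Inv D st′ × Has st′ x c × (∀ {y d} → Has st y d → Has st′ y d)
      step-correct {t , col} inv nar A A∈ ac j Aj≡ = go (search q D x bottom ceiling t)
        where
        go : (s : Dec (Found q D x bottom ceiling t)) → let st′ , c = step′ q D x (t , col) s in
             Inv D st′ × Has st′ x c × (∀ {y d} → Has (t , col) y d → Has st′ y d)
        go (no ¬f) with found nar (ok inv) A A∈ ac j Aj≡
        ... | γ , B , B∈ , (ind , j′ , e) , mL , mR = ⊥-elim (¬f (γ , B , B∈ , (independent-agree agree B∈ ind , j′ , e)
            , matched-agree agree′ (lowerAt-in (ok inv) (λ _ → tt) γ) B∈ mL
            , matched-agree agree′ B∈ (upperAt-in (ok inv) (λ _ → tt) γ) mR))
        go (yes (γ , B , B∈ , (ind , j′ , e) , mL , mR)) =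
          record { ok = insert-ok (ok inv) γ (matrix-ok (lowerAt-in (ok inv) (λ _ → tt) γ) B∈ mL)
                          (matrix-ok B∈ (upperAt-in (ok inv) (λ _ → tt) γ) mR) (independent-agree agree′ B∈ ind) B∈
                 ; ff = extend-firstFit γ col (ff inv) }
          , (new γ , trans (value-new γ) e , extend-new γ col)
          , λ (v , ev , ec) → old γ v , trans (trans (cong value (emb-old γ v)) (value-oldP γ (emb v))) ev , trans (extend-old γ col v) ec


-- Numerical bounds

-- The bound `b` makes the recursion through `⌊ n /2⌋` structural.
2^log≤ : ∀ b n → n ≤ b → 1 ≤ n → 2 ^ ⌊log₂ n ⌋ ≤ n
2^log≤ b       1             _         _ = ≤-refl
2^log≤ (suc b) n@(suc (suc n′)) (s≤s n≤) _ = begin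
  2 ^ ⌊log₂ n ⌋             ≡⟨ cong (2 ^_) log≡ ⟩
  2 * 2 ^ ⌊log₂ h ⌋         ≤⟨ *-monoʳ-≤ 2 (2^log≤ b h (≤-trans (s≤s (⌊n/2⌋≤n n′)) n≤) (s≤s z≤n)) ⟩
  2 * h                     ≡⟨ cong (h +_) (+-identityʳ h) ⟩
  h + h                     ≤⟨ +-monoʳ-≤ h (⌊n/2⌋≤⌈n/2⌉ n) ⟩
  h + ⌈ n /2⌉               ≡⟨ ⌊n/2⌋+⌈n/2⌉≡n n ⟩
  n                         ∎
  where
  open ≤-Reasoning
  h = ⌊ n /2⌋
  log≡ : ⌊log₂ n ⌋ ≡ suc ⌊log₂ h ⌋
  log≡ = trans (sym (m+[n∸m]≡n (⌊log₂⌋-mono-≤ {2} {n} (s≤s (s≤s z≤n))))) (cong suc (sym (⌊log₂⌊n/2⌋⌋≡⌊log₂n⌋∸1 n)))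

<2^suc-log : ∀ n → n < 2 ^ suc ⌊log₂ n ⌋
<2^suc-log n = ≰⇒> λ le → <-irrefl refl
  (subst (_≤ ⌊log₂ n ⌋) (⌊log₂[2^n]⌋≡n (suc ⌊log₂ n ⌋)) (⌊log₂⌋-mono-≤ le))

module GrowthBounds (m : ℕ) where
  open Growth m

  F-pos : ∀ l → 1 ≤ F l
  F-pos zero    = ≤-refl
  F-pos (suc l) = *-mono-≤ (m^n>0 2 (suc l)) (s≤s z≤n)

  R-pos : ∀ l → 1 ≤ R l
  R-pos l = *-mono-≤ (m^n>0 2 (suc l)) (s≤s z≤n)

  -- With `t = 2 ^ suc l`, `Q l` is at most `6 * t * K l` and `K l` at most `2 * (R l * R l * F l)`.
  -- This gives the factor 12, rounded up to a power of two.
  F-step : ∀ l → F (suc l) ≤ 16 * (2 ^ suc l * 2 ^ suc l * (2 ^ suc l * 2 ^ suc l)) * (suc m * suc m) * F l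
  F-step l = begin
    t * ((k + k) + (t * (k + k) + t * (k + k)))            ≤⟨ *-monoʳ-≤ t (+-monoˡ-≤ _ (≤-trans (≤-reflexive (sym (*-identityˡ (k + k)))) (*-monoˡ-≤ (k + k) (m^n>0 2 (suc l))))) ⟩
    t * (t * (k + k) + (t * (k + k) + t * (k + k)))        ≤⟨ *-monoʳ-≤ t (+-mono-≤ k≤ (+-mono-≤ k≤ k≤)) ⟩
    t * (t * k′ + (t * k′ + t * k′))                       ≡⟨ ring t (suc m) (F l) ⟩
    12 * (t * t * (t * t)) * (suc m * suc m) * F l         ≤⟨ *-monoˡ-≤ (F l) (*-monoˡ-≤ (suc m * suc m) (*-monoˡ-≤ (t * t * (t * t)) {12} {16} (m≤m+n 12 4))) ⟩
    16 * (t * t * (t * t)) * (suc m * suc m) * F l         ∎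
    where
    open ≤-Reasoning
    t = 2 ^ suc l
    k = K l
    x = t * suc m * (t * suc m * F l)
    k′ = (x + x) + (x + x)
    k≤ : t * (k + k) ≤ t * k′
    k≤ = *-monoʳ-≤ t (+-mono-≤ (+-monoˡ-≤ x x-pos) (+-monoˡ-≤ x x-pos))
      where
      x-pos : 1 ≤ x
      x-pos = *-mono-≤ (R-pos l) (*-mono-≤ (R-pos l) (F-pos l))
    ring : ∀ t m f → let x = t * m * (t * m * f) ; y = (x + x) + (x + x) in
           t * (t * y + (t * y + t * y)) ≡ 12 * (t * t * (t * t)) * (m * m) * f
    ring = solve-∀

module _ (w : ℕ) (w≥2 : 2 ≤ w) where
  private
    m = suc ((w + w) * w)
    instance
      w≢0 : NonZero w
      w≢0 = >-nonZero (≤-trans (s≤s z≤n) w≥2)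
  open Growth m
  open GrowthBounds m
  open ≤-Reasoning

  sucm≤ : suc m ≤ 4 * (w * w)
  sucm≤ = begin
    2 + (w + w) * w         ≤⟨ +-monoˡ-≤ _ (≤-trans (*-mono-≤ {2} {w} {1} {w} w≥2 (≤-trans (s≤s z≤n) w≥2)) (m≤m+n (w * w) (w * w))) ⟩
    (w * w + w * w) + (w + w) * w ≡⟨ ring w ⟩
    4 * (w * w)             ∎
    where
    ring : ∀ w → (w * w + w * w) + (w + w) * w ≡ 4 * (w * w)
    ring = solve-∀

  -- With `suc m ≤ 4 * (w * w)`, a step contributes `2 ^ (4 * l + 12)` and `w ^ 4`, the 12 being 4
  -- each from the constant 16, from `2 ^ suc l` to the fourth power and from `4 * 4`. The quadratic
  -- exponent has exactly these differences.
  F-bound : ∀ l → F l ≤ 2 ^ (2 * (l * l) + 10 * l) * w ^ (4 * l)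
  F-bound zero    = ≤-refl
  F-bound (suc l) = begin
    F (suc l)                                                ≤⟨ F-step l ⟩
    16 * (t * t * (t * t)) * (suc m * suc m) * F l           ≤⟨ *-mono-≤ (*-monoʳ-≤ (16 * (t * t * (t * t))) (*-mono-≤ sucm≤ sucm≤)) (F-bound l) ⟩
    16 * (t * t * (t * t)) * (4 * (w * w) * (4 * (w * w))) * (p * q) ≡⟨ ring (2 ^ l) w p q ⟩
    2 ^ 12 * (2 ^ l * 2 ^ l * (2 ^ l * 2 ^ l)) * p * (w * (w * (w * (w * 1))) * q) ≡⟨ cong₂ _*_ powers (sym (trans (cong (w ^_) (*-suc 4 l)) (^-distribˡ-+-* w 4 (4 * l)))) ⟩
    2 ^ (2 * (suc l * suc l) + 10 * suc l) * w ^ (4 * suc l) ∎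
    where
    t = 2 ^ suc l
    p = 2 ^ (2 * (l * l) + 10 * l)
    q = w ^ (4 * l)
    ring : ∀ s w p q → 16 * ((2 * s) * (2 * s) * ((2 * s) * (2 * s))) * (4 * (w * w) * (4 * (w * w))) * (p * q)
           ≡ 4096 * (s * s * (s * s)) * p * (w * (w * (w * (w * 1))) * q)
    ring = solve-∀
    exponents : ∀ l → (12 + ((l + l) + (l + l))) + (2 * (l * l) + 10 * l) ≡ 2 * ((1 + l) * (1 + l)) + 10 * (1 + l)
    exponents = solve-∀
    pow = λ a b → ^-distribˡ-+-* 2 a b
    powers : 2 ^ 12 * (2 ^ l * 2 ^ l * (2 ^ l * 2 ^ l)) * p ≡ 2 ^ (2 * (suc l * suc l) + 10 * suc l)
    powers = trans (cong (λ z → 2 ^ 12 * z * p) (trans (sym (cong₂ _*_ (pow l l) (pow l l))) (sym (pow (l + l) (l + l)))))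
      (trans (cong (_* p) (sym (pow 12 ((l + l) + (l + l)))))
        (trans (sym (pow (12 + ((l + l) + (l + l))) (2 * (l * l) + 10 * l))) (cong (2 ^_) (exponents l))))

  -- At `l = suc L`, the power of two has exponent `L * (2 * L + 14) + 12`, and `2 ^ L ≤ w` turns it
  -- into a power of `w` with exponent linear in `L`. Together with `w ^ (4 * suc L)` and
  -- `suc w ≤ w ^ 2` the exponent is `6 * L + 32`; squaring doubles it.
  total-bound : (F (suc ⌊log₂ w ⌋) * suc w) * (F (suc ⌊log₂ w ⌋) * suc w) ≤ w ^ (13 * ⌊log₂ w ⌋ + 64)
  total-bound = begin
    (F (suc L) * suc w) * (F (suc L) * suc w)     ≤⟨ *-mono-≤ one one ⟩
    w ^ (6 * L + 32) * w ^ (6 * L + 32)           ≡⟨ ^-distribˡ-+-* w (6 * L + 32) (6 * L + 32) ⟨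
    w ^ ((6 * L + 32) + (6 * L + 32))             ≤⟨ ^-monoʳ-≤ w (≤-trans (m≤m+n _ L) (≤-reflexive (exponents L))) ⟩
    w ^ (13 * L + 64)                             ∎
    where
    L = ⌊log₂ w ⌋
    exponents : ∀ L → (6 * L + 32) + (6 * L + 32) + L ≡ 13 * L + 64
    exponents = solve-∀
    split : ∀ L → 2 * ((1 + L) * (1 + L)) + 10 * (1 + L) ≡ L * (2 * L + 14) + 12
    split = solve-∀
    join : ∀ L → ((2 * L + 14) + 12 + 4 * (1 + L)) + 2 ≡ 6 * L + 32
    join = solve-∀
    two : 2 ^ (2 * (suc L * suc L) + 10 * suc L) ≤ w ^ ((2 * L + 14) + 12)
    two = begin
      2 ^ (2 * (suc L * suc L) + 10 * suc L)   ≡⟨ cong (2 ^_) (split L) ⟩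
      2 ^ (L * (2 * L + 14) + 12)              ≡⟨ ^-distribˡ-+-* 2 (L * (2 * L + 14)) 12 ⟩
      2 ^ (L * (2 * L + 14)) * 2 ^ 12          ≡⟨ cong (_* 2 ^ 12) (^-*-assoc 2 L (2 * L + 14)) ⟨
      (2 ^ L) ^ (2 * L + 14) * 2 ^ 12          ≤⟨ *-mono-≤ (^-monoˡ-≤ (2 * L + 14) (2^log≤ w w ≤-refl (≤-trans (s≤s z≤n) w≥2))) (^-monoˡ-≤ 12 w≥2) ⟩
      w ^ (2 * L + 14) * w ^ 12                ≡⟨ ^-distribˡ-+-* w (2 * L + 14) 12 ⟨
      w ^ ((2 * L + 14) + 12)                  ∎
    last : suc w ≤ w ^ 2
    last = begin
      suc w       ≤⟨ +-monoˡ-≤ w (≤-trans (s≤s z≤n) w≥2) ⟩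
      w + w       ≡⟨ cong (w +_) (+-identityʳ w) ⟨
      2 * w       ≤⟨ *-monoˡ-≤ w w≥2 ⟩
      w * w       ≡⟨ cong (w *_) (*-identityʳ w) ⟨
      w ^ 2       ∎
    one : F (suc L) * suc w ≤ w ^ (6 * L + 32)
    one = begin
      F (suc L) * suc w                                                     ≤⟨ *-mono-≤ (F-bound (suc L)) last ⟩
      2 ^ (2 * (suc L * suc L) + 10 * suc L) * w ^ (4 * suc L) * w ^ 2      ≤⟨ *-monoˡ-≤ (w ^ 2) (*-monoˡ-≤ (w ^ (4 * suc L)) two) ⟩
      w ^ ((2 * L + 14) + 12) * w ^ (4 * suc L) * w ^ 2                     ≡⟨ cong (_* w ^ 2) (^-distribˡ-+-* w ((2 * L + 14) + 12) (4 * suc L)) ⟨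
      w ^ ((2 * L + 14) + 12 + 4 * suc L) * w ^ 2                           ≡⟨ ^-distribˡ-+-* w ((2 * L + 14) + 12 + 4 * suc L) 2 ⟨
      w ^ (((2 * L + 14) + 12 + 4 * suc L) + 2)                             ≡⟨ cong (w ^_) (join L) ⟩
      w ^ (6 * L + 32)                                                      ∎


-- The on-line algorithm

Table : Set
Table = List (List (ℕ × Bool × Bool))

entry : List (ℕ × Bool × Bool) → ℕ → Bool × Bool
entry []            a = false , false
entry ((b , p) ∷ r) a with a ≟ b
... | yes _ = p
... | no  _ = entry r a

row : (ℕ → ℕ → Bool) → ℕ → ℕ → List (ℕ × Bool × Bool)
row le n zero    = []
row le n (suc m) = (m , le m n , le n m) ∷ row le n m

-- Storing the presented relation as data makes equal prefixes propositionally equal, without function extensionality.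
table : (ℕ → ℕ → Bool) → ℕ → Table
table le zero    = []
table le (suc n) = row le n (suc n) ∷ table le n

order : Table → ℕ → ℕ → Bool
order []      a b = false
order (r ∷ h) a b with b ≟ length h | a ≟ length h
... | yes _ | _     = proj₁ (entry r a)
... | no _  | yes _ = proj₂ (entry r b)
... | no _  | no _  = order h a b

entry-row : ∀ le n {m a} → a < m → entry (row le n m) a ≡ (le a n , le n a)
entry-row le n {suc m} {a} a< with a ≟ m
... | yes refl = refl
... | no a≢m   = entry-row le n (≤∧≢⇒< (≤-pred a<) a≢m)

table-length : ∀ le n → length (table le n) ≡ n
table-length le zero    = refl
table-length le (suc n) = cong suc (table-length le n)

order-table : ∀ le n {a b} → a < n → b < n → order (table le n) a b ≡ le a b
order-table le (suc n) {a} {b} a< b< with b ≟ length (table le n) | a ≟ length (table le n)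
... | yes refl | _ rewrite table-length le n = cong proj₁ (entry-row le n a<)
... | no _ | yes refl rewrite table-length le n = cong proj₂ (entry-row le n b<)
... | no b≢ | no a≢ rewrite table-length le n = order-table le n (≤∧≢⇒< (≤-pred a<) a≢) (≤∧≢⇒< (≤-pred b<) b≢)

row-cong : ∀ {le le′} n m → (∀ {a} → a < m → le a n ≡ le′ a n × le n a ≡ le′ n a) → row le n m ≡ row le′ n m
row-cong n zero    h = refl
row-cong n (suc m) h = cong₂ _∷_ (cong (m ,_) (cong₂ _,_ (proj₁ (h ≤-refl)) (proj₂ (h ≤-refl)))) (row-cong n m (h ∘ m≤n⇒m≤1+n))

table-cong : ∀ {le le′} n → (∀ {a b} → a < n → b < n → le a b ≡ le′ a b) → table le n ≡ table le′ n
table-cong zero    h = refl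
table-cong (suc n) h = cong₂ _∷_ (row-cong n (suc n) λ a< → h a< ≤-refl , h ≤-refl a<)
  (table-cong n λ a< b< → h (m≤n⇒m≤1+n a<) (m≤n⇒m≤1+n b<))

-- Numbers outside Fin n are related only to themselves, so the extension is a partial order on all of ℕ.
extend-le : {n : ℕ} → (Fin n → Fin n → Bool) → ℕ → ℕ → Bool
extend-le {n} r a b with a <? n | b <? n
... | yes a< | yes b< = r (fromℕ< a<) (fromℕ< b<)
... | _      | _      = ⌊ a ≟ b ⌋

module Online (w : ℕ) where

  -- The first component lists, for each `s`, the vertices of stage at most `s`; the second holds
  -- the tree and the colouring of each stage.
  State : Set
  State = (ℕ → List ℕ) × (∀ s → Stage.State s)

  Crowded : (ℕ → ℕ → Bool) → ℕ → List ℕ → Set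
  Crowded q s D = ∃[ g ] (∀ i → g i ∈ D) × Independent (λ a b → T (q a b)) {s} g

  crowded? : ∀ q s D → Dec (Crowded q s D)
  crowded? q s D = anyFunction? D s (independent-resp (λ a b → T (q a b))) (independent? λ a b → T? (q a b))

  -- Taking the largest possible stage keeps x ∷ D s′ free of antichains of size s′ + 1 for all s′ from the stage of x on.
  stage : (ℕ → ℕ → Bool) → (ℕ → List ℕ) → ℕ → ℕ → ℕ
  stage q D x zero    = 0
  stage q D x (suc n) with crowded? q (suc n) (x ∷ D n)
  ... | yes _ = suc n
  ... | no  _ = stage q D x n

  add : ℕ → ℕ → (ℕ → List ℕ) → ℕ → List ℕ
  add s x D s′ with s ≤? s′
  ... | yes _ = x ∷ D s′
  ... | no  _ = D s′

  update : ∀ s → Stage.State s → (∀ s′ → Stage.State s′) → ∀ s′ → Stage.State s′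
  update s st ts s′ with s ≟ s′
  ... | yes refl = st
  ... | no  _    = ts s′

  stageStep : (ℕ → ℕ → Bool) → ℕ → State → ∀ s → Stage.State s × ℕ
  stageStep q x (D , ts) s = Stage.step s q (x ∷ D s) x (ts s)

  -- Stages do not exceed `w`, so stage and colour are the remainder and the quotient of the label
  -- modulo `suc w`; different stages never share a chain.
  next : (ℕ → ℕ → Bool) → ℕ → State → State × ℕ
  next q x (D , ts) = let s = stage q D x w ; r = stageStep q x (D , ts) s in
    (add s x D , update s (proj₁ r) ts) , s + proj₂ r * suc w

  run : Table → State × ℕ
  run []      = ((λ _ → []) , (λ s → Levels.leaf , λ _ → 0)) , 0
  run (r ∷ h) = next (order (r ∷ h)) (length h) (proj₁ (run h))

  algorithm : OnlineAlgorithm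
  algorithm n r = proj₂ (run (table (extend-le r) (suc n)))

  stage-≤ : ∀ q D x n → stage q D x n ≤ n
  stage-≤ q D x zero    = z≤n
  stage-≤ q D x (suc n) with crowded? q (suc n) (x ∷ D n)
  ... | yes _ = ≤-refl
  ... | no  _ = m≤n⇒m≤1+n (stage-≤ q D x n)

  stage-crowded : ∀ q D x n {s} → stage q D x n ≡ suc s → Crowded q (suc s) (x ∷ D s)
  stage-crowded q D x (suc n) e with crowded? q (suc n) (x ∷ D n)
  stage-crowded q D x (suc n) refl | yes c = c
  ... | no _ = stage-crowded q D x n e

  stage-max : ∀ q D x n s → stage q D x n ≤ s → s < n → ¬ Crowded q (suc s) (x ∷ D s)
  stage-max q D x (suc n) s le lt with crowded? q (suc n) (x ∷ D n)
  ... | yes _ = ⊥-elim (<⇒≱ lt le)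
  ... | no ¬c with m≤n⇒m<n∨m≡n (≤-pred lt)
  ...   | inj₁ s<n  = stage-max q D x n s le s<n
  ...   | inj₂ refl = ¬c

  add-old : ∀ s x D s′ {a} → a ∈ D s′ → a ∈ add s x D s′
  add-old s x D s′ a∈ with s ≤? s′
  ... | yes _ = there a∈
  ... | no  _ = a∈

  add-new : ∀ s x D s′ → s ≤ s′ → add s x D s′ ≡ x ∷ D s′
  add-new s x D s′ le with s ≤? s′
  ... | yes _ = refl
  ... | no ¬l = ⊥-elim (¬l le)

  add-other : ∀ s x D s′ → ¬ s ≤ s′ → add s x D s′ ≡ D s′
  add-other s x D s′ ¬l with s ≤? s′
  ... | yes l = ⊥-elim (¬l l)
  ... | no _  = refl

  add-∈ : ∀ s x D s′ {a} → a ∈ add s x D s′ → (a ≡ x × s ≤ s′) ⊎ a ∈ D s′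
  add-∈ s x D s′ a∈ with s ≤? s′
  add-∈ s x D s′ (here refl) | yes l = inj₁ (refl , l)
  add-∈ s x D s′ (there a∈)  | yes _ = inj₂ a∈
  ... | no _ = inj₂ a∈

  update-prop : (Q : ∀ s → Stage.State s → Set) → ∀ s st ts → Q s st → (∀ s′ → s ≢ s′ → Q s′ (ts s′)) →
                ∀ s′ → Q s′ (update s st ts s′)
  update-prop Q s st ts here′ there′ s′ with s ≟ s′
  ... | yes refl = here′
  ... | no ne    = there′ s′ ne

  -- The invariant of a run

  module Run {n : ℕ} (P : OnlinePoset n) (width : HasWidth P w) where

    lt : ℕ → ℕ → Bool
    lt = extend-le (le P)

    lt-toℕ : ∀ i j → lt (toℕ i) (toℕ j) ≡ le P i j
    lt-toℕ i j with toℕ i <? n | toℕ j <? n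
    ... | yes i< | yes j< = cong₂ (le P) (Fin.fromℕ<-toℕ i i<) (Fin.fromℕ<-toℕ j j<)
    ... | no i≮  | _      = ⊥-elim (i≮ (Fin.toℕ<n i))
    ... | yes _  | no j≮  = ⊥-elim (j≮ (Fin.toℕ<n j))

    lt-refl : ∀ {a} → T (lt a a)
    lt-refl {a} with a <? n
    ... | yes a< = reflexive P (fromℕ< a<)
    ... | no _   = fromWitness refl

    lt-antisym : ∀ {a b} → T (lt a b) → T (lt b a) → a ≡ b
    lt-antisym {a} {b} h h′ with a <? n | b <? n
    ... | yes p | yes r = Fin.fromℕ<-injective a b p r (antisym P _ _ h h′)
    ... | yes _ | no _  = toWitness h
    ... | no _  | yes _ = toWitness h
    ... | no _  | no _  = toWitness h

    lt-trans : ∀ {a b c} → T (lt a b) → T (lt b c) → T (lt a c)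
    lt-trans {a} {b} {c} h h′ = go (b <? n) (a <? n) (c <? n)
      where
      outside-≡ : ∀ {x y} → ¬ (x < n × y < n) → T (lt x y) → x ≡ y
      outside-≡ {x} {y} out t with x <? n | y <? n
      ... | yes p | yes q = ⊥-elim (out (p , q))
      ... | yes _ | no _  = toWitness t
      ... | no _  | yes _ = toWitness t
      ... | no _  | no _  = toWitness t
      inside : ∀ {x y} (p : x < n) (q : y < n) → lt x y ≡ le P (fromℕ< p) (fromℕ< q)
      inside {x} {y} p q = trans (cong₂ lt (sym (Fin.toℕ-fromℕ< p)) (sym (Fin.toℕ-fromℕ< q))) (lt-toℕ (fromℕ< p) (fromℕ< q))
      go : Dec (b < n) → Dec (a < n) → Dec (c < n) → T (lt a c)
      go (yes q) (yes p) (yes r) = subst T (sym (inside p r)) (transitive P _ _ _ (subst T (inside p q) h) (subst T (inside q r) h′))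
      go _ (no ¬p) _ = subst (λ x → T (lt x c)) (sym (outside-≡ (¬p ∘ proj₁) h)) h′
      go _ _ (no ¬r) = subst (λ x → T (lt a x)) (outside-≡ (¬r ∘ proj₂) h′) h
      go (no ¬q) _ _ = subst (λ x → T (lt x c)) (sym (outside-≡ (¬q ∘ proj₂) h)) h′

    module C (s : ℕ) = Stage.Correct s lt (λ {a} → lt-refl {a}) (λ {a} {b} {c} → lt-trans {a} {b} {c}) (λ {a} {b} → lt-antisym {a} {b})

    label : ℕ → ℕ
    label i = proj₂ (run (table lt (suc i)))

    Narrow : ℕ → List ℕ → Set
    Narrow s D = ¬ Crowded lt (suc s) D

    Labelled : (∀ s → Stage.State s) → ℕ → ℕ → Set
    Labelled ts i ℓ = ∃[ s ] ∃[ c ] s ≤ w × ℓ ≡ s + c * suc w × C.Has s (ts s) i c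

    record GInv (x : ℕ) (st : State) : Set where
      D  = proj₁ st
      ts = proj₂ st
      field
        inv     : ∀ s → C.Inv s (D s) (ts s)
        narrow  : ∀ s → s ≤ w → Narrow s (D s)
        empty   : ∀ {a} → a ∈ D 0 → ⊥
        nested  : ∀ s {a} → a ∈ D s → a ∈ D (suc s)
        old     : ∀ s {a} → a ∈ D s → a < x
        labels  : ∀ {i} → i < x → Labelled ts i (label i)

    narrow-w : ∀ D → (∀ {a} → a ∈ D → a < n) → Narrow w D
    narrow-w D D< (g , g∈ , ind) = proj₂ width (λ i → fromℕ< (D< (g∈ i)))
      λ i j ne → [ no-le i j ne , no-le j i (ne ∘ sym) ]′
      where
      no-le : ∀ i j → i ≢ j → ¬ T (le P (fromℕ< (D< (g∈ i))) (fromℕ< (D< (g∈ j))))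
      no-le i j ne h = ind i j ne (subst T (trans (sym (lt-toℕ _ _)) (cong₂ lt (Fin.toℕ-fromℕ< _) (Fin.toℕ-fromℕ< _))) h)

    initial : GInv 0 (proj₁ (run []))
    initial = record
      { inv = λ s → C.inv-init s ; narrow = λ { s _ (g , g∈ , _) → ¬∈[] (g∈ fzero) } ; empty = λ () ; nested = λ _ () ; old = λ _ () ; labels = λ () }
      where
      ¬∈[] : ∀ {a : ℕ} → a ∈ [] → ⊥
      ¬∈[] ()

    module Next (1≤w : 1 ≤ w) (x : ℕ) (x<n : x < n) (q : ℕ → ℕ → Bool) (q≡ : ∀ {a b} → a < suc x → b < suc x → q a b ≡ lt a b)
                (st : State) (G : GInv x st) (label≡ : label x ≡ proj₂ (next q x st)) where
      open GInv G

      s = stage q D x w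
      r = stageStep q x (D , ts) s
      D′ = add s x D
      ts′ = update s (proj₁ r) ts

      x∷D< : ∀ s {a} → a ∈ x ∷ D s → a < suc x
      x∷D< s (here refl) = ≤-refl
      x∷D< s (there a∈)  = m≤n⇒m≤1+n (old s a∈)

      q-crowded : ∀ {k} s → Crowded lt k (x ∷ D s) → Crowded q k (x ∷ D s)
      q-crowded s (g , g∈ , ind) = g , g∈ , λ i j ne h → ind i j ne (subst T (q≡ (x∷D< s (g∈ i)) (x∷D< s (g∈ j))) h)

      lt-crowded : ∀ {k} s → Crowded q k (x ∷ D s) → Crowded lt k (x ∷ D s)
      lt-crowded s (g , g∈ , ind) = g , g∈ , λ i j ne h → ind i j ne (subst T (sym (q≡ (x∷D< s (g∈ i)) (x∷D< s (g∈ j)))) h)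

      -- For `s′ < w` an antichain of `suc s′` vertices would have given `x` a larger stage; for
      -- `s′ = w` the width of the poset excludes it.
      narrow-x : ∀ s′ → s ≤ s′ → s′ ≤ w → Narrow s′ (x ∷ D s′)
      narrow-x s′ s≤ s′≤ c with m≤n⇒m<n∨m≡n s′≤
      ... | inj₁ s′<w = stage-max q D x w s′ s≤ s′<w (q-crowded s′ c)
      ... | inj₂ refl = narrow-w (x ∷ D w) (λ a∈ → ≤-trans (x∷D< w a∈) x<n) c

      single : Crowded q 1 (x ∷ D 0)
      single = (λ _ → x) , (λ _ → here refl) , λ { fzero fzero ne → ⊥-elim (ne refl) }

      -- The stage is positive, as `x` alone is an antichain of size one. The antichain that
      -- determines the stage must contain `x`, because the earlier vertices of smaller stage
      -- contain no antichain of that size.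
      antichain-x : ∃[ A ] (∀ i → A i ∈ x ∷ D s) × Independent (λ a b → T (lt a b)) {s} A × ∃[ j ] A j ≡ x
      antichain-x = go s refl
        where
        go : ∀ s′ → s ≡ s′ → ∃[ A ] (∀ i → A i ∈ x ∷ D s′) × Independent (λ a b → T (lt a b)) {s′} A × ∃[ j ] A j ≡ x
        go zero    e = ⊥-elim (stage-max q D x w 0 (≤-reflexive e) 1≤w single)
        go (suc s′) e with lt-crowded s′ (stage-crowded q D x w e)
        ... | A , A∈ , ind = A , (λ i → lift (A∈ i)) , ind , has-x (Fin.any? λ j → A j ≟ x)
          where
          lift : ∀ {a} → a ∈ x ∷ D s′ → a ∈ x ∷ D (suc s′)
          lift (here e)   = here e
          lift (there a∈) = there (nested s′ a∈)
          drop-x : ∀ {a} → a ≢ x → a ∈ x ∷ D s′ → a ∈ D s′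
          drop-x ne (here e)   = ⊥-elim (ne e)
          drop-x ne (there a∈) = a∈
          has-x : Dec (∃[ j ] A j ≡ x) → ∃[ j ] A j ≡ x
          has-x (yes p) = p
          has-x (no ¬p) = ⊥-elim (narrow s′ (≤-trans (n≤1+n s′) (≤-trans (≤-reflexive (sym e)) (stage-≤ q D x w)))
            (A , (λ i → drop-x (λ e → ¬p (i , e)) (A∈ i)) , ind))

      correct : C.Inv s (x ∷ D s) (proj₁ r) × C.Has s (proj₁ r) x (proj₂ r) × (∀ {y d} → C.Has s (ts s) y d → C.Has s (proj₁ r) y d)
      correct = let A , A∈ , ind , j , e = antichain-x in
        C.step-correct s (λ a∈ b∈ → q≡ (x∷D< s a∈) (x∷D< s b∈)) (C.inv-mono s there (inv s))
          (λ g g∈ ac → narrow-x s ≤-refl (stage-≤ q D x w) (g , g∈ , ac)) A A∈ ind j e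

      has-new : C.Has s (ts′ s) x (proj₂ r)
      has-new = update-prop (λ s′ st′ → s ≡ s′ → C.Has s′ st′ x (proj₂ r)) s (proj₁ r) ts
        (λ _ → proj₁ (proj₂ correct)) (λ s′ ne e → ⊥-elim (ne e)) s refl

      has-old : ∀ s′ {y d} → C.Has s′ (ts s′) y d → C.Has s′ (ts′ s′) y d
      has-old s′ = update-prop (λ s′ st′ → ∀ {y d} → C.Has s′ (ts s′) y d → C.Has s′ st′ y d) s (proj₁ r) ts
        (proj₂ (proj₂ correct)) (λ s′ _ h → h) s′

      ginv : GInv (suc x) (proj₁ (next q x st))
      ginv = record
        { inv = update-prop (λ s′ st′ → C.Inv s′ (D′ s′) st′) s (proj₁ r) ts
            (subst (λ E → C.Inv s E (proj₁ r)) (sym (add-new s x D s ≤-refl)) (proj₁ correct))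
            (λ s′ _ → C.inv-mono s′ (add-old s x D s′) (inv s′))
        ; narrow = λ s′ s′≤ → nar s′ s′≤ (s ≤? s′)
        ; empty = λ a∈ → [ (λ (_ , s≤0) → stage-max q D x w 0 s≤0 1≤w single) , empty ]′ (add-∈ s x D 0 a∈)
        ; nested = λ s′ a∈ → nest s′ (add-∈ s x D s′ a∈)
        ; old = λ s′ a∈ → [ (λ { (refl , _) → ≤-refl }) , (λ a∈ → m≤n⇒m≤1+n (old s′ a∈)) ]′ (add-∈ s x D s′ a∈)
        ; labels = λ i< → lab (m≤n⇒m<n∨m≡n (≤-pred i<)) }
        where
        nar : ∀ s′ → s′ ≤ w → Dec (s ≤ s′) → Narrow s′ (D′ s′)
        nar s′ s′≤ (yes l) = subst (Narrow s′) (sym (add-new s x D s′ l)) (narrow-x s′ l s′≤)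
        nar s′ s′≤ (no ¬l) = subst (Narrow s′) (sym (add-other s x D s′ ¬l)) (narrow s′ s′≤)
        nest : ∀ s′ {a} → (a ≡ x × s ≤ s′) ⊎ a ∈ D s′ → a ∈ D′ (suc s′)
        nest s′ (inj₁ (refl , l)) = subst (x ∈_) (sym (add-new s x D (suc s′) (m≤n⇒m≤1+n l))) (here refl)
        nest s′ (inj₂ a∈) = add-old s x D (suc s′) (nested s′ a∈)
        lab : ∀ {i} → i < x ⊎ i ≡ x → Labelled ts′ i (label i)
        lab (inj₂ refl) = s , proj₂ r , stage-≤ q D x w , label≡ , has-new
        lab (inj₁ i<) with labels i<
        ... | s′ , c , s′≤ , e , h = s′ , c , s′≤ , e , has-old s′ h

    invariant : 1 ≤ w → ∀ x → x ≤ n → GInv x (proj₁ (run (table lt x)))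
    invariant 1≤w zero    _   = initial
    invariant 1≤w (suc x) x<n = subst (λ y → GInv (suc x) (proj₁ (next (order (table lt (suc x))) y (proj₁ (run (table lt x)))))) (sym (table-length lt x))
      (Next.ginv 1≤w x x<n (order (table lt (suc x))) (order-table lt (suc x)) (proj₁ (run (table lt x)))
        (invariant 1≤w x (<⇒≤ x<n))
        (cong (λ y → proj₂ (next (order (table lt (suc x))) y (proj₁ (run (table lt x))))) (table-length lt x)))

    -- The algorithm replays its whole run from the prefix. Prefix and full poset agree on the
    -- presented vertices and so yield the same table; hence labels issued at different times belong
    -- to one run.
    assign≡label : ∀ i → assign algorithm P i ≡ label (toℕ i)
    assign≡label i = cong (proj₂ ∘ run) (table-cong (suc (toℕ i)) agree)
      where
      agree : ∀ {a b} → a < suc (toℕ i) → b < suc (toℕ i) → extend-le (prefix P i) a b ≡ lt a b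
      agree {a} {b} a< b< with a <? suc (toℕ i) | b <? suc (toℕ i) | a <? n | b <? n
      ... | yes p | yes q | yes p′ | yes q′ = cong₂ (le P)
        (Fin.toℕ-injective (trans (Fin.toℕ-inject≤ _ _) (trans (Fin.toℕ-fromℕ< p) (sym (Fin.toℕ-fromℕ< p′)))))
        (Fin.toℕ-injective (trans (Fin.toℕ-inject≤ _ _) (trans (Fin.toℕ-fromℕ< q) (sym (Fin.toℕ-fromℕ< q′)))))
      ... | no ¬p | _ | _ | _ = ⊥-elim (¬p a<)
      ... | yes _ | no ¬q | _ | _ = ⊥-elim (¬q b<)
      ... | yes _ | yes _ | no ¬p | _ = ⊥-elim (¬p (≤-trans a< (Fin.toℕ<n i)))
      ... | yes _ | yes _ | yes _ | no ¬q = ⊥-elim (¬q (≤-trans b< (Fin.toℕ<n i)))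

    labelled : 1 ≤ w → ∀ i → Labelled (proj₂ (proj₁ (run (table lt n)))) (toℕ i) (assign algorithm P i)
    labelled 1≤w i = subst (Labelled _ (toℕ i)) (sym (assign≡label i)) (GInv.labels (invariant 1≤w n ≤-refl) (Fin.toℕ<n i))

    label-injective : ∀ {s s′} c c′ → s ≤ w → s′ ≤ w → s + c * suc w ≡ s′ + c′ * suc w → s ≡ s′ × c ≡ c′
    label-injective {s} {s′} c c′ s≤ s′≤ e = s≡ , *-cancelʳ-≡ c c′ (suc w) (+-cancelˡ-≡ s′ _ _ (trans (cong (_+ c * suc w) (sym s≡)) e))
      where
      s≡ : s ≡ s′
      s≡ = trans (sym (mod c s≤)) (trans (cong (_% suc w) e) (mod c′ s′≤))
        where
        mod : ∀ {s} c → s ≤ w → (s + c * suc w) % suc w ≡ s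
        mod {s} c s≤ = trans ([m+kn]%n≡m%n s c (suc w)) (m<n⇒m%n≡m (s≤s s≤))

    chain-partition : 1 ≤ w → IsChainPartition algorithm P
    chain-partition 1≤w i j e = go (labelled 1≤w i) (labelled 1≤w j)
      where
      go : Labelled _ (toℕ i) _ → Labelled _ (toℕ j) _ → Comparable P i j
      go (s , c , s≤ , ei , hi) (s′ , c′ , s′≤ , ej , hj) with label-injective c c′ s≤ s′≤ (trans (sym ei) (trans e ej))
      ... | refl , refl with C.inv-comparable s (GInv.inv (invariant 1≤w n ≤-refl) s) hi hj
      ... | inj₁ h = inj₁ (subst T (lt-toℕ i j) h)
      ... | inj₂ h = inj₂ (subst T (lt-toℕ j i) h)

    bound : ℕ
    bound = Growth.F (suc ((w + w) * w)) (suc ⌊log₂ w ⌋) * suc w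

    assign-< : 1 ≤ w → ∀ i → assign algorithm P i < bound
    assign-< 1≤w i with labelled 1≤w i
    ... | s , c , s≤ , e , h = subst (_< bound) (sym e) (<-≤-trans (+-monoˡ-< (c * suc w) (s≤s s≤)) (*-monoˡ-≤ (suc w)
      -- Every stage `s ≤ w` is measured with the parameters of `w`: its ladder bound is at most
      -- `suc ((w + w) * w)`, and `s ≤ w < 2 ^ suc ⌊log₂ w ⌋`.
      (C.inv-bound s (GInv.inv (invariant 1≤w n ≤-refl) s) h (suc ((w + w) * w)) (s≤s (*-mono-≤ (+-mono-≤ s≤ s≤) s≤))
        (suc ⌊log₂ w ⌋) (≤-<-trans s≤ (<2^suc-log w)))))

    uses : 1 ≤ w → UsesAtMost algorithm P bound
    uses 1≤w = code , λ i j e → trans (sym (code-< i)) (trans (cong toℕ e) (code-< j))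
      where
      bound-pos : 0 < bound
      bound-pos = *-mono-≤ {1} (GrowthBounds.F-pos (suc ((w + w) * w)) (suc ⌊log₂ w ⌋)) (s≤s (z≤n {w}))
      code : ℕ → Fin bound
      code ℓ with ℓ <? bound
      ... | yes l = fromℕ< l
      -- A default value, never taken on labels that the algorithm assigns.
      ... | no _  = fromℕ< bound-pos
      code-< : ∀ i → toℕ (code (assign algorithm P i)) ≡ assign algorithm P i
      code-< i with assign algorithm P i <? bound
      ... | yes l = Fin.toℕ-fromℕ< l
      ... | no ¬l = ⊥-elim (¬l (assign-< 1≤w i))

-- Squaring `N` clears the fraction 6.5: the inequality bounds `N` by `w` to the power 6.5
-- `⌊log₂ w ⌋` + `C` / 2, and rounding the logarithm down only strengthens it.
theorem1p2 : Σ ℕ λ C → ∀ (w : ℕ) → 1 ≤ w →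
    Σ ℕ λ N → (N * N ≤ w ^ (13 * ⌊log₂ w ⌋ + C)) × ValAtMost w N
theorem1p2 = 64 , bounds
  where
  bounds : ∀ w → 1 ≤ w → Σ ℕ λ N → (N * N ≤ w ^ (13 * ⌊log₂ w ⌋ + 64)) × ValAtMost w N
  -- Powers of `w` absorb constant factors only from `w = 2` on. For `w = 1` the whole poset is a
  -- chain and one label suffices.
  bounds 1 _ = 1 , ≤-reflexive (sym (^-zeroˡ (13 * ⌊log₂ 1 ⌋ + 64))) , (λ _ _ → 0)
    , λ n P width → (λ i j _ → comparable P width i j) , ((λ _ → fzero) , λ _ _ _ → refl)
    where
    comparable : ∀ {n} (P : OnlinePoset n) → HasWidth P 1 → ∀ i j → Comparable P i j
    comparable P (_ , nar) i j with T? (le P i j) | T? (le P j i)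
    ... | yes h | _     = inj₁ h
    ... | no _  | yes h = inj₂ h
    ... | no ¬h | no ¬k = ⊥-elim (nar (i ◂ λ _ → j) λ
      { fzero fzero ne → ⊥-elim (ne refl) ; fzero (fsuc fzero) _ → [ ¬h , ¬k ]′
      ; (fsuc fzero) fzero _ → [ ¬k , ¬h ]′ ; (fsuc fzero) (fsuc fzero) ne → ⊥-elim (ne refl) })
  bounds w@(suc (suc _)) 1≤w = Growth.F (suc ((w + w) * w)) (suc ⌊log₂ w ⌋) * suc w , total-bound w (s≤s (s≤s z≤n))
    , Online.algorithm w , λ n P width → Online.Run.chain-partition w P width 1≤w , Online.Run.uses w P width 1≤w
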